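{- Let $t$ be a positive integer. There exist constants $d=d(t)$ and $\mu=\mu(t)$ (depending only on $t$) such that for every $K_{t,t}$-induced-minor-free graph $G$ on $n$ vertices, every $A,B\subseteq V(G)$ and every positive integer $k$, one of the following holds: (1) $G$ has an $A$--$B$ separator $S\subseteq V(G)$ whose distance $16\log 2n$-independence number is at most $50k\cdot g\cdot \log^3 2n$, where $g := (12\log^2 2n + 4d + 1)^{\mu}\cdot (2\mu+1)^{4\mu^2+1}$; (2) $G$ contains a collection of $k$ vertex-disjoint $A$--$B$ paths that are pairwise anticomplete.
   Context: All graphs are finite; logarithms are base 2. $H$ is an induced minor of $G$ if there are pairwise disjoint vertex sets $\{X_v\}_{v\in V(H)}$ of $G$, each inducing a connected subgraph, with $uv\in E(H)$ iff some edge of $G$ joins $X_u$ and $X_v$. $K_{t,t}$ is the complete bipartite graph with sides of size $t$. An $A$--$B$ path is a path starting in $A$ and ending in $B$; an $A$--$B$ separator is a set $S$ meeting every $A$--$B$ path. Two paths are anticomplete if they share no vertex and no edge of $G$ joins them. The distance between two vertices is the minimum number of edges of a path joining them; a distance $r$-independent set is a vertex set with pairwise distances strictly greater than $r$, and the distance $r$-independence number of $S$ is the maximum size of such a subset of $S$. -}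

module Defs where

open import Data.Nat using (ℕ; suc; _+_; _*_; _^_; _≤_; _<_; _<ᵇ_)
open import Data.Bool using (Bool; true; false; _xor_)
open import Data.Bool.Properties using (xor-same)
open import Data.Fin using (Fin; toℕ)
open import Data.Fin.Subset using (Subset; _∈_; ∣_∣; _⊆_)
open import Data.List using (List; length)
open import Data.List.NonEmpty using (List⁺; toList; head; last; tail)
open import Data.List.Relation.Unary.Any using (Any)
open import Data.List.Relation.Unary.All using (All)
open import Data.List.Relation.Unary.Linked using (Linked)
open import Data.List.Relation.Unary.Unique.Propositional using (Unique)
open import Data.List.Membership.Propositional renaming (_∈_ to _∈ₗ_)
open import Data.Product using (Σ; _×_; _,_)
open import Relation.Binary.PropositionalEquality using (_≡_; _≢_; refl)
open import Relation.Nullary using (¬_)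
open import Function.Bundles using (_⇔_)

record Graph (n : ℕ) : Set where
  field
    adj    : Fin n → Fin n → Bool
    adj-sym    : ∀ u v → adj u v ≡ adj v u
    adj-irrefl : ∀ u → adj u u ≡ false

Edge : ∀ {n} → Graph n → Fin n → Fin n → Set
Edge G u v = Graph.adj G u v ≡ true

record Path {n : ℕ} (G : Graph n) : Set where
  field
    verts  : List⁺ (Fin n)
    linked : Linked (Edge G) (toList verts)
    unique : Unique (toList verts)

module _ {n : ℕ} {G : Graph n} where
  start end : Path G → Fin n
  start P = head (Path.verts P)
  end   P = last (Path.verts P)

  len : Path G → ℕ
  len P = length (tail (Path.verts P))

  _onPath_ : Fin n → Path G → Set
  v onPath P = v ∈ₗ toList (Path.verts P)

ABPath : ∀ {n} (G : Graph n) → Subset n → Subset n → Path G → Set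
ABPath G A B P = (start P ∈ A) × (end P ∈ B)

Separator : ∀ {n} (G : Graph n) → Subset n → Subset n → Subset n → Set
Separator G A B S = ∀ (P : Path G) → ABPath G A B P → Any (_∈ S) (toList (Path.verts P))

Anticomplete : ∀ {n} {G : Graph n} → Path G → Path G → Set
Anticomplete {G = G} P Q = ∀ x y → x onPath P → y onPath Q → (x ≢ y) × ¬ Edge G x y

-- dist(u,v) > 16 log₂(2n), encoded exactly as: every u--v path has length ℓ
-- with (2n)^16 < 2^ℓ  (i.e. 16·log₂(2n) < ℓ).  Covers infinite distance.
FarApart : ∀ {n} (G : Graph n) → Fin n → Fin n → Set
FarApart {n} G u v = ∀ (P : Path G) → start P ≡ u → end P ≡ v → (2 * n) ^ 16 < 2 ^ len P

DistIndep : ∀ {n} (G : Graph n) → Subset n → Subset n → Set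
DistIndep G S I = (I ⊆ S) × (∀ u v → u ∈ I → v ∈ I → u ≢ v → FarApart G u v)

-- "α ≤ 50 k g log³(2n)" with g = (12 log²(2n) + 4d + 1)^μ (2μ+1)^(4μ²+1),
-- encoded exactly without reals: for every rational p/q > log₂(2n)
-- (i.e. (2n)^q < 2^p), α ≤ 50 k (12 (p/q)² + 4d + 1)^μ (2μ+1)^(4μ²+1) (p/q)³,
-- cleared of denominators.  (Equivalent by monotonicity and right-continuity.)
BoundedBy : (n k d μ α : ℕ) → Set
BoundedBy n k d μ α =
  ∀ (p q : ℕ) → 1 ≤ q → (2 * n) ^ q < 2 ^ p →
    α * q ^ (2 * μ + 3) ≤
      50 * k * (12 * p ^ 2 + (4 * d + 1) * q ^ 2) ^ μ
        * (2 * μ + 1) ^ (4 * μ ^ 2 + 1) * p ^ 3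

IndepNumberBounded : ∀ {n} (G : Graph n) → (k d μ : ℕ) → Subset n → Set
IndepNumberBounded {n} G k d μ S = ∀ I → DistIndep G S I → BoundedBy n k d μ ∣ I ∣

ConnectedIn : ∀ {n} (G : Graph n) → Subset n → Set
ConnectedIn G X = ∀ u v → u ∈ X → v ∈ X →
  Σ (Path G) λ P → (start P ≡ u) × (end P ≡ v) × All (_∈ X) (toList (Path.verts P))

InducedMinor : ∀ {h n} → Graph h → Graph n → Set
InducedMinor {h} {n} H G =
  Σ (Fin h → Subset n) λ X →
    (∀ i → Σ (Fin n) λ v → v ∈ X i) ×
    (∀ i → ConnectedIn G (X i)) ×
    (∀ i j → i ≢ j → ∀ v → v ∈ X i → v ∈ X j → ⊥') ×
    (∀ i j → i ≢ j →
       Edge H i j ⇔ Σ (Fin n) λ u → Σ (Fin n) λ v → (u ∈ X i) × (v ∈ X j) × Edge G u v)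
  where open import Data.Empty renaming (⊥ to ⊥')

private
  xor-comm : ∀ a b → a xor b ≡ b xor a
  xor-comm false false = refl
  xor-comm false true  = refl
  xor-comm true  false = refl
  xor-comm true  true  = refl

Ktt : (t : ℕ) → Graph (t + t)
Ktt t = record
  { adj = λ u v → (toℕ u <ᵇ t) xor (toℕ v <ᵇ t)
  ; adj-sym = λ u v → xor-comm (toℕ u <ᵇ t) (toℕ v <ᵇ t)
  ; adj-irrefl = λ u → xor-same (toℕ u <ᵇ t)
  }

{-# OPTIONS --safe #-}
-- Write L for log₂ 2n.  Give every vertex w the weight x w = 2 ^ (number of chosen paths meeting N[w]), and charge u
-- the cost y u = Σ_w x w · 4 ^ (- dist u w).  If every A–B path is expensive, a random level set of the cost distance
-- from A is a separator, and a Vitali covering by balls of radius at most L (chosen so that the cost inside is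
-- comparable to the weight of the ball) shows that some level set is covered by few balls.  Otherwise a cheapest A–B
-- path is chosen and the weights are updated; as y varies by a factor of at most 4 along an edge, a cheapest path meets
-- each N[v] at most 6 times, and after T rounds each N[v] is met by at most L paths.  So the union U of the chosen paths
-- induces a graph of degree O(L) in which no T / L vertices separate A from B.
--
-- In G[U] we run the Klein–Plotkin–Rao decomposition: t times, components are cut into breadth-first annuli, with one of
-- two shifts each time.  If t + 1 vertices deep inside a piece were pairwise far apart, the t breadth-first cores and the
-- legs joining the vertices to them would form an induced K_{t,t} minor.  Hence for each of the 2 ^ t choices of shifts
-- the clusters of deep vertices have size polynomial in L, and every vertex has its whole neighbourhood inside one
-- cluster for a suitable choice.  For each choice in turn, contract the clusters, apply Menger's theorem, and keep only
-- shortest A–B paths in the resulting disjoint sets of clusters.  This costs a factor of the cluster size, and afterwards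
-- the vertices handled by this choice have only their path neighbours left.  In the end disjoint A–B paths are anticomplete.
module Submission where

open import Defs
open import Data.Bool as Bool using (Bool; true; false; _xor_)
open import Data.Bool.Properties as Boolₚ using ()
open import Data.Empty using (⊥; ⊥-elim)
open import Data.Unit using (⊤; tt)
open import Data.Fin as Fin using (Fin; zero; suc; toℕ; fromℕ<)
open import Data.Fin.Properties as Finₚ using (any?; all?; toℕ-injective; toℕ<n; toℕ-fromℕ<)
open import Data.Fin.Subset as Sub using (Subset)
open import Data.List as List using (List; []; _∷_; _++_; length; map; filter; concatMap; allFin; lookup; cartesianProduct)
open import Data.List.Properties using (length-++; length-tabulate; length-map; filter-accept; filter-reject; filter-notAll; ∷-injective)
open import Data.List.Membership.Propositional using (_∈_; _∉_; lose; find)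
open import Data.List.Membership.Propositional.Properties using (∈-++⁺ˡ; ∈-++⁺ʳ; ∈-++⁻; ∈-map⁺; ∈-map⁻; ∈-filter⁺; ∈-filter⁻; ∈-allFin; ∈-lookup; ∈-tabulate⁺; ∈-cartesianProduct⁺)
open import Data.List.Relation.Unary.Any as Any using (Any; here; there)
open import Data.List.Relation.Unary.All as All using (All; []; _∷_)
open import Data.List.Relation.Unary.AllPairs using (AllPairs; []; _∷_)
open import Data.List.Relation.Unary.Linked using (Linked; []; [-]; _∷_)
open import Data.List.Relation.Unary.Unique.Propositional using (Unique)
open import Data.List.NonEmpty as List⁺ using (List⁺; _∷_)
open import Data.Nat as ℕ using (ℕ; zero; suc; _+_; _*_; _^_; _∸_; _≤_; _<_; z≤n; s≤s; _/_; _%_; _<ᵇ_; NonZero)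
open import Data.Nat.Properties
open import Data.Nat.DivMod
open import Data.Nat.Tactic.RingSolver using (solve-∀)
open import Data.Product using (Σ; ∃; _×_; _,_; proj₁; proj₂)
open import Data.Sum using (_⊎_; inj₁; inj₂; [_,_])
open import Data.Vec as Vec using (Vec)
open import Data.Vec.Properties using (lookup∘tabulate; []=⇒lookup; lookup⇒[]=)
open import Function using (_∘_; id; case_of_; mk⇔; Equivalence)
open import Relation.Binary.PropositionalEquality using (_≡_; _≢_; refl; sym; trans; cong; cong₂; subst; subst₂)
open import Relation.Nullary using (¬_; Dec; yes; no; does; contradiction)
open import Relation.Nullary.Decidable using (map′; _×-dec_; _⊎-dec_; ¬?; decidable-stable; dec-true)
open import Data.List.Relation.Unary.Unique.Propositional.Properties as Uniqueₚ using ()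
open import Relation.Binary.Definitions using (tri<; tri≈; tri>)
open import Data.List.Relation.Unary.Any.Properties as Anyₚ using ()
open import Data.List.Relation.Unary.All.Properties as Allₚ using ()
open import Data.Fin.Subset.Properties as Subₚ using ()

-- Trails and geodesics

-- Base 4 serves two ends. It bounds the change of the charge along an edge, and it multiplies the
-- contribution from outside a ball whenever the radius grows by one. So a ball either carries half
-- of the charge seen from its centre, or that charge at least doubles; as the total weight stays
-- below 2 ^ (`l` + 1), this happens at most `l` times. Charges are scaled by 4 ^ `N` to stay
-- natural numbers; distances are capped at `N` = 2n > `l`, which does not affect the radii in use.
-- The random level becomes an average over all thresholds below the cost of a cheapest path.
--
-- Doubling the weights turns a bound on their total into a logarithmic bound on the hits of a
-- single closed neighbourhood.
--
-- The obstacle in rerouting is that disjoint paths may still be joined by edges. A pass over one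
-- choice of shifts cures only the vertices whose neighbourhood lies in one cluster. The cure is
-- inherited by subsets, and later passes only select among surviving vertices, so the passes can be
-- run one after another; with t fixed, their total price is polylogarithmic.

Rel : ℕ → Set₁
Rel n = Fin n → Fin n → Set

DecRel : ∀ {n} → Rel n → Set
DecRel {n} R = ∀ (u v : Fin n) → Dec (R u v)

SymRel : ∀ {n} → Rel n → Set
SymRel {n} R = ∀ {u v : Fin n} → R u v → R v u

DecPred : ∀ {n} → (Fin n → Set) → Set
DecPred {n} P = ∀ (u : Fin n) → Dec (P u)

-- The list of a trail holds its vertices except the first one.
data Trail {n : ℕ} (R : Rel n) : Fin n → List (Fin n) → Fin n → Set where
  stop : ∀ {u} → Trail R u [] u
  _▸_  : ∀ {u v zs w} → R u v → Trail R v zs w → Trail R u (v ∷ zs) w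

infixr 5 _▸_

module _ {n : ℕ} {R : Rel n} where

  infixr 5 _▸▸_

  _▸▸_ : ∀ {u v w xs ys} → Trail R u xs v → Trail R v ys w → Trail R u (xs ++ ys) w
  stop    ▸▸ q = q
  (e ▸ p) ▸▸ q = e ▸ (p ▸▸ q)

  mapTrail : ∀ {S : Rel n} → (∀ {u v} → R u v → S u v) → ∀ {u zs v} → Trail R u zs v → Trail S u zs v
  mapTrail f stop    = stop
  mapTrail f (e ▸ p) = f e ▸ mapTrail f p

  revTrail : SymRel R → ∀ {u zs v} → Trail R u zs v → Σ (List (Fin n)) λ ys → length ys ≡ length zs × Trail R v ys u
  revTrail s stop = [] , refl , stop
  revTrail s (_▸_ {u} {v} {zs} e p) with revTrail s p
  ... | ys , q , p' = ys ++ (u ∷ []) ,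
        trans (length-++ ys) (trans (+-comm (length ys) 1) (cong suc q)) , p' ▸▸ (s e ▸ stop)

  splitTrail : ∀ {u w} as {z} bs → Trail R u (as ++ z ∷ bs) w → Trail R u (as ++ z ∷ []) z × Trail R z bs w
  splitTrail []       bs (e ▸ p) = (e ▸ stop) , p
  splitTrail (a ∷ as) bs (e ▸ p) with splitTrail as bs p
  ... | q , r = (e ▸ q) , r

Conn : ∀ {n} → Rel n → Fin n → Fin n → Set
Conn R u v = Σ _ λ zs → Trail R u zs v

Within : ∀ {n} → Rel n → ℕ → Fin n → Fin n → Set
Within R k u v = Σ _ λ zs → length zs ≤ k × Trail R u zs v

module _ {n : ℕ} {R : Rel n} where

  conn-refl : ∀ {u} → Conn R u u
  conn-refl = [] , stop

  conn-edge : ∀ {u v} → R u v → Conn R u v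
  conn-edge e = _ , e ▸ stop

  conn-trans : ∀ {u v w} → Conn R u v → Conn R v w → Conn R u w
  conn-trans (_ , p) (_ , q) = _ , p ▸▸ q

  conn-sym : SymRel R → ∀ {u v} → Conn R u v → Conn R v u
  conn-sym s (_ , p) with revTrail s p
  ... | _ , _ , q = _ , q

  conn-map : ∀ {S : Rel n} → (∀ {u v} → R u v → S u v) → ∀ {u v} → Conn R u v → Conn S u v
  conn-map f (_ , p) = _ , mapTrail f p

  within-refl : ∀ {k u} → Within R k u u
  within-refl = [] , z≤n , stop

  within-edge : ∀ {u v} → R u v → Within R 1 u v
  within-edge e = _ , s≤s z≤n , e ▸ stop

  within-trans : ∀ {j k u v w} → Within R j u v → Within R k v w → Within R (j + k) u w
  within-trans (xs , p , f) (ys , q , g) = _ , ≤-trans (≤-reflexive (length-++ xs)) (+-mono-≤ p q) , f ▸▸ g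

  within-sym : SymRel R → ∀ {k u v} → Within R k u v → Within R k v u
  within-sym s (_ , l , p) with revTrail s p
  ... | ys , q , p' = ys , ≤-trans (≤-reflexive q) l , p'

  within-mono : ∀ {j k u v} → j ≤ k → Within R j u v → Within R k u v
  within-mono le (zs , p , f) = zs , ≤-trans p le , f

  within-map : ∀ {S : Rel n} → (∀ {u v} → R u v → S u v) → ∀ {k u v} → Within R k u v → Within S k u v
  within-map f (zs , l , p) = zs , l , mapTrail f p

  within-zero : ∀ {u v} → Within R 0 u v → u ≡ v
  within-zero ([] , _ , stop) = refl

  abstract
    within? : DecRel R → ∀ k u v → Dec (Within R k u v)
    within? R? zero u v with u Fin.≟ v
    ... | yes refl = yes within-refl
    ... | no  u≢v  = no (u≢v ∘ within-zero)
    within? R? (suc k) u v with u Fin.≟ v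
    ... | yes refl = yes within-refl
    ... | no  u≢v  with any? (λ z → R? u z ×-dec within? R? k z v)
    ... | yes (z , e , zs , l , p) = yes (z ∷ zs , s≤s l , e ▸ p)
    ... | no  none = no λ where
      ([] , _ , stop) → u≢v refl
      (z ∷ zs , s≤s l , e ▸ p) → none (z , e , zs , l , p)

abstract
  least : ∀ {P : ℕ → Set} → (∀ k → Dec (P k)) → ∀ k → P k → Σ ℕ λ j → P j × j ≤ k × (∀ i → P i → j ≤ i)
  least P? zero p = zero , p , z≤n , λ _ _ → z≤n
  least {P} P? (suc k) p with P? zero
  ... | yes p₀ = zero , p₀ , z≤n , λ _ _ → z≤n
  ... | no ¬p₀ with least (P? ∘ suc) k p
  ... | j , pj , j≤k , min = suc j , pj , s≤s j≤k , λ where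
          zero    p₀ → contradiction p₀ ¬p₀
          (suc i) pi → s≤s (min i pi)

abstract
  leastVertex : ∀ {n} {P : Fin n → Set} → DecPred P → ∃ P → Σ (Fin n) λ v → P v × (∀ w → P w → toℕ v ≤ toℕ w)
  leastVertex {suc n} {P} P? (x , px) with P? zero
  ... | yes p₀ = zero , p₀ , λ _ _ → z≤n
  ... | no ¬p₀ with x
  ...   | zero   = contradiction px ¬p₀
  ...   | suc x' with leastVertex (P? ∘ suc) (x' , px)
  ...     | v , pv , min = suc v , pv , λ where
            zero    p₀ → contradiction p₀ ¬p₀
            (suc w) pw → s≤s (min w pw)

-- Shortest among all trails from `A` to `B`, not only among those with the same two ends. This is
-- why it meets `A` and `B` only at its ends and has no shortcuts. Values of `at` beyond `ℓ` carry
-- no meaning.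
record Geodesic {n : ℕ} (R : Rel n) (A B : Fin n → Set) : Set where
  field
    at      : ℕ → Fin n
    ℓ     : ℕ
    at-A    : A (at 0)
    at-B    : B (at ℓ)
    step    : ∀ {i} → i < ℓ → R (at i) (at (suc i))
    minimal : ∀ {a zs b} → A a → B b → Trail R a zs b → ℓ ≤ length zs

  before : ∀ i → i ≤ ℓ → Σ _ λ zs → length zs ≡ i × Trail R (at 0) zs (at i)
  before zero    _ = [] , refl , stop
  before (suc i) l with before i (<⇒≤ l)
  ... | zs , q , p = zs ++ (at (suc i) ∷ []) ,
        trans (length-++ zs) (trans (+-comm (length zs) 1) (cong suc q)) , p ▸▸ (step l ▸ stop)

  after : ∀ m i → m + i ≡ ℓ → Σ _ λ zs → length zs ≡ m × Trail R (at i) zs (at ℓ)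
  after zero    i refl = [] , refl , stop
  after (suc m) i q with after m (suc i) (trans (+-suc m i) q)
  ... | zs , q' , p = at (suc i) ∷ zs , cong suc q' , step (≤-trans (s≤s (m≤n+m i m)) (≤-reflexive q)) ▸ p

  A-first : ∀ {i} → i ≤ ℓ → A (at i) → i ≡ 0
  A-first {i} i≤ a with after (ℓ ∸ i) i (m∸n+n≡m i≤)
  ... | zs , q , p = n≤0⇒n≡0 (+-cancelˡ-≤ (ℓ ∸ i) i 0
          (≤-trans (≤-reflexive (m∸n+n≡m i≤))
            (≤-trans (minimal a at-B p) (≤-reflexive (trans q (sym (+-identityʳ _)))))))

  B-last : ∀ {i} → i ≤ ℓ → B (at i) → i ≡ ℓ
  B-last {i} i≤ b with before i i≤
  ... | zs , q , p = ≤-antisym i≤ (≤-trans (minimal at-A b p) (≤-reflexive q))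

  -- An edge that skips a position forwards would give a shorter trail. For symmetric `R` this makes
  -- the geodesic an induced path.
  edge-bound : ∀ {i j} → i ≤ ℓ → j ≤ ℓ → R (at i) (at j) → j ≤ suc i
  edge-bound {i} {j} i≤ j≤ e with before i i≤ | after (ℓ ∸ j) j (m∸n+n≡m j≤)
  ... | xs , q , p | ys , q' , p' = +-cancelˡ-≤ (ℓ ∸ j) j (suc i)
          (≤-trans (≤-reflexive (m∸n+n≡m j≤))
            (≤-trans (minimal at-A at-B (p ▸▸ e ▸ p'))
              (≤-reflexive (trans (length-++ xs) (trans (cong₂ (λ a b → a + suc b) q q')
                (trans (+-suc i _) (+-comm (suc i) (ℓ ∸ j))))))))

  inj-bound : ∀ {i j} → i ≤ ℓ → j ≤ ℓ → at i ≡ at j → j ≤ i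
  inj-bound {i} {j} i≤ j≤ e with before i i≤ | after (ℓ ∸ j) j (m∸n+n≡m j≤)
  ... | xs , q , p | ys , q' , p' rewrite e = +-cancelˡ-≤ (ℓ ∸ j) j i
          (≤-trans (≤-reflexive (m∸n+n≡m j≤))
            (≤-trans (minimal at-A at-B (p ▸▸ p'))
              (≤-reflexive (trans (length-++ xs) (trans (cong₂ _+_ q q') (+-comm i _))))))

  injective : ∀ {i j} → i ≤ ℓ → j ≤ ℓ → at i ≡ at j → i ≡ j
  injective i≤ j≤ e = ≤-antisym (inj-bound j≤ i≤ (sym e)) (inj-bound i≤ j≤ e)

nth : ∀ {n} → Fin n → List (Fin n) → ℕ → Fin n
nth u zs       zero    = u
-- A default beyond the end of the trail; every use is restricted to positions up to its length.
nth u []       (suc i) = u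
nth u (z ∷ zs) (suc i) = nth z zs i

nth-end : ∀ {n} {R : Rel n} {u zs v} → Trail R u zs v → nth u zs (length zs) ≡ v
nth-end stop    = refl
nth-end (e ▸ p) = nth-end p

nth-step : ∀ {n} {R : Rel n} {u zs v} → Trail R u zs v → ∀ {i} → i < length zs → R (nth u zs i) (nth u zs (suc i))
nth-step (e ▸ p) {zero}  _       = e
nth-step (e ▸ p) {suc i} (s≤s l) = nth-step p l

abstract
  geodesic : ∀ {n} {R : Rel n} {A B : Fin n → Set} → DecRel R → DecPred A → DecPred B →
             ∀ {a zs b} → A a → B b → Trail R a zs b → Geodesic R A B
  geodesic {n} {R} {A} {B} R? A? B? {a₀} {zs₀} {b₀} Aa₀ Bb₀ p₀
    with least (λ k → any? λ a → any? λ b → A? a ×-dec B? b ×-dec within? R? k a b) (length zs₀)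
               (a₀ , b₀ , Aa₀ , Bb₀ , zs₀ , ≤-refl , p₀)
  ... | k , (a , b , Aa , Bb , zs , l , p) , _ , min = record
    { at      = nth a zs
    ; ℓ     = length zs
    ; at-A    = Aa
    ; at-B    = subst B (sym (nth-end p)) Bb
    ; step    = nth-step p
    ; minimal = λ {a'} {ys} {b'} Aa' Bb' q → ≤-trans l (min _ (a' , b' , Aa' , Bb' , ys , ≤-refl , q))
    }

geodesic₂ : ∀ {n} {R : Rel n} → DecRel R → ∀ {u v} → Conn R u v → Geodesic R (u ≡_) (v ≡_)
geodesic₂ R? {u} {v} (zs , p) = geodesic R? (u Fin.≟_) (v Fin.≟_) refl refl p

-- A shortest trail visits `ℓ` + 1 distinct vertices, so `ℓ` < `n`. The bound reduces connectivity
-- to a finite search.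
conn⇒within : ∀ {n} {R : Rel n} → DecRel R → ∀ {u v} → Conn R u v → Within R n u v
conn⇒within {n} {R} R? {u} {v} c = shorten
  where
  g = geodesic₂ R? c
  open Geodesic g
  bound : ℓ < n
  bound = Finₚ.injective⇒≤ {f = λ (i : Fin (suc ℓ)) → at (toℕ i)}
            (λ {i} {j} e → toℕ-injective (injective (≤-pred (toℕ<n i)) (≤-pred (toℕ<n j)) e))
  shorten : Within R n u v
  shorten with before ℓ ≤-refl
  ... | zs , q , p = zs , ≤-trans (≤-reflexive q) (<⇒≤ bound) ,
                     subst₂ (λ a b → Trail R a zs b) (sym at-A) (sym at-B) p

abstract
  conn? : ∀ {n} {R : Rel n} → DecRel R → ∀ u v → Dec (Conn R u v)
  conn? {n} R? u v = map′ (λ (zs , _ , p) → zs , p) (conn⇒within R?) (within? R? n u v)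

-- The smallest vertex of a component serves as its canonical representative.
module _ {n : ℕ} {R : Rel n} (R? : DecRel R) (R-sym : SymRel R) where

  abstract
    root : Fin n → Fin n
    root u = proj₁ (leastVertex (conn? R? u) (u , conn-refl))

    root-conn : ∀ u → Conn R u (root u)
    root-conn u = proj₁ (proj₂ (leastVertex (conn? R? u) (u , conn-refl)))

    conn⇒root≡ : ∀ {u v} → Conn R u v → root u ≡ root v
    conn⇒root≡ {u} {v} c = toℕ-injective (≤-antisym
        (proj₂ (proj₂ (leastVertex (conn? R? u) (u , conn-refl))) _ (conn-trans c (root-conn v)))
        (proj₂ (proj₂ (leastVertex (conn? R? v) (v , conn-refl))) _ (conn-trans (conn-sym R-sym c) (root-conn u))))

    root≡⇒conn : ∀ {u v} → root u ≡ root v → Conn R u v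
    root≡⇒conn {u} {v} e = conn-trans (root-conn u)
      (subst (λ r → Conn R r v) (sym e) (conn-sym R-sym (root-conn v)))

-- Menger's theorem

inj-length : ∀ {X : Set} {k} (f : Fin k → X) → (∀ {i j} → f i ≡ f j → i ≡ j) →
             ∀ L → (∀ i → f i ∈ L) → k ≤ length L
inj-length f inj L mem = Finₚ.injective⇒≤ {f = λ i → Any.index (mem i)} λ {i} {j} e →
  inj (trans (Anyₚ.lookup-index (mem i)) (trans (cong (lookup L) e) (sym (Anyₚ.lookup-index (mem j)))))

fin-inverse : ∀ {k} (π : Fin k → Fin k) → (∀ {i j} → π i ≡ π j → i ≡ j) → ∀ p → Σ (Fin k) λ i → π i ≡ p
fin-inverse {zero}  π inj ()
fin-inverse {suc k} π inj p with any? (λ i → π i Fin.≟ p)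
... | yes found = found
... | no  none  = contradiction
        (Finₚ.injective⇒≤ {f = λ i → Fin.punchOut {i = p} {j = π i} (λ e → none (i , sym e))}
          (λ {i} {j} e → inj (Finₚ.punchOut-injective (λ e → none (i , sym e)) (λ e → none (j , sym e)) e)))
        (<⇒≱ ≤-refl)

lookup-injective : ∀ {X : Set} {L : List X} → Unique L → ∀ i j → lookup L i ≡ lookup L j → i ≡ j
lookup-injective (_ ∷ _)  zero    zero    _ = refl
lookup-injective (ds ∷ _) zero    (suc j) e = contradiction e (All.lookup ds (∈-lookup j))
lookup-injective (ds ∷ _) (suc i) zero    e = contradiction (sym e) (All.lookup ds (∈-lookup i))
lookup-injective (_ ∷ us) (suc i) (suc j) e = cong suc (lookup-injective us i j e)

module _ {n : ℕ} {R : Rel n} where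

  end∈ : ∀ {u zs v} → Trail R u zs v → v ∈ u ∷ zs
  end∈ stop    = here refl
  end∈ (e ▸ p) = there (end∈ p)

  prefixAt : ∀ {u zs w v} → Trail R u zs w → v ∈ u ∷ zs → Σ (List (Fin n)) λ as → Trail R u as v ×
             (∀ {s} → s ∈ u ∷ as → s ∈ u ∷ zs)
  prefixAt p       (here refl) = [] , stop , λ { (here e) → here e }
  prefixAt (e ▸ p) (there m) with prefixAt p m
  ... | as , q , sub = _ , e ▸ q , λ { (here r) → here r ; (there k) → there (sub k) }

  suffixAt : ∀ {u zs w v} → Trail R u zs w → v ∈ u ∷ zs → Σ (List (Fin n)) λ bs → Trail R v bs w ×
             (∀ {s} → s ∈ v ∷ bs → s ∈ u ∷ zs)
  suffixAt p       (here refl) = _ , p , λ m → m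
  suffixAt (e ▸ p) (there m) with suffixAt p m
  ... | bs , q , sub = bs , q , there ∘ sub

record SetTrail {n : ℕ} (R : Rel n) (A B : Fin n → Set) : Set where
  field
    {first last} : Fin n
    {rest}       : List (Fin n)
    first∈       : A first
    last∈        : B last
    trail        : Trail R first rest last

  vertices : List (Fin n)
  vertices = first ∷ rest

open SetTrail using (vertices)

DisjointTrails : ∀ {n} → Rel n → (A B : Fin n → Set) → ℕ → Set
DisjointTrails R A B k = Σ (Fin k → SetTrail R A B) λ P →
  ∀ {i j v} → v ∈ vertices (P i) → v ∈ vertices (P j) → i ≡ j

Separates : ∀ {n} → Rel n → (A B : Fin n → Set) → List (Fin n) → Set
Separates R A B Z = ∀ {a zs b} → A a → B b → Trail R a zs b → Σ _ λ v → v ∈ a ∷ zs × v ∈ Z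

module _ {n : ℕ} {R : Rel n} {T : Fin n → Set} (T? : DecPred T) where

  -- `prefix` expresses that the initial trail meets `T` at its end only: a vertex of `T` on the
  -- part up to `v` forces `v` and that vertex to be the hit. This is the form in which `Glue.cross`
  -- needs it.
  record FirstHit {A : Fin n → Set} (P : SetTrail R A T) : Set where
    open SetTrail P using (first)
    field
      {hit}   : Fin n
      {upto}  : List (Fin n)
      hit∈    : T hit
      initial : Trail R first upto hit
      within  : ∀ {v} → v ∈ first ∷ upto → v ∈ vertices P
      prefix  : ∀ {v} → v ∈ first ∷ upto → Σ (List (Fin n)) λ as → Trail R first as v ×
                (∀ {s} → s ∈ first ∷ as → s ∈ first ∷ upto) ×
                (∀ {s} → s ∈ first ∷ as → T s → v ≡ hit × s ≡ hit)

  firstHit : ∀ {A} (P : SetTrail R A T) → FirstHit P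
  firstHit P = go (SetTrail.last∈ P) (SetTrail.first∈ P) (SetTrail.trail P)
    where
    go : ∀ {A u zs v} (Tv : T v) (Au : A u) (p : Trail R u zs v) →
         FirstHit {A} (record { first∈ = Au ; last∈ = Tv ; trail = p })
    go {u = u} Tv Au p with T? u
    go Tv Au p       | yes Tu = record
      { hit∈ = Tu ; initial = stop ; within = λ { (here e) → here e }
      ; prefix = λ { (here refl) → [] , stop , (λ m → m) , λ { (here e) _ → refl , e } } }
    go Tv Au stop    | no ¬Tu = contradiction Tv ¬Tu
    go Tv Au (e ▸ p) | no ¬Tu = record
      { hit∈ = hit∈ ; initial = e ▸ initial
      ; within = λ { (here q) → here q ; (there m) → there (within m) }
      ; prefix = λ where
          (here refl) → [] , stop , (λ { (here q) → here q }) , λ { (here refl) Ts → contradiction Ts ¬Tu }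
          (there m) → let as , q , sub , only = prefix m in
            _ , e ▸ q , (λ { (here q) → here q ; (there m) → there (sub m) }) ,
            λ { (here refl) Ts → contradiction Ts ¬Tu ; (there m) Ts → only m Ts } }
      where open FirstHit (go {A = λ _ → ⊤} Tv tt p)

  record LastHit {u w : Fin n} {zs : List (Fin n)} (p : Trail R u zs w) : Set where
    field
      {hit}  : Fin n
      {from} : List (Fin n)
      hit∈   : T hit
      final  : Trail R hit from w
      within : ∀ {v} → v ∈ hit ∷ from → v ∈ u ∷ zs
      suffix : ∀ {v} → v ∈ hit ∷ from → Σ (List (Fin n)) λ bs → Trail R v bs w ×
               (∀ {s} → s ∈ v ∷ bs → s ∈ hit ∷ from) ×
               (∀ {s} → s ∈ v ∷ bs → T s → v ≡ hit × s ≡ hit)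

  lastHit? : ∀ {u zs w} (p : Trail R u zs w) → LastHit p ⊎ (∀ {s} → s ∈ u ∷ zs → ¬ T s)
  lastHit? {u} stop with T? u
  ... | yes Tu = inj₁ record
        { hit∈ = Tu ; final = stop ; within = λ m → m
        ; suffix = λ { (here refl) → [] , stop , (λ m → m) , λ { (here e) _ → refl , e } } }
  ... | no ¬Tu = inj₂ λ { (here refl) → ¬Tu }
  lastHit? {u} (e ▸ p) with lastHit? p
  ... | inj₁ h = inj₁ record
        { hit∈ = hit∈ ; final = final ; within = there ∘ within ; suffix = suffix }
    where open LastHit h
  ... | inj₂ none with T? u
  ...   | yes Tu = inj₁ record
          { hit∈ = Tu ; final = e ▸ p ; within = λ m → m
          ; suffix = λ where
              (here refl) → _ , e ▸ p , (λ m → m) ,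
                λ { (here q) _ → refl , q ; (there m) Ts → contradiction Ts (none m) }
              (there m) → let bs , q , sub = suffixAt p m in
                bs , q , there ∘ sub , λ k Ts → contradiction Ts (none (sub k)) }
  ...   | no ¬Tu = inj₂ λ { (here refl) → ¬Tu ; (there m) → none m }

  lastHit : ∀ {B} (Q : SetTrail R T B) → LastHit (SetTrail.trail Q)
  lastHit Q with lastHit? (SetTrail.trail Q)
  ... | inj₁ h    = h
  ... | inj₂ none = contradiction (SetTrail.first∈ Q) (none (here refl))

ListEdge : ∀ {n} → List (Fin n × Fin n) → Rel n
ListEdge es u v = (u , v) ∈ es

module _ {n : ℕ} {x y : Fin n} {es : List (Fin n × Fin n)} where

  firstUse : ∀ {a zs b} → Trail (ListEdge ((x , y) ∷ es)) a zs b → Trail (ListEdge es) a zs b ⊎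
             Σ _ λ ys → Trail (ListEdge es) a ys x × (∀ {s} → s ∈ a ∷ ys → s ∈ a ∷ zs)
  firstUse stop = inj₁ stop
  firstUse (here refl ▸ p) = inj₂ ([] , stop , λ { (here q) → here q })
  firstUse (there e ▸ p) with firstUse p
  ... | inj₁ q = inj₁ (e ▸ q)
  ... | inj₂ (ys , q , sub) = inj₂ (_ , e ▸ q , λ { (here r) → here r ; (there m) → there (sub m) })

  lastUse : ∀ {a zs b} → Trail (ListEdge ((x , y) ∷ es)) a zs b → Trail (ListEdge es) a zs b ⊎
            Σ _ λ ys → Trail (ListEdge es) y ys b × (∀ {s} → s ∈ y ∷ ys → s ∈ a ∷ zs)
  lastUse stop = inj₁ stop
  lastUse (e ▸ p) with lastUse p
  ... | inj₂ (ys , q , sub) = inj₂ (ys , q , there ∘ sub)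
  lastUse (here refl ▸ p) | inj₁ q = inj₂ (_ , q , there)
  lastUse (there e ▸ p)   | inj₁ q = inj₁ (e ▸ q)

_∈?_ : ∀ {n} (v : Fin n) (L : List (Fin n)) → Dec (v ∈ L)
v ∈? L = Any.any? (v Fin.≟_) L

-- If S separates A from B once the edge xy is removed, then trails into x ∷ S and out of y ∷ S
-- only meet in S, so they can be glued along S and the edge xy.
module Glue {n : ℕ} {x y : Fin n} {es : List (Fin n × Fin n)} {A B : Fin n → Set} (S : List (Fin n))
  (sep : Separates (ListEdge es) A B S)
  (P : Fin (suc (length S)) → SetTrail (ListEdge es) A (_∈ x ∷ S))
  (Q : Fin (suc (length S)) → SetTrail (ListEdge es) (_∈ y ∷ S) B)
  (P-disjoint : ∀ {i j v} → v ∈ vertices (P i) → v ∈ vertices (P j) → i ≡ j)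
  (Q-disjoint : ∀ {i j v} → v ∈ vertices (Q i) → v ∈ vertices (Q j) → i ≡ j)
  (into : ∀ i → FirstHit (_∈? (x ∷ S)) (P i))
  (out : ∀ i → LastHit (_∈? (y ∷ S)) (SetTrail.trail (Q i)))
  (into-end : ∀ i → FirstHit.hit (into i) ≡ lookup (x ∷ S) i)
  (out-start : ∀ i → LastHit.hit (out i) ≡ lookup (y ∷ S) i) where

  private
    module P i = FirstHit (into i)
    module Q i = LastHit (out i)
    Pv Qv : Fin (suc (length S)) → List (Fin n)
    Pv i = SetTrail.first (P i) ∷ P.upto i
    Qv i = Q.hit i ∷ Q.from i

    P-disj : ∀ {i j v} → v ∈ Pv i → v ∈ Pv j → i ≡ j
    P-disj m m' = P-disjoint (P.within _ m) (P.within _ m')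
    Q-disj : ∀ {i j v} → v ∈ Qv i → v ∈ Qv j → i ≡ j
    Q-disj m m' = Q-disjoint (Q.within _ m) (Q.within _ m')

    P-end∈ : ∀ r → lookup S r ∈ Pv (suc r)
    P-end∈ r = subst (_∈ Pv (suc r)) (into-end (suc r)) (end∈ (P.initial (suc r)))
    Q-start∈ : ∀ r → lookup S r ∈ Qv (suc r)
    Q-start∈ r = here (sym (out-start (suc r)))

    -- Following `P p` to `v` and then `Q q` gives an `A`-`B` trail without the edge xy, so it meets
    -- `S`. The first-hit and last-hit properties force the meeting point to be `v`, and its index
    -- in `S` then determines both `p` and `q`.
    cross : ∀ {p q v} → v ∈ Pv p → v ∈ Qv q → p ≡ q
    cross {p} {q} {v} m m' with P.prefix p m | Q.suffix q m'
    ... | as , f , subP , onlyP | bs , g , subQ , onlyQ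
      with sep (SetTrail.first∈ (P p)) (SetTrail.last∈ (Q q)) (f ▸▸ g)
    ... | s , s∈ , s∈S with ∈-++⁻ (_ ∷ as) s∈
    ...   | inj₁ s∈as = trans p≡ (Q-disj (Q-start∈ r) (subst (_∈ Qv q) (trans v≡s s≡) m'))
      where
      r  = Any.index s∈S
      s≡ = Anyₚ.lookup-index s∈S
      p≡ : p ≡ suc r
      p≡ = P-disj (subP s∈as) (subst (_∈ Pv (suc r)) (sym s≡) (P-end∈ r))
      v≡s : v ≡ s
      v≡s = trans (proj₁ (onlyP s∈as (there s∈S))) (sym (proj₂ (onlyP s∈as (there s∈S))))
    ...   | inj₂ s∈bs = trans (P-disj m (subst (_∈ Pv (suc r)) (sym (trans v≡s s≡)) (P-end∈ r))) (sym q≡)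
      where
      r  = Any.index s∈S
      s≡ = Anyₚ.lookup-index s∈S
      q≡ : q ≡ suc r
      q≡ = Q-disj (subQ (there s∈bs)) (subst (_∈ Qv (suc r)) (sym s≡) (Q-start∈ r))
      v≡s : v ≡ s
      v≡s = trans (proj₁ (onlyQ (there s∈bs) (there s∈S))) (sym (proj₂ (onlyQ (there s∈bs) (there s∈S))))

    R' : Rel n
    R' = ListEdge ((x , y) ∷ es)

    join : ∀ p → Σ (SetTrail R' A B) λ W → ∀ {v} → v ∈ vertices W → v ∈ Pv p ⊎ v ∈ Qv p
    join zero = record { first∈ = SetTrail.first∈ (P zero) ; last∈ = SetTrail.last∈ (Q zero)
                       ; trail = mapTrail there (P.initial zero) ▸▸
                                 (here (cong₂ _,_ (into-end zero) (out-start zero)) ▸ mapTrail there (Q.final zero)) } ,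
                λ m → ∈-++⁻ (Pv zero) m
    join (suc r) = record { first∈ = SetTrail.first∈ (P (suc r)) ; last∈ = SetTrail.last∈ (Q (suc r))
                          ; trail = mapTrail there (P.initial (suc r)) ▸▸
                                    subst (λ h → Trail R' h (Q.from (suc r)) _)
                                          (trans (out-start (suc r)) (sym (into-end (suc r))))
                                          (mapTrail there (Q.final (suc r))) } ,
                   λ m → [ inj₁ , inj₂ ∘ there ] (∈-++⁻ (Pv (suc r)) m)

  glue : DisjointTrails (ListEdge ((x , y) ∷ es)) A B (suc (length S))
  glue = (λ p → proj₁ (join p)) , λ {p} {q} m m' → disj (proj₂ (join p) m) (proj₂ (join q) m')
    where
    disj : ∀ {p q v} → v ∈ Pv p ⊎ v ∈ Qv p → v ∈ Pv q ⊎ v ∈ Qv q → p ≡ q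
    disj (inj₁ m) (inj₁ m') = P-disj m m'
    disj (inj₁ m) (inj₂ m') = cross m m'
    disj (inj₂ m) (inj₁ m') = sym (cross m' m)
    disj (inj₂ m) (inj₂ m') = Q-disj m m'

module _ {n : ℕ} {x y : Fin n} {es : List (Fin n × Fin n)} {A B : Fin n → Set} (S : List (Fin n))
  (sep : Separates (ListEdge es) A B S)
  (Ps : DisjointTrails (ListEdge es) A (_∈ x ∷ S) (suc (length S)))
  (Qs : DisjointTrails (ListEdge es) (_∈ y ∷ S) B (suc (length S))) where

  private
    module P i = FirstHit (firstHit (_∈? (x ∷ S)) (proj₁ Ps i))
    module Q i = LastHit (lastHit (_∈? (y ∷ S)) (proj₁ Qs i))

    π ρ : Fin (suc (length S)) → Fin (suc (length S))
    π i = Any.index (P.hit∈ i)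
    ρ i = Any.index (Q.hit∈ i)

    π-inj : ∀ {i j} → π i ≡ π j → i ≡ j
    π-inj {i} {j} e = proj₂ Ps (P.within i (end∈ (P.initial i)))
      (P.within j (subst (_∈ _) (trans (Anyₚ.lookup-index (P.hit∈ j))
        (trans (cong (lookup (x ∷ S)) (sym e)) (sym (Anyₚ.lookup-index (P.hit∈ i))))) (end∈ (P.initial j))))
    ρ-inj : ∀ {i j} → ρ i ≡ ρ j → i ≡ j
    ρ-inj {i} {j} e = proj₂ Qs (Q.within i (here refl))
      (Q.within j (here (trans (Anyₚ.lookup-index (Q.hit∈ i))
        (trans (cong (lookup (y ∷ S)) e) (sym (Anyₚ.lookup-index (Q.hit∈ j)))))))

    I J : ∀ p → _
    I p = fin-inverse π π-inj p
    J p = fin-inverse ρ ρ-inj p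

  -- Disjoint trails hit different entries, and there are as many trails as entries; hence every
  -- entry is hit once and the trails can be numbered by the entries they hit.
  reindexGlue : DisjointTrails (ListEdge ((x , y) ∷ es)) A B (suc (length S))
  reindexGlue = Glue.glue S sep (λ p → proj₁ Ps (proj₁ (I p))) (λ p → proj₁ Qs (proj₁ (J p)))
    (λ {p} {q} m m' → trans (sym (proj₂ (I p))) (trans (cong π (proj₂ Ps m m')) (proj₂ (I q))))
    (λ {p} {q} m m' → trans (sym (proj₂ (J p))) (trans (cong ρ (proj₂ Qs m m')) (proj₂ (J q))))
    (λ p → firstHit (_∈? (x ∷ S)) (proj₁ Ps (proj₁ (I p))))
    (λ p → lastHit (_∈? (y ∷ S)) (proj₁ Qs (proj₁ (J p))))
    (λ p → trans (Anyₚ.lookup-index (P.hit∈ (proj₁ (I p)))) (cong (lookup (x ∷ S)) (proj₂ (I p))))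
    (λ p → trans (Anyₚ.lookup-index (Q.hit∈ (proj₁ (J p)))) (cong (lookup (y ∷ S)) (proj₂ (J p))))

-- Göring's proof, by induction on the edge list of a directed graph.
menger : ∀ {n} (es : List (Fin n × Fin n)) {A B : Fin n → Set} → DecPred A → DecPred B → ∀ k →
         (Σ (List (Fin n)) λ Z → length Z < k × Separates (ListEdge es) A B Z) ⊎
         DisjointTrails (ListEdge es) A B k
menger {n} [] {A} {B} A? B? k with length Z ℕ.<? k
  where Z = filter (λ v → A? v ×-dec B? v) (allFin n)
... | yes l = inj₁ (_ , l , λ { Aa Bb stop → _ , here refl , ∈-filter⁺ _ (∈-allFin _) (Aa , Bb) ; _ _ (() ▸ _) })
... | no ≮  = inj₂ (P , disj)
  where
  Z = filter (λ v → A? v ×-dec B? v) (allFin n)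
  pick : Fin k → Fin (length Z)
  pick i = Fin.inject≤ i (≮⇒≥ ≮)
  prop : ∀ i → A (lookup Z (pick i)) × B (lookup Z (pick i))
  prop i = proj₂ (∈-filter⁻ (λ v → A? v ×-dec B? v) {xs = allFin n} (∈-lookup {xs = Z} (pick i)))
  P : Fin k → SetTrail (ListEdge []) A B
  P i = record { first∈ = proj₁ (prop i) ; last∈ = proj₂ (prop i) ; trail = stop }
  disj : ∀ {i j v} → v ∈ vertices (P i) → v ∈ vertices (P j) → i ≡ j
  disj {i} {j} (here refl) (here e) = Finₚ.inject≤-injective (≮⇒≥ ≮) (≮⇒≥ ≮) i j
    (lookup-injective (Uniqueₚ.filter⁺ (λ v → A? v ×-dec B? v) (Uniqueₚ.allFin⁺ n)) (pick i) (pick j) e)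
menger {n} ((x , y) ∷ es) {A} {B} A? B? k with menger es A? B? k
... | inj₂ (P , disj) = inj₂ ((λ i → let open SetTrail (P i) in
        record { first∈ = first∈ ; last∈ = last∈ ; trail = mapTrail there trail }) , disj)
... | inj₁ (S , l , sep) with <-cmp (suc (length S)) k
...   | tri> _ _ k≤ = contradiction l (<⇒≱ k≤)
...   | tri< l' _ _ = inj₁ (x ∷ S , l' , λ Aa Bb p → case firstUse p of λ where
          (inj₁ q) → let v , m , s = sep Aa Bb q in v , m , there s
          (inj₂ (ys , q , sub)) → x , sub (end∈ q) , here refl)
-- The only tight case: `S` is one short of `k`. An `A`-`B` trail, cut before its first use of xy or
-- at a vertex of `S`, contains a trail of the smaller graph from `A` to `x ∷ S`. So a small
-- separator of these two also separates `A` from `B`; the same holds for `y ∷ S` and `B`. If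
-- neither exists, both systems of trails do.
...   | tri≈ _ refl _ with menger es A? (_∈? (x ∷ S)) (suc (length S)) | menger es (_∈? (y ∷ S)) B? (suc (length S))
...     | inj₁ (Z , lZ , sepZ) | _ = inj₁ (Z , lZ , λ Aa Bb p → case firstUse p of λ where
            (inj₂ (ys , q , sub)) → let v , m , z = sepZ Aa (here refl) q in v , sub m , z
            (inj₁ q) → let s , m , s∈S = sep Aa Bb q
                           as , r , sub = prefixAt q m
                           v , m' , z = sepZ Aa (there s∈S) r in v , sub m' , z)
...     | inj₂ _ | inj₁ (Z , lZ , sepZ) = inj₁ (Z , lZ , λ Aa Bb p → case lastUse p of λ where
            (inj₂ (ys , q , sub)) → let v , m , z = sepZ (here refl) Bb q in v , sub m , z
            (inj₁ q) → let s , m , s∈S = sep Aa Bb q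
                           bs , r , sub = suffixAt q m
                           v , m' , z = sepZ (there s∈S) Bb r in v , sub m' , z)
...     | inj₂ Ps | inj₂ Qs = inj₂ (reindexGlue S sep Ps Qs)

-- Klein–Plotkin–Rao decomposition

record Level (n : ℕ) : Set₁ where
  field
    E     : Rel n
    E?    : DecRel E
    E-sym : SymRel E

  top : Fin n → Fin n
  top = root E? E-sym

  top-conn : ∀ u → Conn E (top u) u
  top-conn u = conn-sym E-sym (root-conn E? E-sym u)

  abstract
    depth-data : ∀ u → Σ ℕ λ j → Within E j (top u) u × j ≤ n × (∀ i → Within E i (top u) u → j ≤ i)
    depth-data u = least (λ k → within? E? k (top u) u) n (conn⇒within E? (top-conn u))

    depth : Fin n → ℕ
    depth u = proj₁ (depth-data u)

    depth-within : ∀ u → Within E (depth u) (top u) u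
    depth-within u = proj₁ (proj₂ (depth-data u))

    depth-min : ∀ {k u} → Within E k (top u) u → depth u ≤ k
    depth-min {k} {u} = proj₂ (proj₂ (proj₂ (depth-data u))) k

    depth-lipschitz : ∀ {k u v} → Within E k u v → depth v ≤ depth u + k
    depth-lipschitz {k} {u} {v} (zs , l , p) = depth-min
      (subst (λ r → Within E (depth u + k) r v) (conn⇒root≡ E? E-sym (zs , p))
        (within-trans (depth-within u) (zs , l , p)))

-- `Λ s` bounds the radius of the branch sets around the far points after `s` levels. An annulus of
-- `width s` is twice as wide as its central zone, which keeps distance `Λ s` + 1 from both borders.
-- Of `gap s`, the part `Λ s` keeps the branch sets off the core and the 2 excludes edges between
-- core and annulus. A new leg crosses at most the gap and one annulus, whence the recursion.
Λ width gap : ℕ → ℕ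
Λ zero    = 0
Λ (suc s) = gap s + width s
width s = 4 + 4 * Λ s
gap s = 2 + Λ s

offset : ℕ → Bool → ℕ
offset s true  = 2 + 2 * Λ s
offset s false = 0

Λ≤Λ : ∀ s → Λ s ≤ Λ (suc s)
Λ≤Λ s = ≤-trans (m≤n+m (Λ s) 2) (m≤m+n (gap s) (width s))

/-unique : ∀ k w y .{{_ : NonZero w}} → k * w ≤ y → y < k * w + w → y / w ≡ k
/-unique k w y lo hi = ≤-antisym
  (≤-pred (m<n*o⇒m/o<n (≤-trans hi (≤-reflexive (+-comm (k * w) w)))))
  (≤-trans (≤-reflexive (sym (m*n/n≡m k w))) (/-monoˡ-≤ w lo))

module Annuli {n : ℕ} (L : Level n) (s : ℕ) (b : Bool) where
  open Level L

  shifted ring : Fin n → ℕ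
  shifted u = depth u + offset s b
  ring u = shifted u / width s

  ring-lower : ∀ u → ring u * width s ≤ shifted u
  ring-lower u = m/n*n≤m (shifted u) (width s)

  ring-upper : ∀ u → shifted u < ring u * width s + width s
  ring-upper u = ≤-trans (s≤s (≤-reflexive (m≡m%n+[m/n]*n (shifted u) (width s))))
    (≤-trans (+-monoˡ-< (ring u * width s) (m%n<n (shifted u) (width s))) (≤-reflexive (+-comm (width s) _)))

  -- At least `Λ s` away from both borders, so that the ball of radius `Λ s` stays inside the
  -- annulus and survives the refinement.
  Deep : Fin n → Set
  Deep u = ring u * width s + Λ s ≤ shifted u × shifted u + Λ s < ring u * width s + width s

  refined : Level n
  refined = record
    { E     = λ u v → E u v × ring u ≡ ring v
    ; E?    = λ u v → E? u v ×-dec (ring u ℕ.≟ ring v)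
    ; E-sym = λ (e , q) → E-sym e , sym q
    }

  ring-conn : ∀ {u v} → Conn (Level.E refined) u v → ring u ≡ ring v
  ring-conn (_ , stop)          = refl
  ring-conn (_ , (e , q) ▸ p) = trans q (ring-conn (_ , p))

  shifted-lipschitz : ∀ {k u v} → Within E k u v → shifted v ≤ shifted u + k
  shifted-lipschitz {k} {u} {v} wi = ≤-trans (+-monoˡ-≤ (offset s b) (depth-lipschitz wi))
    (≤-reflexive (trans (+-assoc (depth u) k _) (trans (cong (depth u +_) (+-comm k _)) (sym (+-assoc (depth u) _ k)))))

  deep-ring : ∀ {k u v} → Deep u → k ≤ Λ s → Within E k u v → ring v ≡ ring u
  deep-ring {k} {u} {v} (lo , hi) k≤ wi = /-unique (ring u) (width s) (shifted v)
    (+-cancelʳ-≤ (Λ s) _ _ (≤-trans lo (≤-trans (shifted-lipschitz (within-sym E-sym wi)) (+-monoʳ-≤ (shifted v) k≤))))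
    (≤-trans (s≤s (≤-trans (shifted-lipschitz wi) (+-monoʳ-≤ (shifted u) k≤))) hi)

  deep-within : ∀ {u v} → Deep u → Within E (Λ s) u v → Within (Level.E refined) (Λ s) u v
  deep-within {u} {v} deep (zs , l , p) = zs , l , go p within-refl l
    where
    go : ∀ {a x ys} → Trail E x ys v → Within E a u x → a + length ys ≤ Λ s → Trail (Level.E refined) x ys v
    go stop    wi le = stop
    go {a} {x} (_▸_ {v = y} {ys} e p) wi le =
      (e , trans (deep-ring deep (≤-trans (m≤m+n a _) le) wi) (sym (deep-ring deep (≤-trans (m≤m+n (suc a) _) le') wi')))
      ▸ go p wi' le'
      where
      wi' : Within E (suc a) u y
      wi' = within-mono (≤-reflexive (+-comm a 1)) (within-trans wi (within-edge e))
      le' : suc a + length ys ≤ Λ s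
      le' = ≤-trans (≤-reflexive (sym (+-suc a _))) le

  deep? : DecPred Deep
  deep? u = (_ ℕ.≤? _) ×-dec (_ ℕ.<? _)

module _ (a w : ℕ) .{{_ : NonZero w}} (w≡ : w ≡ 4 + 4 * a) where

  Central : ℕ → Set
  Central y = y / w * w + suc a ≤ y × y + suc a < y / w * w + w

  private
    central : ∀ k m {y} → y ≡ k * w + m → suc a ≤ m → m + suc a < w → Central y
    central k m {y} refl lo hi = subst (λ q → q * w + suc a ≤ y × y + suc a < q * w + w) (sym q≡)
      (+-monoʳ-≤ (k * w) lo , ≤-trans (s≤s (≤-reflexive (+-assoc (k * w) m (suc a)))) (+-monoʳ-< (k * w) hi))
      where
      q≡ : y / w ≡ k
      q≡ = /-unique k w y (m≤m+n _ m) (+-monoʳ-< (k * w) (≤-trans (s≤s (m≤m+n m (suc a))) hi))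

    central-from : ∀ k r → r < w → Central (k * w + r) ⊎ Central (k * w + r + (2 + 2 * a))
    central-from k r r<w with suc a ℕ.≤? r
    ... | no ≰ = inj₂ (central k (r + (2 + 2 * a)) (+-assoc (k * w) r _)
                    (≤-trans (≤-trans (s≤s (m≤n+m a (suc a))) (≤-reflexive (lem₁ a))) (m≤n+m _ r))
                    (≤-trans (s≤s (+-monoˡ-≤ (suc a) (+-monoˡ-≤ (2 + 2 * a) (≤-pred (≰⇒> ≰)))))
                      (≤-reflexive (trans (lem₂ a) (sym w≡)))))
      where
      lem₁ : ∀ a → suc (suc a + a) ≡ 2 + 2 * a
      lem₁ = solve-∀
      lem₂ : ∀ a → suc (a + (2 + 2 * a) + suc a) ≡ 4 + 4 * a
      lem₂ = solve-∀
    ... | yes lo with r + suc a ℕ.<? w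
    ...   | yes hi = inj₁ (central k r refl lo hi)
    ...   | no ≮   = inj₂ (central (suc k) m y≡ m-lo m-hi)
      where
      m = r + (2 + 2 * a) ∸ w
      lem₃ : ∀ a r → r + (2 + 2 * a) ≡ r + suc a + suc a
      lem₃ = solve-∀
      w≤ : w + suc a ≤ r + (2 + 2 * a)
      w≤ = ≤-trans (+-monoˡ-≤ (suc a) (≮⇒≥ ≮)) (≤-reflexive (sym (lem₃ a r)))
      m+w : m + w ≡ r + (2 + 2 * a)
      m+w = m∸n+n≡m (≤-trans (m≤m+n w (suc a)) w≤)
      y≡ : k * w + r + (2 + 2 * a) ≡ suc k * w + m
      y≡ = trans (+-assoc (k * w) r _) (trans (cong (k * w +_) (sym m+w)) (lem₄ (k * w) m w))
        where
        lem₄ : ∀ x m w → x + (m + w) ≡ w + x + m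
        lem₄ = solve-∀
      m-lo : suc a ≤ m
      m-lo = +-cancelʳ-≤ w _ _ (≤-trans (≤-reflexive (+-comm (suc a) w)) (≤-trans w≤ (≤-reflexive (sym m+w))))
      m-hi : m + suc a < w
      m-hi = +-cancelʳ-< w _ _ (≤-trans (s≤s (≤-reflexive (trans (lem₅ m a w) (cong (_+ suc a) m+w))))
               (≤-trans (+-monoˡ-≤ (suc a) (+-monoˡ-≤ (2 + 2 * a) r<w))
                 (≤-trans (≤-reflexive (lem₆ w a)) (+-monoʳ-≤ w (≤-trans (lem₇ a) (≤-reflexive (sym w≡)))))))
        where
        lem₅ : ∀ m a w → m + suc a + w ≡ m + w + suc a
        lem₅ = solve-∀
        lem₆ : ∀ w a → w + (2 + 2 * a) + suc a ≡ w + (3 + 3 * a)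
        lem₆ = solve-∀
        lem₇ : ∀ a → 3 + 3 * a ≤ 4 + 4 * a
        lem₇ a = +-mono-≤ (n≤1+n 3) (*-monoˡ-≤ a (n≤1+n 3))

  -- Modulo `w` the central residues form an interval of 2 + 2a elements, exactly half a period. A
  -- residue outside it enters it when translated by half a period.
  central-shift : ∀ d → Central (d + 0) ⊎ Central (d + (2 + 2 * a))
  central-shift d with central-from (d / w) (d % w) (m%n<n d w)
  ... | inj₁ c = inj₁ (subst Central (trans (trans (+-comm _ (d % w)) (sym (m≡m%n+[m/n]*n d w))) (sym (+-identityʳ d))) c)
  ... | inj₂ c = inj₂ (subst (λ x → Central (x + (2 + 2 * a))) (trans (+-comm _ (d % w)) (sym (m≡m%n+[m/n]*n d w))) c)

central-offset : ∀ s d → Σ Bool λ b → Central (Λ s) (width s) refl (d + offset s b)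
central-offset s d with central-shift (Λ s) (width s) refl d
... | inj₁ c = false , c
... | inj₂ c = true , c

module _ {n : ℕ} (L : Level n) (s : ℕ) (b : Bool) where
  open Level L
  open Annuli L s b

  -- `Central` asks for one unit more than `Deep`; that unit pays for the change of depth along the
  -- edge.
  central-edge : ∀ {u v} → Central (Λ s) (width s) refl (shifted u) → E u v →
                 Level.E refined u v × Deep u × Deep v
  central-edge {u} {v} (lo , hi) e = (e , sym ring≡) , deep-u , deep-v
    where
    v≤ : shifted v ≤ suc (shifted u)
    v≤ = ≤-trans (shifted-lipschitz (within-edge e)) (≤-reflexive (+-comm _ 1))
    u≤ : shifted u ≤ suc (shifted v)
    u≤ = ≤-trans (shifted-lipschitz (within-edge (E-sym e))) (≤-reflexive (+-comm _ 1))
    κ = ring u * width s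
    lo' : κ + Λ s ≤ shifted v
    lo' = ≤-pred (≤-trans (≤-trans (≤-reflexive (sym (+-suc κ _))) lo) u≤)
    hi' : shifted v + Λ s < κ + width s
    hi' = ≤-trans (s≤s (≤-trans (+-monoˡ-≤ (Λ s) v≤) (≤-reflexive (sym (+-suc (shifted u) _))))) hi
    deep-u : Deep u
    deep-u = ≤-trans (+-monoʳ-≤ κ (n≤1+n (Λ s))) lo , ≤-trans (s≤s (+-monoʳ-≤ (shifted u) (n≤1+n (Λ s)))) hi
    ring≡ : ring v ≡ ring u
    ring≡ = /-unique (ring u) (width s) (shifted v) (≤-trans (m≤m+n κ _) lo') (≤-trans (s≤s (m≤m+n _ (Λ s))) hi')
    deep-v : Deep v
    deep-v = subst (λ q → q * width s + Λ s ≤ shifted v × shifted v + Λ s < q * width s + width s) (sym ring≡) (lo' , hi')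

module Decomposition {n : ℕ} (L₀ : Level n) where
  open Level

  level : List Bool → Level n
  level []      = L₀
  level (b ∷ σ) = Annuli.refined (level σ) (length σ) b

  AllDeep : List Bool → Fin n → Set
  AllDeep []      u = ⊤
  AllDeep (b ∷ σ) u = Annuli.Deep (level σ) (length σ) b u × AllDeep σ u

  allDeep? : ∀ σ → DecPred (AllDeep σ)
  allDeep? []      u = yes tt
  allDeep? (b ∷ σ) u = Annuli.deep? (level σ) (length σ) b u ×-dec allDeep? σ u

  level⊆ : ∀ σ {u v} → E (level σ) u v → E L₀ u v
  level⊆ []      e       = e
  level⊆ (b ∷ σ) (e , _) = level⊆ σ e

  -- Connected vertices share their ring at every level, so no edge of `L₀` between them was ever
  -- cut: the components of a level are induced subgraphs. Depth arguments in a level thus apply to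
  -- edges of the whole graph.
  level-induced : ∀ σ {u v} → E L₀ u v → Conn (E (level σ)) u v → E (level σ) u v
  level-induced []      e c = e
  level-induced (b ∷ σ) e c = level-induced σ e (conn-map proj₁ c) , Annuli.ring-conn (level σ) (length σ) b c

  CoreEdge : List Bool → Rel n
  CoreEdge σ u v = E (level σ) u v × AllDeep σ u × AllDeep σ v

  -- A suitable shift at every level puts a vertex so deep inside its annulus that its neighbours are deep as well.
  core-cover : ∀ t u → Σ (List Bool) λ σ → length σ ≡ t × (∀ {v} → E L₀ u v → CoreEdge σ u v)
  core-cover zero    u = [] , refl , λ e → e , tt , tt
  core-cover (suc t) u = extend (core-cover t u)
    where
    extend : (Σ (List Bool) λ σ → length σ ≡ t × (∀ {v} → E L₀ u v → CoreEdge σ u v)) →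
             Σ (List Bool) λ σ → length σ ≡ suc t × (∀ {v} → E L₀ u v → CoreEdge σ u v)
    extend (σ , q , cov) = b ∷ σ , cong suc q , λ e →
        let e' , Du , Dv = cov e
            e″ , du , dv = central-edge (level σ) (length σ) b (proj₂ (central-offset (length σ) (depth (level σ) u))) e'
        in e″ , (du , Du) , (dv , Dv)
      where b = proj₁ (central-offset (length σ) (depth (level σ) u))

-- From far points of a cluster to a complete bipartite induced minor

_↾_ : ∀ {n} → Rel n → (Fin n → Set) → Rel n
(R ↾ X) u v = R u v × X u × X v

module _ {n : ℕ} (L : Level n) where
  open Level L

  depth-geodesic : ∀ {r y} → top y ≡ r → (g : Geodesic E (r ≡_) (y ≡_)) →
                   let open Geodesic g in ∀ {i} → i ≤ ℓ → depth (at i) ≡ i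
  depth-geodesic {r} {y} top≡ g {i} i≤ = ≤-antisym
      (let zs , q , p = before i i≤ in
       depth-min (zs , ≤-reflexive q , subst (λ a → Trail E a zs (at i)) (trans (sym at-A) (sym top-at)) p))
      (let zs , q , p = after (ℓ ∸ i) i (m∸n+n≡m i≤)
           ys , l , p' = depth-within (at i)
       in +-cancelˡ-≤ (ℓ ∸ i) i _ (≤-trans (≤-reflexive (m∸n+n≡m i≤))
            (≤-trans (minimal (sym top-at) at-B (p' ▸▸ p))
              (≤-trans (≤-reflexive (trans (length-++ ys) (+-comm (length ys) _)))
                (+-mono-≤ (≤-reflexive q) l)))))
    where
    open Geodesic g
    top-at : top (at i) ≡ r
    top-at = trans (conn⇒root≡ E? E-sym (let zs , _ , p = after (ℓ ∸ i) i (m∸n+n≡m i≤) in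
                      zs , subst (Trail E (at i) zs) (sym at-B) p)) top≡

module Branching {n : ℕ} (L₀ : Level n) {q : ℕ} (x : Fin (suc (suc q)) → Fin n) (D : ℕ)
  (far : ∀ {i j} → i ≢ j → ¬ Within (Level.E L₀) D (x i) (x j)) where

  open Decomposition L₀
  open Level L₀ using () renaming (E to E₀; E-sym to E₀-sym)

  Apart : (X Y : Fin n → Set) → Set
  Apart X Y = ∀ {u v} → X u → Y v → u ≢ v × ¬ E₀ u v

  -- Each level contributes one set `A` and lengthens every set `B`. Edges between different sets
  -- `B` are not excluded here: `B-near` and the distance of the far points rule them out at the
  -- end.
  record Model (σ : List Bool) : Set₁ where
    field
      A       : Fin (length σ) → Fin n → Set
      A?      : ∀ i → DecPred (A i)
      hub     : Fin (length σ) → Fin n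
      hub∈    : ∀ i → A i (hub i)
      A-conn  : ∀ i {v} → A i v → Conn (E₀ ↾ A i) (hub i) v
      A-apart : ∀ {i j} → i ≢ j → Apart (A i) (A j)
      B       : Fin (suc (suc q)) → Fin n → Set
      B?      : ∀ j → DecPred (B j)
      x∈      : ∀ j → B j (x j)
      B-conn  : ∀ j {z} → B j z → Conn (E₀ ↾ B j) (x j) z
      B-near  : ∀ j {z} → B j z → Within E₀ (Λ (length σ)) (x j) z
      A∩B     : ∀ i j {v} → A i v → B j v → ⊥
      A-B     : ∀ i j → Σ (Fin n) λ u → Σ (Fin n) λ v → A i u × B j v × E₀ u v
      -- All that later levels add lies in the current component, so these two keep the construction going.
      A-comp  : ∀ i → Apart (A i) (Conn (Level.E (level σ)) (x zero))
      B-comp  : ∀ j {z} → B j z → Conn (Level.E (level σ)) (x zero) z →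
                Within (Level.E (level σ)) (Λ (length σ)) (x j) z

  base : Model []
  base = record
    { A = λ () ; A? = λ () ; hub = λ () ; hub∈ = λ () ; A-conn = λ () ; A-apart = λ { {()} }
    ; B = λ j z → x j ≡ z ; B? = λ j z → x j Fin.≟ z ; x∈ = λ j → refl
    ; B-conn = λ { j refl → conn-refl } ; B-near = λ { j refl → within-refl }
    ; A∩B = λ () ; A-B = λ () ; A-comp = λ () ; B-comp = λ { j refl _ → within-refl } }

  module Step (b : Bool) (σ : List Bool)
    (x-conn′ : ∀ j → Conn (Level.E (level (b ∷ σ))) (x zero) (x j))
    (deep : ∀ j → Annuli.Deep (level σ) (length σ) b (x j))
    (room : Λ (suc (length σ)) + Λ (suc (length σ)) ≤ D)
    (M : Model σ) where

    open Model M
    s = length σ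
    open Level (level σ)
    open Annuli (level σ) s b
    open Level refined using () renaming (E to E′)

    x-conn : ∀ j → Conn E (x zero) (x j)
    x-conn j = conn-map proj₁ (x-conn′ j)

    r : Fin n
    r = top (x zero)

    κ : ℕ
    κ = ring (x zero) * width s

    top-comp : ∀ {v} → Conn E (x zero) v → top v ≡ r
    top-comp c = sym (conn⇒root≡ E? E-sym c)

    ring-x : ∀ j → ring (x j) ≡ ring (x zero)
    ring-x j = sym (ring-conn (x-conn′ j))

    lower : ∀ {v} → ring v ≡ ring (x zero) → κ ≤ shifted v
    lower {v} e = ≤-trans (≤-reflexive (cong (_* width s) (sym e))) (ring-lower v)

    upper : ∀ {v} → ring v ≡ ring (x zero) → shifted v < κ + width s
    upper {v} e = ≤-trans (ring-upper v) (≤-reflexive (cong (λ k → k * width s + width s) e))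

    -- Otherwise the whole annulus is close to its centre, while x 0 and x 1 are far apart.
    off-centre : offset s b + gap s ≤ κ
    off-centre with offset s b + gap s ℕ.≤? κ
    ... | yes p = p
    ... | no ≰ = ⊥-elim (far {zero} {suc zero} (λ ()) (within-map (level⊆ σ) (within-mono room
            (within-trans (within-sym E-sym (near zero)) (near (suc zero))))))
      where
      near : ∀ j → Within E (Λ (suc s)) r (x j)
      near j = subst (λ a → Within E _ a (x j)) (top-comp (x-conn j)) (within-mono
        (+-cancelʳ-≤ (offset s b) _ _ (<⇒≤ (≤-trans (upper (ring-x j))
          (≤-trans (+-monoˡ-≤ (width s) (<⇒≤ (≰⇒> ≰)))
            (≤-reflexive (trans (+-assoc (offset s b) (gap s) (width s)) (+-comm (offset s b) _)))))))
        (depth-within (x j)))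

    -- The deepest layer of the core; `gap s` layers remain between it and the annulus. By
    -- `off-centre` the subtraction is not truncated.
    h : ℕ
    h = κ ∸ (offset s b + gap s)

    h+ : h + gap s + offset s b ≡ κ
    h+ = trans (+-assoc h _ _) (trans (cong (h +_) (+-comm (gap s) _)) (m∸n+n≡m off-centre))

    low : ∀ {v} → κ ≤ shifted v → h + gap s ≤ depth v
    low l = +-cancelʳ-≤ (offset s b) _ _ (≤-trans (≤-reflexive h+) l)

    geo : ∀ j → Geodesic E (r ≡_) (x j ≡_)
    geo j = geodesic₂ E? (conn-trans (top-conn (x zero)) (x-conn j))

    module G j = Geodesic (geo j)

    depth-at : ∀ j {i} → i ≤ G.ℓ j → depth (G.at j i) ≡ i
    depth-at j = depth-geodesic (level σ) (top-comp (x-conn j)) (geo j)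

    ℓ≡ : ∀ j → G.ℓ j ≡ depth (x j)
    ℓ≡ j = trans (sym (depth-at j ≤-refl)) (cong depth (sym (G.at-B j)))

    at-comp : ∀ j {i} → i ≤ G.ℓ j → Conn E (x zero) (G.at j i)
    at-comp j {i} i≤ = conn-trans (conn-sym E-sym (top-conn (x zero)))
      (let zs , _ , p = G.before j i i≤ in zs , subst (λ a → Trail E a zs (G.at j i)) (sym (G.at-A j)) p)

    h+gap≤ℓ : ∀ j → h + gap s ≤ G.ℓ j
    h+gap≤ℓ j = ≤-trans (low (lower (ring-x j))) (≤-reflexive (sym (ℓ≡ j)))

    h<ℓ : ∀ j → h < G.ℓ j
    h<ℓ j = ≤-trans (≤-trans (≤-reflexive (+-comm 1 h)) (+-monoʳ-≤ h (s≤s z≤n))) (h+gap≤ℓ j)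

    Core : Fin n → Set
    Core v = Conn E (x zero) v × depth v ≤ h

    r-conn : Conn E (x zero) r
    r-conn = conn-sym E-sym (top-conn (x zero))

    r∈Core : Core r
    r∈Core = r-conn , ≤-trans (depth-min (subst (λ a → Within E 0 a r) (sym (top-comp r-conn)) within-refl)) z≤n

    core-conn : ∀ {v} → Core v → Conn (E₀ ↾ Core) r v
    core-conn {v} (c , d≤) = subst₂ (Conn (E₀ ↾ Core)) (sym g.at-A) (sym g.at-B) (go g.ℓ ≤-refl)
      where
      g₀ : Geodesic E (r ≡_) (v ≡_)
      g₀ = geodesic₂ E? (conn-trans (top-conn (x zero)) c)
      module g = Geodesic g₀
      depth≡ : ∀ {i} → i ≤ g.ℓ → depth (g.at i) ≡ i
      depth≡ = depth-geodesic (level σ) (top-comp c) g₀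
      ℓ≤h : g.ℓ ≤ h
      ℓ≤h = ≤-trans (≤-reflexive (trans (sym (depth≡ ≤-refl)) (cong depth (sym g.at-B)))) d≤
      in-core : ∀ {i} → i ≤ g.ℓ → Core (g.at i)
      in-core {i} i≤ = conn-trans r-conn (let zs , _ , p = g.before i i≤ in zs , subst (λ a → Trail E a zs (g.at i)) (sym g.at-A) p) ,
                       ≤-trans (≤-reflexive (depth≡ i≤)) (≤-trans i≤ ℓ≤h)
      go : ∀ i → i ≤ g.ℓ → Conn (E₀ ↾ Core) (g.at 0) (g.at i)
      go zero    _  = conn-refl
      go (suc i) i< = conn-trans (go i (<⇒≤ i<))
        (conn-edge (level⊆ σ (g.step i<) , in-core (<⇒≤ i<) , in-core i<))

    -- The part of the shortest path from the root to `x j` below the core. Its first vertex is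
    -- adjacent to the core, which supplies the edge required by `A-B`.
    Leg : Fin (suc (suc q)) → Fin n → Set
    Leg j v = Σ (Fin (suc (G.ℓ j))) λ i → h < toℕ i × G.at j (toℕ i) ≡ v

    leg : ∀ j {i} → h < i → i ≤ G.ℓ j → Leg j (G.at j i)
    leg j h<i i≤ = fromℕ< (s≤s i≤) , subst (h <_) (sym (toℕ-fromℕ< (s≤s i≤))) h<i , cong (G.at j) (toℕ-fromℕ< (s≤s i≤))

    B′ : Fin (suc (suc q)) → Fin n → Set
    B′ j v = B j v ⊎ Leg j v

    leg-conn : ∀ j m {i} → h < i → m + i ≡ G.ℓ j → Conn (E₀ ↾ B′ j) (x j) (G.at j i)
    leg-conn j zero    h<i refl = subst (Conn _ (x j)) (G.at-B j) conn-refl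
    leg-conn j (suc m) {i} h<i e = conn-trans (leg-conn j m (m<n⇒m<1+n h<i) (trans (+-suc m i) e))
        (conn-edge (level⊆ σ (E-sym (G.step j i<ℓ)) , inj₂ (leg j (m<n⇒m<1+n h<i) i<ℓ) , inj₂ (leg j h<i (<⇒≤ i<ℓ))))
      where
      i<ℓ : i < G.ℓ j
      i<ℓ = ≤-trans (s≤s (m≤n+m i m)) (≤-reflexive e)

    leg-length : ∀ j {i} → h < i → G.ℓ j ∸ i ≤ Λ (suc s)
    leg-length j {i} h<i = ≤-trans (∸-mono ℓ≤ (<⇒≤ h<i)) (≤-reflexive (m+n∸m≡n h _))
      where
      lem : ∀ h g o w → h + g + o + w ≡ h + (g + w) + o
      lem = solve-∀
      ℓ≤ : G.ℓ j ≤ h + Λ (suc s)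
      ℓ≤ = +-cancelʳ-≤ (offset s b) _ _ (≤-trans (+-monoˡ-≤ (offset s b) (≤-reflexive (ℓ≡ j)))
             (≤-trans (<⇒≤ (upper (ring-x j)))
               (≤-reflexive (trans (cong (_+ width s) (sym h+)) (lem h (gap s) (offset s b) (width s))))))

    leg-near : ∀ j {i} → h < i → i ≤ G.ℓ j → Within E (Λ (suc s)) (x j) (G.at j i)
    leg-near j {i} h<i i≤ = within-sym E-sym (let zs , e , p = G.after j (G.ℓ j ∸ i) i (m∸n+n≡m i≤) in
      zs , ≤-trans (≤-reflexive e) (leg-length j h<i) , subst (Trail E _ zs) (sym (G.at-B j)) p)

    -- From a vertex of the annulus onwards a leg only descends, down to the depth of `x j` in the
    -- same annulus; so this part of it survives the refinement.
    leg-comp : ∀ j m {i} → κ ≤ i + offset s b → m + i ≡ G.ℓ j → Within E′ m (x j) (G.at j i)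
    leg-comp j zero    κ≤ refl = subst (Within _ 0 (x j)) (G.at-B j) within-refl
    leg-comp j (suc m) {i} κ≤ e = within-mono (≤-reflexive (+-comm m 1)) (within-trans
        (leg-comp j m κ≤′ (trans (+-suc m i) e))
        (within-edge (E-sym (G.step j i<ℓ) , trans (ring-at i<ℓ κ≤′) (sym (ring-at (<⇒≤ i<ℓ) κ≤)))))
      where
      κ≤′ : κ ≤ suc i + offset s b
      κ≤′ = m≤n⇒m≤1+n κ≤
      i<ℓ : i < G.ℓ j
      i<ℓ = ≤-trans (s≤s (m≤n+m i m)) (≤-reflexive e)
      ring-at : ∀ {i} → i ≤ G.ℓ j → κ ≤ i + offset s b → ring (G.at j i) ≡ ring (x zero)
      ring-at {i} i≤ κ≤ = /-unique (ring (x zero)) (width s) _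
        (≤-trans κ≤ (≤-reflexive (cong (_+ offset s b) (sym (depth-at j i≤)))))
        (≤-trans (s≤s (+-monoˡ-≤ (offset s b) (≤-trans (≤-reflexive (depth-at j i≤)) (≤-trans i≤ (≤-reflexive (ℓ≡ j))))))
          (upper (ring-x j)))

    -- Depths differ by at least `gap s` ≥ 2, while an edge changes the depth by at most 1.
    core-apart : ∀ {u v} → Core u → Conn E′ (x zero) v → u ≢ v × ¬ E₀ u v
    core-apart {u} {v} (c , d≤h) c′ =
        (λ { refl → <⇒≱ (m<m+n h {gap s} (s≤s z≤n)) (≤-trans deep-v d≤h) }) ,
        λ e → <⇒≱ (+-monoʳ-< h (s≤s (s≤s z≤n)))
          (≤-trans deep-v (≤-trans (depth-lipschitz (within-edge (level-induced σ e (conn-trans (conn-sym E-sym c) (conn-map proj₁ c′)))))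
            (+-monoˡ-≤ 1 d≤h)))
      where
      deep-v : h + gap s ≤ depth v
      deep-v = low (lower (sym (ring-conn c′)))

    -- A vertex of `B j` in this component is within `Λ s` of `x j`, whose depth is at least
    -- `h + gap s`; two layers are left between it and the core.
    core-B : ∀ j {v} → Core v → B j v → ⊥
    core-B j {v} (c , d≤h) v∈B = <⇒≱ (+-monoʳ-< h (m<n+m (Λ s) {2} (s≤s z≤n)))
      (≤-trans (low (lower (ring-x j))) (≤-trans (depth-lipschitz (within-sym E-sym (B-comp j v∈B c))) (+-monoˡ-≤ (Λ s) d≤h)))

    A′ : Fin (suc s) → Fin n → Set
    A′ zero    = Core
    A′ (suc i) = A i

    leg-member : ∀ j {v} → Leg j v → Σ ℕ λ i → h < i × i ≤ G.ℓ j × G.at j i ≡ v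
    leg-member j (i , h<i , e) = toℕ i , h<i , ≤-pred (toℕ<n i) , e

    extended : Model (b ∷ σ)
    extended = record
      { A = A′
      ; A? = λ { zero v → conn? E? (x zero) v ×-dec (depth v ℕ.≤? h) ; (suc i) → A? i }
      ; hub = λ { zero → r ; (suc i) → hub i }
      ; hub∈ = λ { zero → r∈Core ; (suc i) → hub∈ i }
      ; A-conn = λ { zero → core-conn ; (suc i) → A-conn i }
      ; A-apart = A′-apart
      ; B = B′
      ; B? = λ j v → B? j v ⊎-dec any? (λ i → (h ℕ.<? toℕ i) ×-dec (G.at j (toℕ i) Fin.≟ v))
      ; x∈ = λ j → inj₁ (x∈ j)
      ; B-conn = λ where
          j (inj₁ m) → conn-map (λ (e , a , c) → e , inj₁ a , inj₁ c) (B-conn j m)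
          j (inj₂ m) → let i , h<i , i≤ , e = leg-member j m in
            subst (Conn _ (x j)) e (leg-conn j (G.ℓ j ∸ i) h<i (m∸n+n≡m i≤))
      ; B-near = λ where
          j (inj₁ m) → within-mono (Λ≤Λ s) (B-near j m)
          j (inj₂ m) → let i , h<i , i≤ , e = leg-member j m in
            subst (Within _ _ (x j)) e (within-map (level⊆ σ) (leg-near j h<i i≤))
      ; A∩B = A′∩B′
      ; A-B = λ where
          zero j → G.at j h , G.at j (suc h) ,
            (at-comp j (<⇒≤ (h<ℓ j)) , ≤-reflexive (depth-at j (<⇒≤ (h<ℓ j)))) ,
            inj₂ (leg j ≤-refl (h<ℓ j)) , level⊆ σ (G.step j (h<ℓ j))
          (suc i) j → let u , v , a , m , e = A-B i j in u , v , a , inj₁ m , e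
      ; A-comp = λ where
          zero    a c → core-apart a c
          (suc i) a c → A-comp i a (conn-map proj₁ c)
      ; B-comp = λ where
          -- Older branch vertices are within `Λ s` of `x j`. Since `x j` is deep, the short trail
          -- between them is not cut.
          j (inj₁ m) c → within-mono (Λ≤Λ s) (deep-within (deep j) (B-comp j m (conn-map proj₁ c)))
          j {z} (inj₂ m) c → let i , h<i , i≤ , e = leg-member j m in
            subst (Within _ _ (x j)) e (within-mono (leg-length j h<i)
              (leg-comp j (G.ℓ j ∸ i) (≤-trans (lower (sym (ring-conn c)))
                 (≤-reflexive (cong (_+ offset s b) (trans (cong depth (sym e)) (depth-at j i≤)))))
                (m∸n+n≡m i≤)))
      }
      where
      A′-apart : ∀ {i j} → i ≢ j → Apart (A′ i) (A′ j)
      A′-apart {zero}  {zero}  i≢j = contradiction refl i≢j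
      A′-apart {zero}  {suc j} i≢j (c , _) a = let d , e = A-comp j a c in (λ { refl → d refl }) , e ∘ E₀-sym
      A′-apart {suc i} {zero}  i≢j a (c , _) = A-comp i a c
      A′-apart {suc i} {suc j} i≢j = A-apart (λ e → i≢j (cong suc e))
      A′∩B′ : ∀ i j {v} → A′ i v → B′ j v → ⊥
      A′∩B′ zero    j a (inj₁ m) = core-B j a m
      A′∩B′ zero    j (_ , d≤h) (inj₂ m) = let i , h<i , i≤ , e = leg-member j m in
        <⇒≱ h<i (≤-trans (≤-reflexive (trans (sym (depth-at j i≤)) (cong depth e))) d≤h)
      A′∩B′ (suc i) j a (inj₁ m) = A∩B i j a m
      A′∩B′ (suc i) j a (inj₂ m) = let k , h<k , k≤ , e = leg-member j m in
        proj₁ (A-comp i a (at-comp j k≤)) (sym e)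

  model : ∀ σ → (∀ j → Conn (Level.E (level σ)) (x zero) (x j)) → (∀ j → AllDeep σ (x j)) →
          Λ (length σ) + Λ (length σ) ≤ D → Model σ
  model []      c d room = base
  model (b ∷ σ) c d room = Step.extended b σ c (proj₁ ∘ d) room
    (model σ (λ j → conn-map proj₁ (c j)) (proj₂ ∘ d)
      (≤-trans (+-mono-≤ (Λ≤Λ (length σ)) (Λ≤Λ (length σ))) room))

-- Subsets, paths and induced minors of the statement

⟦_⟧ : ∀ {n} {P : Fin n → Set} → DecPred P → Subset n
⟦ P? ⟧ = Vec.tabulate (λ v → does (P? v))

∈⟦⟧⁺ : ∀ {n} {P : Fin n → Set} (P? : DecPred P) {v} → P v → v Sub.∈ ⟦ P? ⟧
∈⟦⟧⁺ P? {v} p = lookup⇒[]= v ⟦ P? ⟧ (trans (lookup∘tabulate _ v) (dec-true (P? v) p))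

∈⟦⟧⁻ : ∀ {n} {P : Fin n → Set} (P? : DecPred P) {v} → v Sub.∈ ⟦ P? ⟧ → P v
∈⟦⟧⁻ P? {v} m with P? v in eq
... | yes p = p
... | no _ with trans (sym ([]=⇒lookup m)) (trans (lookup∘tabulate _ v) (cong does eq))
...   | ()

segment : ∀ {X : Set} → (ℕ → X) → ℕ → List X
segment at zero    = []
segment at (suc k) = at 1 ∷ segment (at ∘ suc) k

segment-∈ : ∀ {X : Set} (at : ℕ → X) k {v} → v ∈ at 0 ∷ segment at k → Σ ℕ λ i → i ≤ k × v ≡ at i
segment-∈ at k       (here e) = 0 , z≤n , e
segment-∈ at (suc k) (there m) with segment-∈ (at ∘ suc) k m
... | i , i≤ , e = suc i , s≤s i≤ , e

segment-length : ∀ {X : Set} (at : ℕ → X) k → length (segment at k) ≡ k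
segment-length at zero    = refl
segment-length at (suc k) = cong suc (segment-length (at ∘ suc) k)

segment-linked : ∀ {X : Set} {R : X → X → Set} (at : ℕ → X) k → (∀ {i} → i < k → R (at i) (at (suc i))) →
                 Linked R (at 0 ∷ segment at k)
segment-linked at zero    r = [-]
segment-linked at (suc k) r = r (s≤s z≤n) ∷ segment-linked (at ∘ suc) k (r ∘ s≤s)

segment-unique : ∀ {X : Set} (at : ℕ → X) k → (∀ {i j} → i ≤ k → j ≤ k → at i ≡ at j → i ≡ j) →
                 Unique (at 0 ∷ segment at k)
segment-unique at zero    inj = [] ∷ []
segment-unique at (suc k) inj =
  All.tabulate (λ m e → let i , i≤ , e′ = segment-∈ (at ∘ suc) k m in
                        case inj z≤n (s≤s i≤) (trans e e′) of λ ())
  ∷ segment-unique (at ∘ suc) k (λ i≤ j≤ e → suc-injective (inj (s≤s i≤) (s≤s j≤) e))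

last-∷ : ∀ {X : Set} (x y : X) ys → List⁺.last (x ∷ y ∷ ys) ≡ List⁺.last (y ∷ ys)
last-∷ x y ys with List.initLast ys
... | []            = refl
... | zs List.∷ʳ′ z = refl

segment-last : ∀ {X : Set} (at : ℕ → X) k → List⁺.last (at 0 ∷ segment at k) ≡ at k
segment-last at zero    = refl
segment-last at (suc k) = trans (last-∷ (at 0) (at 1) (segment (at ∘ suc) k)) (segment-last (at ∘ suc) k)

record PathAlong {n : ℕ} (G : Graph n) (at : ℕ → Fin n) (k : ℕ) : Set where
  field
    path    : Path G
    start≡  : start path ≡ at 0
    end≡    : end path ≡ at k
    len≡    : len path ≡ k
    members : ∀ {v} → v onPath path → Σ ℕ λ i → i ≤ k × v ≡ at i

geodesicPath : ∀ {n} (G : Graph n) {R : Rel n} {A B : Fin n → Set} → (∀ {u v} → R u v → Edge G u v) →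
               (g : Geodesic R A B) → PathAlong G (Geodesic.at g) (Geodesic.ℓ g)
geodesicPath G R⊆ g = record
  { path = record { verts = at 0 ∷ segment at ℓ ; linked = segment-linked at ℓ (R⊆ ∘ step)
                  ; unique = segment-unique at ℓ injective }
  ; start≡ = refl ; end≡ = segment-last at ℓ ; len≡ = segment-length at ℓ ; members = segment-∈ at ℓ }
  where open Geodesic g

edge? : ∀ {n} (G : Graph n) → DecRel (Edge G)
edge? G u v = Graph.adj G u v Bool.≟ true

edge-sym : ∀ {n} (G : Graph n) → SymRel (Edge G)
edge-sym G {u} {v} e = trans (Graph.adj-sym G v u) e

↾? : ∀ {n} {R : Rel n} {X : Fin n → Set} → DecRel R → DecPred X → DecRel (R ↾ X)
↾? R? X? u v = R? u v ×-dec X? u ×-dec X? v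

↾-sym : ∀ {n} {R : Rel n} {X : Fin n → Set} → SymRel R → SymRel (R ↾ X)
↾-sym R-sym (e , a , b) = R-sym e , b , a

↾-stays : ∀ {n} {R : Rel n} {X : Fin n → Set} {u v} → X u → Conn (R ↾ X) u v → X v
↾-stays Xu (_ , stop)            = Xu
↾-stays Xu (_ , (_ , _ , Xv) ▸ p) = ↾-stays Xv (_ , p)

module _ {n : ℕ} (G : Graph n) {t : ℕ}
  (Branch : Fin t ⊎ Fin t → Fin n → Set) (Branch? : ∀ s → DecPred (Branch s))
  (centre : Fin t ⊎ Fin t → Fin n) (centre∈ : ∀ s → Branch s (centre s))
  (connected : ∀ s {v} → Branch s v → Conn (Edge G ↾ Branch s) (centre s) v)
  (disjoint : ∀ {s s′} → s ≢ s′ → ∀ {v} → Branch s v → Branch s′ v → ⊥)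
  (joined : ∀ a b → Σ (Fin n) λ u → Σ (Fin n) λ v → Branch (inj₁ a) u × Branch (inj₂ b) v × Edge G u v)
  (anticomplete₁ : ∀ {a b} → a ≢ b → ∀ {u v} → Branch (inj₁ a) u → Branch (inj₁ b) v → ¬ Edge G u v)
  (anticomplete₂ : ∀ {a b} → a ≢ b → ∀ {u v} → Branch (inj₂ a) u → Branch (inj₂ b) v → ¬ Edge G u v) where

  private
    Touch : Fin t ⊎ Fin t → Fin t ⊎ Fin t → Set
    Touch s s′ = Σ (Fin n) λ u → Σ (Fin n) λ v → Branch s u × Branch s′ v × Edge G u v

    isLeft : Fin t ⊎ Fin t → Bool
    isLeft (inj₁ _) = true
    isLeft (inj₂ _) = false

    isLeft-splitAt : ∀ i → (toℕ i <ᵇ t) ≡ isLeft (Fin.splitAt t i)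
    isLeft-splitAt i with Fin.splitAt t i in eq
    ... | inj₁ a = subst (λ k → (toℕ k <ᵇ t) ≡ true) (Finₚ.splitAt⁻¹-↑ˡ eq)
                     (trans (cong (_<ᵇ t) (Finₚ.toℕ-↑ˡ a t)) (Boolₚ.T-≡ .Equivalence.to (<⇒<ᵇ (toℕ<n a))))
    ... | inj₂ b = subst (λ k → (toℕ k <ᵇ t) ≡ false) (Finₚ.splitAt⁻¹-↑ʳ eq)
                     (trans (cong (_<ᵇ t) (Finₚ.toℕ-↑ʳ t b))
                       (Boolₚ.¬-not λ e → <⇒≱ (<ᵇ⇒< _ _ (Boolₚ.T-≡ .Equivalence.from e)) (m≤m+n t (toℕ b))))

    splitAt-injective : ∀ {i j : Fin (t + t)} → Fin.splitAt t i ≡ Fin.splitAt t j → i ≡ j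
    splitAt-injective {i} {j} e =
      trans (sym (Finₚ.join-splitAt t t i)) (trans (cong (Fin.join t t) e) (Finₚ.join-splitAt t t j))

    touch⁺ : ∀ s s′ → isLeft s xor isLeft s′ ≡ true → Touch s s′
    touch⁺ (inj₁ a) (inj₂ b) _ = joined a b
    touch⁺ (inj₂ b) (inj₁ a) _ = let u , v , p , q , e = joined a b in v , u , q , p , edge-sym G e

    touch⁻ : ∀ s s′ → s ≢ s′ → Touch s s′ → isLeft s xor isLeft s′ ≡ true
    touch⁻ (inj₁ a) (inj₁ b) ≠ (_ , _ , p , q , e) = contradiction e (anticomplete₁ (≠ ∘ cong inj₁) p q)
    touch⁻ (inj₁ a) (inj₂ b) _ _ = refl
    touch⁻ (inj₂ a) (inj₁ b) _ _ = refl
    touch⁻ (inj₂ a) (inj₂ b) ≠ (_ , _ , p , q , e) = contradiction e (anticomplete₂ (≠ ∘ cong inj₂) p q)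

  bipartiteMinor : InducedMinor (Ktt t) G
  bipartiteMinor = (λ i → ⟦ Branch? (part i) ⟧) ,
    (λ i → centre (part i) , ∈⟦⟧⁺ (Branch? (part i)) (centre∈ (part i))) ,
    (λ i u v u∈ v∈ → link (part i) (∈⟦⟧⁻ (Branch? (part i)) u∈) (∈⟦⟧⁻ (Branch? (part i)) v∈)) ,
    (λ i j i≢j v v∈ v∈′ → disjoint (i≢j ∘ splitAt-injective) (∈⟦⟧⁻ (Branch? (part i)) v∈) (∈⟦⟧⁻ (Branch? (part j)) v∈′)) ,
    λ i j i≢j → mk⇔
      (λ e → let u , v , p , q , e′ = touch⁺ (part i) (part j)
                                        (trans (sym (cong₂ _xor_ (isLeft-splitAt i) (isLeft-splitAt j))) e)
             in u , v , ∈⟦⟧⁺ (Branch? (part i)) p , ∈⟦⟧⁺ (Branch? (part j)) q , e′)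
      (λ (u , v , p , q , e) → trans (cong₂ _xor_ (isLeft-splitAt i) (isLeft-splitAt j))
         (touch⁻ (part i) (part j) (i≢j ∘ splitAt-injective)
           (u , v , ∈⟦⟧⁻ (Branch? (part i)) p , ∈⟦⟧⁻ (Branch? (part j)) q , e)))
    where
    part : Fin (t + t) → Fin t ⊎ Fin t
    part = Fin.splitAt t
    link : ∀ s {u v} → Branch s u → Branch s v →
           Σ (Path G) λ P → (start P ≡ u) × (end P ≡ v) × All (Sub._∈ ⟦ Branch? s ⟧) (List⁺.toList (Path.verts P))
    link s {u} {v} p q = path , trans start≡ (sym g.at-A) , trans end≡ (sym g.at-B) ,
        All.tabulate λ m → let i , i≤ , e = members m in
          subst (Sub._∈ ⟦ Branch? s ⟧) (sym e) (∈⟦⟧⁺ (Branch? s)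
            (↾-stays (subst (Branch s) g.at-A p) (let zs , _ , f = g.before i i≤ in zs , f)))
      where
      g = geodesic₂ (↾? (edge? G) (Branch? s))
            (conn-trans (conn-sym (↾-sym {X = Branch s} (edge-sym G)) (connected s p)) (connected s q))
      module g = Geodesic g
      open PathAlong (geodesicPath G proj₁ g)

inducedLevel : ∀ {n} (G : Graph n) {U : Fin n → Set} → DecPred U → Level n
inducedLevel G {U} U? = record { E = Edge G ↾ U ; E? = ↾? (edge? G) U? ; E-sym = ↾-sym {X = U} (edge-sym G) }

-- `D` = 2 `Λ` + 1 covers two branch radii and one edge between them. With `q` + 2 points there are
-- two distinct far points even for t = 1, as the argument for `off-centre` demands.
farPoints⇒minor : ∀ {n} (G : Graph n) {U : Fin n → Set} (U? : DecPred U) (let L₀ = inducedLevel G U?) {q : ℕ} (x : Fin (suc (suc q)) → Fin n) →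
  ∀ σ → length σ ≡ suc q → let D = suc (Λ (suc q) + Λ (suc q)) in
  (∀ {i j} → i ≢ j → ¬ Within (Edge G ↾ U) D (x i) (x j)) →
  (∀ j → Conn (Level.E (Decomposition.level L₀ σ)) (x zero) (x j)) → (∀ j → Decomposition.AllDeep L₀ σ (x j)) →
  (∀ j → U (x j)) → InducedMinor (Ktt (suc q)) G
farPoints⇒minor {n} G {U} U? {q} x σ σ≡ far conn deep x∈U =
  bipartiteMinor G Branch Branch? centre centre∈ connected disjoint joined anti₁ anti₂
  where
  D = suc (Λ (suc q) + Λ (suc q))
  open Branching (inducedLevel G U?) x D far
  room : Λ (length σ) + Λ (length σ) ≤ D
  room = ≤-trans (≤-reflexive (cong (λ k → Λ k + Λ k) σ≡)) (n≤1+n _)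
  open Model (model σ conn deep room)
  c : Fin (suc q) → Fin (length σ)
  c = Fin.cast (sym σ≡)
  c-injective : ∀ {a b} → c a ≡ c b → a ≡ b
  c-injective {a} {b} e = toℕ-injective (trans (sym (Finₚ.toℕ-cast (sym σ≡) a)) (trans (cong toℕ e) (Finₚ.toℕ-cast (sym σ≡) b)))
  Branch : Fin (suc q) ⊎ Fin (suc q) → Fin n → Set
  Branch (inj₁ a) = A (c a)
  Branch (inj₂ b) = B (Fin.inject₁ b)
  Branch? : ∀ s → DecPred (Branch s)
  Branch? (inj₁ a) = A? (c a)
  Branch? (inj₂ b) = B? (Fin.inject₁ b)
  centre : Fin (suc q) ⊎ Fin (suc q) → Fin n
  centre (inj₁ a) = hub (c a)
  centre (inj₂ b) = x (Fin.inject₁ b)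
  centre∈ : ∀ s → Branch s (centre s)
  centre∈ (inj₁ a) = hub∈ (c a)
  centre∈ (inj₂ b) = x∈ (Fin.inject₁ b)
  connected : ∀ s {v} → Branch s v → Conn (Edge G ↾ Branch s) (centre s) v
  connected (inj₁ a) m = conn-map (λ ((e , _) , p) → e , p) (A-conn (c a) m)
  connected (inj₂ b) m = conn-map (λ ((e , _) , p) → e , p) (B-conn (Fin.inject₁ b) m)
  -- The model speaks of edges inside `U` only, whereas the minor needs the absence of arbitrary
  -- edges of `G`. All branch sets lie in `U`: each contains one vertex of `U` and is connected by
  -- edges inside `U`.
  B⊆U : ∀ j {v} → B j v → U v
  B⊆U j m = let zs , _ , p = B-near j m in ↾-stays {R = Edge G} (x∈U j) (zs , p)
  hub∈U : ∀ i → U (hub i)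
  hub∈U i = let u , v , a , _ , (_ , Uu , _) = A-B i zero in
    ↾-stays {R = Edge G} Uu (conn-sym (↾-sym {X = U} (edge-sym G)) (conn-map proj₁ (A-conn i a)))
  A⊆U : ∀ i {v} → A i v → U v
  A⊆U i m = ↾-stays {R = Edge G} (hub∈U i) (conn-map proj₁ (A-conn i m))
  near-B : ∀ {i j u v} → i ≢ j → B i u → B j v → ∀ {k} → k ≤ 1 → Within (Edge G ↾ U) k u v → ⊥
  near-B {i} {j} i≢j p p′ k≤ e = far i≢j (within-mono
    (≤-trans (≤-reflexive (cong (λ m → Λ m + _ + Λ m) σ≡)) (≤-trans (+-monoˡ-≤ _ (+-monoʳ-≤ (Λ (suc q)) k≤))
      (≤-reflexive (cong (_+ Λ (suc q)) (+-comm (Λ (suc q)) 1)))))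
    (within-trans (within-trans (B-near i p) e) (within-sym (↾-sym {X = U} (edge-sym G)) (B-near j p′))))
  disjoint : ∀ {s s′} → s ≢ s′ → ∀ {v} → Branch s v → Branch s′ v → ⊥
  disjoint {inj₁ a} {inj₁ b} ≠ p p′ = proj₁ (A-apart (≠ ∘ cong inj₁ ∘ c-injective) p p′) refl
  disjoint {inj₁ a} {inj₂ b} ≠ p p′ = A∩B (c a) (Fin.inject₁ b) p p′
  disjoint {inj₂ a} {inj₁ b} ≠ p p′ = A∩B (c b) (Fin.inject₁ a) p′ p
  disjoint {inj₂ a} {inj₂ b} ≠ p p′ = near-B (≠ ∘ cong inj₂ ∘ Finₚ.inject₁-injective) p p′ z≤n within-refl
  joined : ∀ a b → Σ (Fin n) λ u → Σ (Fin n) λ v → Branch (inj₁ a) u × Branch (inj₂ b) v × Edge G u v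
  joined a b = let u , v , p , p′ , e , _ = A-B (c a) (Fin.inject₁ b) in u , v , p , p′ , e
  anti₁ : ∀ {a b} → a ≢ b → ∀ {u v} → Branch (inj₁ a) u → Branch (inj₁ b) v → ¬ Edge G u v
  anti₁ {a} {b} ≠ p p′ e = proj₂ (A-apart (≠ ∘ c-injective) p p′) (e , A⊆U (c a) p , A⊆U (c b) p′)
  anti₂ : ∀ {a b} → a ≢ b → ∀ {u v} → Branch (inj₂ a) u → Branch (inj₂ b) v → ¬ Edge G u v
  anti₂ {a} {b} ≠ p p′ e = near-B (≠ ∘ Finₚ.inject₁-injective) p p′ ≤-refl
    (within-edge (e , B⊆U (Fin.inject₁ a) p , B⊆U (Fin.inject₁ b) p′))

-- Clusters of bounded size

concatMap-length : ∀ {X Y : Set} (f : X → List Y) {m} (xs : List X) → (∀ {x} → x ∈ xs → length (f x) ≤ m) →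
                   length (concatMap f xs) ≤ length xs * m
concatMap-length f []       b = z≤n
concatMap-length f (x ∷ xs) b = ≤-trans (≤-reflexive (length-++ (f x)))
  (+-mono-≤ (b (here refl)) (concatMap-length f xs (b ∘ there)))

∈-concatMap : ∀ {X Y : Set} (f : X → List Y) {x y xs} → x ∈ xs → y ∈ f x → y ∈ concatMap f xs
∈-concatMap f {xs = x ∷ xs} (here refl) m = ∈-++⁺ˡ m
∈-concatMap f {xs = x ∷ xs} (there k)   m = ∈-++⁺ʳ (f x) (∈-concatMap f k m)

-- Greedy choice: when a scattered set cannot be extended, its members are near every point of `P`.
scatterOrCover : ∀ {n} {P : Fin n → Set} {Near : Rel n} → DecPred P → DecRel Near → SymRel Near → ∀ m →
  (Σ (Fin m → Fin n) λ f → (∀ i → P (f i)) × (∀ {i j} → i ≢ j → ¬ Near (f i) (f j))) ⊎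
  (Σ (List (Fin n)) λ ps → length ps < m × All P ps × (∀ {z} → P z → Σ (Fin n) λ p → p ∈ ps × Near p z))
scatterOrCover P? Near? Near-sym zero = inj₁ ((λ ()) , (λ ()) , λ { {()} })
scatterOrCover {n} {P} {Near} P? Near? Near-sym (suc m) with scatterOrCover P? Near? Near-sym m
... | inj₂ (ps , l , rest) = inj₂ (ps , m<n⇒m<1+n l , rest)
... | inj₁ (f , Pf , sep) with any? (λ z → P? z ×-dec all? (λ i → ¬? (Near? (f i) z)))
...   | yes (z , Pz , away) = inj₁ (f′ , (λ { zero → Pz ; (suc i) → Pf i }) , sep′)
  where
  f′ : Fin (suc m) → Fin n
  f′ zero    = z
  f′ (suc i) = f i
  sep′ : ∀ {i j} → i ≢ j → ¬ Near (f′ i) (f′ j)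
  sep′ {zero}  {zero}  i≢j = contradiction refl i≢j
  sep′ {zero}  {suc j} i≢j = away j ∘ Near-sym
  sep′ {suc i} {zero}  i≢j = away i
  sep′ {suc i} {suc j} i≢j = sep (i≢j ∘ cong suc)
...   | no none = inj₂ (List.tabulate f , s≤s (≤-reflexive (length-tabulate f)) , Allₚ.tabulate⁺ Pf , cover)
  where
  cover : ∀ {z} → P z → Σ (Fin n) λ p → p ∈ List.tabulate f × Near p z
  cover {z} Pz with any? (λ i → Near? (f i) z)
  ... | yes (i , near) = f i , ∈-tabulate⁺ i , near
  ... | no  away = contradiction (z , Pz , λ i near → away (i , near)) none

module Clusters {n : ℕ} (G : Graph n) {U : Fin n → Set} (U? : DecPred U) {q : ℕ}
  (minor-free : ¬ InducedMinor (Ktt (suc q)) G)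
  (nb : Fin n → List (Fin n)) (d : ℕ) (nb-length : ∀ v → length (nb v) ≤ d)
  (nb-self : ∀ {v} → U v → v ∈ nb v) (nb-edge : ∀ {v z} → (Edge G ↾ U) v z → z ∈ nb v) where

  open Decomposition (inducedLevel G U?)

  radius : ℕ
  radius = suc (Λ (suc q) + Λ (suc q))

  ball : ℕ → Fin n → List (Fin n)
  ball zero    v = v ∷ []
  ball (suc k) v = concatMap (ball k) (nb v)

  ball-length : ∀ k v → length (ball k v) ≤ d ^ k
  ball-length zero    v = ≤-refl
  ball-length (suc k) v = ≤-trans (concatMap-length (ball k) (nb v) (λ {x} _ → ball-length k x))
                                  (*-monoˡ-≤ (d ^ k) (nb-length v))

  ∈-ball : ∀ k {v z} → U v → Within (Edge G ↾ U) k v z → z ∈ ball k v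
  ∈-ball zero    Uv w with within-zero w
  ... | refl = here refl
  ∈-ball (suc k) Uv ([] , _ , stop) = ∈-concatMap (ball k) (nb-self Uv) (∈-ball k Uv within-refl)
  ∈-ball (suc k) Uv (_ , s≤s l , e@(_ , _ , Uz) ▸ p) = ∈-concatMap (ball k) (nb-edge e) (∈-ball k Uz (_ , l , p))

  coreEdge? : ∀ σ → DecRel (CoreEdge σ)
  coreEdge? σ u v = Level.E? (level σ) u v ×-dec allDeep? σ u ×-dec allDeep? σ v

  coreEdge-sym : ∀ σ → SymRel (CoreEdge σ)
  coreEdge-sym σ (e , a , b) = Level.E-sym (level σ) e , b , a

  -- `q` + 2 far points in one cluster would give the excluded minor, so at most `q` + 1 balls of
  -- the given radius cover it; with neighbour lists of length at most `d` each ball has at most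
  -- `d ^ radius` vertices.
  cluster-small : ∀ σ → length σ ≡ suc q → ∀ u →
    Σ (List (Fin n)) λ C → length C ≤ suc q * d ^ radius × (∀ {z} → U z → Conn (CoreEdge σ) u z → z ∈ C)
  cluster-small σ σ≡ u with scatterOrCover {P = λ z → U z × Conn (CoreEdge σ) u z} {Near = Within (Edge G ↾ U) radius}
      (λ z → U? z ×-dec conn? (coreEdge? σ) u z) (within? (↾? (edge? G) U?) radius)
      (within-sym (↾-sym {X = U} (edge-sym G))) (suc (suc q))
  ... | inj₂ (ps , l , Ps , cover) = concatMap (ball radius) ps ,
        ≤-trans (concatMap-length (ball radius) ps (λ {x} _ → ball-length radius x)) (*-monoˡ-≤ (d ^ radius) (≤-pred l)) ,
        λ Uz c → let p , p∈ , near = cover (Uz , c) in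
          ∈-concatMap (ball radius) p∈ (∈-ball radius (proj₁ (All.lookup Ps p∈)) near)
  ... | inj₁ (x , Px , far) = contradiction
        (farPoints⇒minor G U? x σ σ≡ far (λ j → conn-map proj₁ (joined zero j)) (λ j → deep j) (proj₁ ∘ Px)) minor-free
    where
    joined : ∀ i j → Conn (CoreEdge σ) (x i) (x j)
    joined i j = conn-trans (conn-sym (coreEdge-sym σ) (proj₂ (Px i))) (proj₂ (Px j))
    -- A singleton cluster need not be deep. The far points are distinct, so each starts a nonempty
    -- trail of core edges, and the first edge testifies that it is deep.
    deep-end : ∀ {a b} → a ≢ b → Conn (CoreEdge σ) a b → AllDeep σ a
    deep-end a≢b (_ , stop)              = contradiction refl a≢b
    deep-end a≢b (_ , (_ , da , _) ▸ p) = da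
    x≢ : ∀ {i j} → i ≢ j → x i ≢ x j
    x≢ {i} i≢j e = far i≢j (subst (Within _ radius (x i)) e within-refl)
    deep : ∀ j → AllDeep σ (x j)
    deep zero    = deep-end (x≢ {zero} {suc zero} (λ ())) (joined zero (suc zero))
    deep (suc j) = deep-end (x≢ {suc j} {zero} (λ ())) (joined (suc j) zero)

-- Rerouting

conn-self : ∀ {n} {R : Rel n} {u v} → Conn R u v → Conn (R ↾ Conn R u) u v
conn-self {R = R} {u} (_ , p) = go conn-refl p
  where
  go : ∀ {x zs v} → Conn R u x → Trail R x zs v → Conn (R ↾ Conn R u) x v
  go c stop    = conn-refl
  go c (e ▸ p) = conn-trans (conn-edge (e , c , c′)) (go c′ p)
    where c′ = conn-trans c (conn-edge e)

module Reroute {n : ℕ} (G : Graph n) {A B : Fin n → Set} (A? : DecPred A) (B? : DecPred B) where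

  Avoiding : (Fin n → Set) → List (Fin n) → Set
  Avoiding U Z = Σ (Fin n) λ a → Σ (List (Fin n)) λ zs → Σ (Fin n) λ b →
    A a × B b × Trail (Edge G) a zs b × (∀ {v} → v ∈ a ∷ zs → U v × v ∉ Z)

  -- No fewer than `K` vertices separate `A` from `B` inside `U`, in a positive form: each failure
  -- to separate comes with a trail.
  Robust : ℕ → (Fin n → Set) → Set
  Robust K U = ∀ Z → length Z < K → Avoiding U Z

  module Contract {U : Fin n → Set} (U? : DecPred U) (lab : Fin n → Fin n) (X : ℕ) (0<X : 0 < X)
    (C : Fin n → List (Fin n)) (C-length : ∀ c → length (C c) ≤ X) (C-cover : ∀ {u} → U u → u ∈ C (lab u))
    (lab-conn : ∀ {u v} → U u → U v → lab u ≡ lab v → Conn ((Edge G ↾ U) ↾ (λ w → lab w ≡ lab u)) u v)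
    (K : ℕ) (robust : Robust (K * X) U) where

    Part : List (Fin n) → Fin n → Set
    Part W v = U v × lab v ∈ W

    part? : ∀ W → DecPred (Part W)
    part? W v = U? v ×-dec (lab v ∈? W)

    -- A shortest path, with free ends in `A` and `B`, inside the union of the classes on one
    -- quotient trail. Different routes then differ in all labels, which is stronger than being
    -- disjoint.
    Route : List (Fin n) → Set
    Route W = Geodesic (Edge G ↾ Part W) (λ v → A v × Part W v) (λ v → B v × Part W v)

    private
      pairs : List (Fin n × Fin n)
      pairs = filter (λ (u , v) → ↾? (edge? G) U? u v) (cartesianProduct (allFin n) (allFin n))

      es : List (Fin n × Fin n)
      es = map (λ (u , v) → lab u , lab v) pairs

      es⁺ : ∀ {u v} → (Edge G ↾ U) u v → (lab u , lab v) ∈ es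
      es⁺ {u} {v} e = ∈-map⁺ (λ (u , v) → lab u , lab v)
        (∈-filter⁺ (λ (u , v) → ↾? (edge? G) U? u v) (∈-cartesianProduct⁺ (∈-allFin u) (∈-allFin v)) e)

      es⁻ : ∀ {c c′} → (c , c′) ∈ es → Σ (Fin n) λ u → Σ (Fin n) λ v → (Edge G ↾ U) u v × c ≡ lab u × c′ ≡ lab v
      es⁻ m with ∈-map⁻ (λ (u , v) → lab u , lab v) m
      ... | (u , v) , m′ , refl = u , v ,
            proj₂ (∈-filter⁻ (λ (u , v) → ↾? (edge? G) U? u v) {xs = cartesianProduct (allFin n) (allFin n)} m′) , refl , refl

      Q : (Fin n → Set) → Fin n → Set
      Q P c = Σ (Fin n) λ u → P u × U u × lab u ≡ c

      q? : ∀ {P} → DecPred P → DecPred (Q P)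
      q? P? c = any? λ u → P? u ×-dec U? u ×-dec (lab u Fin.≟ c)

      quotient : ∀ {a zs b} → Trail (Edge G) a zs b → (∀ {v} → v ∈ a ∷ zs → U v) →
                 Trail (ListEdge es) (lab a) (map lab zs) (lab b)
      quotient stop    in-U = stop
      quotient (e ▸ p) in-U = es⁺ (e , in-U (here refl) , in-U (there (here refl))) ▸ quotient p (in-U ∘ there)

      -- Fewer than `K` labels stand for fewer than `K * X` vertices. A trail avoiding all of these
      -- projects to a quotient trail avoiding the labels.
      unseparated : ∀ Z → length Z < K → ¬ Separates (ListEdge es) (Q A) (Q B) Z
      unseparated Z l sep with robust (concatMap C Z)
           (≤-trans (s≤s (concatMap-length C Z (λ {c} _ → C-length c))) (*-monoˡ-< X {{ℕ.>-nonZero 0<X}} l))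
      ... | a , zs , b , Aa , Bb , p , avoid
        with sep (a , Aa , proj₁ (avoid (here refl)) , refl) (b , Bb , proj₁ (avoid (end∈ p)) , refl)
                 (quotient p (proj₁ ∘ avoid))
      ... | c , c∈ , c∈Z with ∈-map⁻ lab {xs = a ∷ zs} c∈
      ...   | v , v∈ , refl = proj₂ (avoid v∈) (∈-concatMap C c∈Z (C-cover (proj₁ (avoid v∈))))

      lift : ∀ {W c zs c′ u} → (∀ {w} → w ∈ c ∷ zs → w ∈ W) → Trail (ListEdge es) c zs c′ →
             U u → lab u ≡ c → ∀ {v} → U v → lab v ≡ c′ → Conn (Edge G ↾ Part W) u v
      lift {W} sub stop Uu refl Uv e = conn-map
        (λ { ((e , Ux , Uy) , lx , ly) → e , (Ux , subst (_∈ W) (sym lx) (sub (here refl)))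
                                           , (Uy , subst (_∈ W) (sym ly) (sub (here refl))) })
        (lab-conn Uu Uv (sym e))
      lift {W} sub (m ▸ p) Uu refl Uv e with es⁻ m
      ... | x , y , (xy , Ux , Uy) , lx , refl = conn-trans
            (lift {W} {zs = []} (λ { (here q) → sub (here q) }) stop Uu refl Ux (sym lx))
            (conn-trans (conn-edge (xy , (Ux , subst (_∈ W) lx (sub (here refl))) , (Uy , sub (there (here refl)))))
              (lift {W} (sub ∘ there) p Uy refl Uv e))

      route : (P : SetTrail (ListEdge es) (Q A) (Q B)) → Route (vertices P)
      route P with SetTrail.first∈ P | SetTrail.last∈ P
      ... | u , Au , Uu , lu | v , Bv , Uv , lv = geodesic (↾? (edge? G) (part? _))
            (λ v → A? v ×-dec part? _ v) (λ v → B? v ×-dec part? _ v)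
            (Au , Uu , here lu) (Bv , Uv , subst (_∈ vertices P) (sym lv) (end∈ (SetTrail.trail P)))
            (proj₂ (lift (λ m → m) (SetTrail.trail P) Uu lu Uv lv))

    abstract
      routes : Σ (Fin K → List (Fin n)) λ W → (∀ {i j c} → c ∈ W i → c ∈ W j → i ≡ j) × (∀ i → Route (W i))
      routes with menger es (q? A?) (q? B?) K
      ... | inj₁ (Z , l , sep) = ⊥-elim (unseparated Z l sep)
      ... | inj₂ (P , disj)    = (λ i → vertices (P i)) , disj , λ i → route (P i)

    W : Fin K → List (Fin n)
    W = proj₁ routes

    W-disjoint : ∀ {i j c} → c ∈ W i → c ∈ W j → i ≡ j
    W-disjoint = proj₁ (proj₂ routes)

    module R i = Geodesic (proj₂ (proj₂ routes) i)

    R-part : ∀ i {m} → m ≤ R.ℓ i → Part (W i) (R.at i m)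
    R-part i {m} m≤ = ↾-stays (proj₂ (R.at-A i)) (let zs , _ , p = R.before i m m≤ in zs , p)

    Routed : Fin n → Set
    Routed v = Σ (Fin K) λ i → Σ (Fin (suc (R.ℓ i))) λ m → R.at i (toℕ m) ≡ v

    routed? : DecPred Routed
    routed? v = any? λ i → any? λ m → R.at i (toℕ m) Fin.≟ v

    routed : ∀ i {m} → m ≤ R.ℓ i → Routed (R.at i m)
    routed i m≤ = i , fromℕ< (s≤s m≤) , cong (R.at i) (toℕ-fromℕ< (s≤s m≤))

    position : ∀ {v} → Routed v → Σ (Fin K) λ i → Σ ℕ λ m → m ≤ R.ℓ i × R.at i m ≡ v
    position (i , m , e) = i , toℕ m , ≤-pred (toℕ<n m) , e

    routed⊆ : ∀ {v} → Routed v → U v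
    routed⊆ r = let i , m , m≤ , e = position r in subst U e (proj₁ (R-part i m≤))

    -- The routes have disjoint label sets, so each vertex of `Z` blocks at most one of the `K`
    -- routes.
    routed-robust : Robust K Routed
    routed-robust Z l with any? (λ i → all? λ (m : Fin (suc (R.ℓ i))) → ¬? (R.at i (toℕ m) ∈? Z))
    ... | yes (i , free) = R.at i 0 , segment (R.at i) (R.ℓ i) , R.at i (R.ℓ i) ,
          proj₁ (R.at-A i) , proj₁ (R.at-B i) , along (R.at i) (R.ℓ i) (proj₁ ∘ R.step i) ,
          λ v∈ → let m , m≤ , e = segment-∈ (R.at i) (R.ℓ i) v∈ in
            subst (λ v → Routed v × v ∉ Z) (sym e)
              (routed i m≤ , subst (λ k → R.at i k ∉ Z) (toℕ-fromℕ< (s≤s m≤)) (free (fromℕ< (s≤s m≤))))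
      where
      along : ∀ at k → (∀ {i} → i < k → Edge G (at i) (at (suc i))) → Trail (Edge G) (at 0) (segment at k) (at k)
      along at zero    st = stop
      along at (suc k) st = st (s≤s z≤n) ▸ along (at ∘ suc) k (st ∘ s≤s)
    ... | no none = contradiction (inj-length (λ i → R.at i (toℕ (proj₁ (hit i)))) hit-inj Z (λ i → proj₂ (hit i))) (<⇒≱ l)
      where
      hit : ∀ i → Σ (Fin (suc (R.ℓ i))) λ m → R.at i (toℕ m) ∈ Z
      hit i with any? (λ (m : Fin (suc (R.ℓ i))) → R.at i (toℕ m) ∈? Z)
      ... | yes h = h
      ... | no ¬h = contradiction (i , λ m m∈ → ¬h (m , m∈)) none
      hit-inj : ∀ {i j} → R.at i (toℕ (proj₁ (hit i))) ≡ R.at j (toℕ (proj₁ (hit j))) → i ≡ j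
      hit-inj {i} {j} e = W-disjoint (proj₂ (R-part i (≤-pred (toℕ<n (proj₁ (hit i))))))
        (subst (λ v → lab v ∈ W j) (sym e) (proj₂ (R-part j (≤-pred (toℕ<n (proj₁ (hit j)))))))

  -- The neighbours of v within U are at most the predecessor and the successor of v on some path,
  -- which starts in v if v ∈ A and ends in v if v ∈ B.
  record Local (U : Fin n → Set) (v : Fin n) : Set where
    field
      pos end-pos : ℕ
      nbr         : ℕ → Fin n
      near        : ∀ {z} → U z → Edge G v z → Σ ℕ λ i → i ≤ end-pos × z ≡ nbr i × (i ≡ suc pos ⊎ pos ≡ suc i)
      A⇒first     : A v → pos ≡ 0
      B⇒last      : B v → pos ≡ end-pos

  local-mono : ∀ {U U′ : Fin n → Set} → (∀ {v} → U′ v → U v) → ∀ {v} → Local U v → Local U′ v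
  local-mono sub l = record { pos = pos ; end-pos = end-pos ; nbr = nbr ; near = near ∘ sub ; A⇒first = A⇒first ; B⇒last = B⇒last }
    where open Local l

  edge-irrefl : ∀ {v} → ¬ Edge G v v
  edge-irrefl {v} e with trans (sym e) (Graph.adj-irrefl G v)
  ... | ()

  module _ {U : Fin n → Set} (U? : DecPred U) (lab : Fin n → Fin n) (X : ℕ) (0<X : 0 < X)
    (C : Fin n → List (Fin n)) (C-length : ∀ c → length (C c) ≤ X) (C-cover : ∀ {u} → U u → u ∈ C (lab u))
    (lab-conn : ∀ {u v} → U u → U v → lab u ≡ lab v → Conn ((Edge G ↾ U) ↾ (λ w → lab w ≡ lab u)) u v)
    (K : ℕ) (robust : Robust (K * X) U) where

    open Contract U? lab X 0<X C C-length C-cover lab-conn K robust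

    -- By `same`, a routed neighbour of `v` carries the label of `v`. Label sets of different routes
    -- are disjoint, so it lies on the same route, and there only consecutive vertices are adjacent.
    routed-local : ∀ {v} → Routed v → (∀ {z} → U z → Edge G v z → lab z ≡ lab v) → Local Routed v
    routed-local {v} r same with position r
    ... | i , p , p≤ , refl = record
      { pos = p ; end-pos = R.ℓ i ; nbr = R.at i
      ; near = near
      ; A⇒first = λ a → R.A-first i p≤ (a , R-part i p≤)
      ; B⇒last = λ b → R.B-last i p≤ (b , R-part i p≤) }
      where
      near : ∀ {z} → Routed z → Edge G (R.at i p) z →
             Σ ℕ λ m → m ≤ R.ℓ i × z ≡ R.at i m × (m ≡ suc p ⊎ p ≡ suc m)
      near rz e with position rz
      ... | j , m , m≤ , refl with W-disjoint {j} {i} (proj₂ (R-part j m≤))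
                                   (subst (_∈ W i) (sym (same (proj₁ (R-part j m≤)) e)) (proj₂ (R-part i p≤)))
      ... | refl with <-cmp m p
      ...   | tri< m<p _ _ = m , m≤ , refl , inj₂ (≤-antisym
                (R.edge-bound i m≤ p≤ (edge-sym G e , R-part i m≤ , R-part i p≤)) m<p)
      ...   | tri≈ _ refl _ = ⊥-elim (edge-irrefl e)
      ...   | tri> _ _ p<m = m , m≤ , refl , inj₁ (≤-antisym
                (R.edge-bound i p≤ m≤ (e , R-part i p≤ , R-part i m≤)) p<m)

  AnticompletePaths : ℕ → Set
  AnticompletePaths k = Σ (Fin k → Path G) λ P → (∀ i → A (start (P i)) × B (end (P i))) ×
             (∀ i j → i ≢ j → Anticomplete (P i) (P j))

  -- With singleton classes, contraction reduces to plain Menger followed by shortening. That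
  -- suffices once every vertex is local.
  module Finish {U : Fin n → Set} (U? : DecPred U) (local : ∀ {v} → U v → Local U v)
    (k : ℕ) (robust : Robust (k * 1) U) where

    id-conn : ∀ {u v} → U u → U v → u ≡ v → Conn ((Edge G ↾ U) ↾ (_≡ u)) u v
    id-conn _ _ refl = conn-refl

    open Contract U? id 1 ≤-refl (_∷ []) (λ _ → ≤-refl) (λ _ → here refl) id-conn k robust

    in-U : ∀ i {m} → m ≤ R.ℓ i → U (R.at i m)
    in-U i m≤ = proj₁ (R-part i m≤)

    apart : ∀ {i j} → i ≢ j → ∀ {m m′} → m ≤ R.ℓ i → m′ ≤ R.ℓ j → R.at i m ≢ R.at j m′
    apart {i} {j} i≢j m≤ m′≤ e = i≢j (W-disjoint (proj₂ (R-part i m≤)) (subst (_∈ W j) (sym e) (proj₂ (R-part j m′≤))))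

    -- A vertex of R i has, counting an end in A or B as a neighbour, two neighbours on R i already.
    no-edge : ∀ {i j} → i ≢ j → ∀ m m′ → m ≤ R.ℓ i → m′ ≤ R.ℓ j → ¬ Edge G (R.at i m) (R.at j m′)
    no-edge {i} {j} i≢j m m′ m≤ m′≤ e = cases (pred-nbr m m≤) (succ-nbr m m≤)
      where
      open Local (local (in-U i m≤))
      y = R.at j m′
      Neighbour : Fin n → Set
      Neighbour z = Σ ℕ λ a → a ≤ end-pos × z ≡ nbr a × (a ≡ suc pos ⊎ pos ≡ suc a)
      y-nbr : Neighbour y
      y-nbr = near (in-U j m′≤) e
      pred-nbr : ∀ m → m ≤ R.ℓ i → A (R.at i m) ⊎ Σ ℕ λ l → suc l ≡ m
      pred-nbr zero    _ = inj₁ (proj₁ (R.at-A i))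
      pred-nbr (suc l) _ = inj₂ (l , refl)
      succ-nbr : ∀ m → m ≤ R.ℓ i → B (R.at i m) ⊎ m < R.ℓ i
      succ-nbr m m≤ with m≤n⇒m<n∨m≡n m≤
      ... | inj₁ l    = inj₂ l
      ... | inj₂ refl = inj₁ (proj₁ (R.at-B i))
      pred-near : ∀ {l} → suc l ≡ m → Neighbour (R.at i l)
      pred-near refl = near (in-U i (<⇒≤ m≤)) (edge-sym G (proj₁ (R.step i m≤)))
      succ-near : m < R.ℓ i → Neighbour (R.at i (suc m))
      succ-near l = near (in-U i l) (proj₁ (R.step i l))
      up : ∀ {z} → Neighbour z → pos ≡ 0 → z ≡ nbr (suc pos)
      up (a , _ , q , inj₁ refl) _ = q
      up (a , _ , q , inj₂ p)    r = case trans (sym r) p of λ ()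
      down : ∀ {z} → Neighbour z → pos ≡ end-pos → Σ ℕ λ a → pos ≡ suc a × z ≡ nbr a
      down (a , a≤ , q , inj₁ refl) r = contradiction (≤-trans a≤ (≤-reflexive (sym r))) (<⇒≱ ≤-refl)
      down (a , _  , q , inj₂ p)    r = a , p , q
      same : ∀ {z z′ a a′} → z ≡ nbr a → z′ ≡ nbr a′ → a ≡ a′ → z ≡ z′
      same p q refl = trans p (sym q)
      cases : A (R.at i m) ⊎ (Σ ℕ λ l → suc l ≡ m) → B (R.at i m) ⊎ m < R.ℓ i → ⊥
      cases (inj₁ a) (inj₁ b) with down y-nbr (B⇒last b)
      ... | _ , p , _ = case trans (sym (A⇒first a)) p of λ ()
      cases (inj₁ a) (inj₂ l) =
        apart i≢j l m′≤ (same (up (succ-near l) (A⇒first a)) (up y-nbr (A⇒first a)) refl)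
      cases (inj₂ (l , refl)) (inj₁ b) with down y-nbr (B⇒last b) | down (pred-near refl) (B⇒last b)
      ... | _ , p , q | _ , p′ , q′ = apart i≢j (<⇒≤ m≤) m′≤ (same q′ q (suc-injective (trans (sym p′) p)))
      -- Predecessor, successor and `y` share the two slots next to `pos`. If predecessor and
      -- successor coincide, the route is not injective; otherwise `y` is one of them, against
      -- disjointness.
      cases (inj₂ (l , refl)) (inj₂ l<) with pred-near refl | succ-near l< | y-nbr
      ... | a , _ , q , inj₁ p | b , _ , q′ , inj₁ p′ | _ =
            case R.injective i (<⇒≤ m≤) l< (same q q′ (trans p (sym p′))) of λ ()
      ... | a , _ , q , inj₂ p | b , _ , q′ , inj₂ p′ | _ =
            case R.injective i (<⇒≤ m≤) l< (same q q′ (suc-injective (trans (sym p) p′))) of λ ()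
      ... | a , _ , q , inj₁ p | b , _ , q′ , inj₂ p′ | c , _ , q″ , inj₁ p″ =
            apart i≢j (<⇒≤ m≤) m′≤ (same q q″ (trans p (sym p″)))
      ... | a , _ , q , inj₁ p | b , _ , q′ , inj₂ p′ | c , _ , q″ , inj₂ p″ =
            apart i≢j l< m′≤ (same q′ q″ (suc-injective (trans (sym p′) p″)))
      ... | a , _ , q , inj₂ p | b , _ , q′ , inj₁ p′ | c , _ , q″ , inj₁ p″ =
            apart i≢j l< m′≤ (same q′ q″ (trans p′ (sym p″)))
      ... | a , _ , q , inj₂ p | b , _ , q′ , inj₁ p′ | c , _ , q″ , inj₂ p″ =
            apart i≢j (<⇒≤ m≤) m′≤ (same q q″ (suc-injective (trans (sym p) p″)))

    anticompletePaths : AnticompletePaths k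
    anticompletePaths = (λ i → P.path i) , (λ i → subst A (sym (P.start≡ i)) (proj₁ (R.at-A i)) , subst B (sym (P.end≡ i)) (proj₁ (R.at-B i))) ,
      λ i j i≢j u v u∈ v∈ → let m , m≤ , e = P.members i u∈ ; m′ , m′≤ , e′ = P.members j v∈ in
        subst₂ (λ u v → u ≢ v × ¬ Edge G u v) (sym e) (sym e′) (apart i≢j m≤ m′≤ , no-edge i≢j m m′ m≤ m′≤)
      where module P i = PathAlong (geodesicPath G proj₁ (proj₂ (proj₂ routes) i))

module _ {n : ℕ} (G : Graph n) {A B : Fin n → Set} (A? : DecPred A) (B? : DecPred B)
  {U₀ : Fin n → Set} (U₀? : DecPred U₀) {q : ℕ} (minor-free : ¬ InducedMinor (Ktt (suc q)) G)
  (nb : Fin n → List (Fin n)) (d : ℕ) (nb-length : ∀ v → length (nb v) ≤ d)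
  (nb-self : ∀ {v} → U₀ v → v ∈ nb v) (nb-edge : ∀ {v z} → (Edge G ↾ U₀) v z → z ∈ nb v)
  (0<d : 0 < d) where

  open Reroute G A? B?
  open Clusters G U₀? minor-free nb d nb-length nb-self nb-edge
  open Decomposition (inducedLevel G U₀?)

  clusterSize : ℕ
  clusterSize = suc q * d ^ radius

  private
    Covers : Fin n → List Bool → Set
    Covers v σ = ∀ {z} → (Edge G ↾ U₀) v z → CoreEdge σ v z

    module Pass {U : Fin n → Set} (U? : DecPred U) (U⊆U₀ : ∀ {v} → U v → U₀ v)
      (σ : List Bool) (σ≡ : length σ ≡ suc q) (K : ℕ) (robust : Robust (K * clusterSize) U) where

      -- Classes are formed inside the current `U`, so that quotient trails lift to `U`; their size
      -- is still bounded, because each lies in a cluster of the original `U₀`.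
      S : Rel n
      S = CoreEdge σ ↾ U

      S? : DecRel S
      S? = ↾? (coreEdge? σ) U?

      S-sym : SymRel S
      S-sym = ↾-sym {X = U} (coreEdge-sym σ)

      lab : Fin n → Fin n
      lab = root S? S-sym

      positive : 0 < clusterSize
      positive = *-mono-≤ {1} {suc q} (s≤s z≤n) (m^n>0 d {{ℕ.>-nonZero 0<d}} radius)

      C-cover : ∀ {u} → U u → u ∈ proj₁ (cluster-small σ σ≡ (lab u))
      C-cover {u} Uu = proj₂ (proj₂ (cluster-small σ σ≡ (lab u))) (U⊆U₀ Uu)
        (conn-sym (coreEdge-sym σ) (conn-map proj₁ (root-conn S? S-sym u)))

      lab-conn : ∀ {u v} → U u → U v → lab u ≡ lab v → Conn ((Edge G ↾ U) ↾ (λ w → lab w ≡ lab u)) u v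
      lab-conn {u} Uu Uv e = conn-map
        (λ { (((s , _) , Ux , Uy) , cx , cy) → (proj₁ (level⊆ σ s) , Ux , Uy) ,
               sym (conn⇒root≡ S? S-sym cx) , sym (conn⇒root≡ S? S-sym cy) })
        (conn-self (root≡⇒conn S? S-sym e))

      open Contract U? lab clusterSize positive (λ c → proj₁ (cluster-small σ σ≡ c))
        (λ c → proj₁ (proj₂ (cluster-small σ σ≡ c))) C-cover lab-conn K robust public

      covered-local : ∀ {v} → Routed v → Covers v σ → Local Routed v
      covered-local r cov = routed-local U? lab clusterSize positive (λ c → proj₁ (cluster-small σ σ≡ c))
        (λ c → proj₁ (proj₂ (cluster-small σ σ≡ c))) C-cover lab-conn K robust r
        λ Uz e → sym (conn⇒root≡ S? S-sym (conn-edge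
          (cov (e , U⊆U₀ (routed⊆ r) , U⊆U₀ Uz) , routed⊆ r , Uz)))

    -- Invariant: each surviving vertex is already local or is covered by a choice of shifts still
    -- to come. A pass moves the vertices covered by its own choice to the first kind and consumes
    -- one factor `clusterSize`.
    passes : ∀ k σs → All (λ σ → length σ ≡ suc q) σs → ∀ {U} → DecPred U → (∀ {v} → U v → U₀ v) →
             Robust (k * clusterSize ^ length σs) U → (∀ {v} → U v → Local U v ⊎ Any (Covers v) σs) → AnticompletePaths k
    passes k [] [] U? U⊆ robust status = Finish.anticompletePaths U?
      (λ Uv → case status Uv of λ { (inj₁ l) → l ; (inj₂ ()) }) k robust
    passes k (σ ∷ σs) (σ≡ ∷ σs≡) {U} U? U⊆ robust status =
      passes k σs σs≡ routed? (U⊆ ∘ routed⊆) routed-robust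
        (λ r → next r (status (routed⊆ r)))
      where
      open Pass U? U⊆ σ σ≡ (k * clusterSize ^ length σs)
        (subst (λ m → Robust m U) (trans (cong (k *_) (*-comm clusterSize _)) (sym (*-assoc k _ clusterSize))) robust)
      next : ∀ {v} → Routed v → Local U v ⊎ Any (Covers v) (σ ∷ σs) → Local Routed v ⊎ Any (Covers v) σs
      next r (inj₁ l)         = inj₁ (local-mono routed⊆ l)
      next r (inj₂ (here c))  = inj₁ (covered-local r c)
      next r (inj₂ (there a)) = inj₂ a

    shifts : ℕ → List (List Bool)
    shifts zero    = [] ∷ []
    shifts (suc t) = map (true ∷_) (shifts t) ++ map (false ∷_) (shifts t)

    shifts-length : ∀ t → length (shifts t) ≡ 2 ^ t
    shifts-length zero    = refl
    shifts-length (suc t) = trans (length-++ (map (true ∷_) (shifts t)))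
      (cong₂ _+_ (trans (length-map _ (shifts t)) (shifts-length t))
                 (trans (length-map _ (shifts t)) (trans (shifts-length t) (sym (+-identityʳ (2 ^ t))))))

    shifts-all : ∀ t → All (λ σ → length σ ≡ t) (shifts t)
    shifts-all zero    = refl ∷ []
    shifts-all (suc t) = Allₚ.++⁺ (Allₚ.map⁺ (All.map (cong suc) (shifts-all t))) (Allₚ.map⁺ (All.map (cong suc) (shifts-all t)))

    ∈-shifts : ∀ σ → σ ∈ shifts (length σ)
    ∈-shifts []          = here refl
    ∈-shifts (true  ∷ σ) = ∈-++⁺ˡ (∈-map⁺ (true ∷_) (∈-shifts σ))
    ∈-shifts (false ∷ σ) = ∈-++⁺ʳ (map (true ∷_) (shifts (length σ))) (∈-map⁺ (false ∷_) (∈-shifts σ))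

  reroute : ∀ k → Robust (k * clusterSize ^ (2 ^ suc q)) U₀ → AnticompletePaths k
  reroute k robust = passes k (shifts (suc q)) (shifts-all (suc q)) U₀? id
    (subst (λ m → Robust (k * clusterSize ^ m) U₀) (sym (shifts-length (suc q))) robust)
    λ {v} _ → let σ , σ≡ , cov = core-cover (suc q) v in
      inj₂ (lose (subst (λ t → σ ∈ shifts t) σ≡ (∈-shifts σ)) (λ e → cov e))

-- Weighted sums

abstract
  ∑ : ∀ {n} → (Fin n → ℕ) → ℕ
  ∑ {zero}  f = 0
  ∑ {suc n} f = f zero + ∑ (f ∘ suc)

  ∑-mono : ∀ {n} {f g : Fin n → ℕ} → (∀ v → f v ≤ g v) → ∑ f ≤ ∑ g
  ∑-mono {zero}  le = z≤n
  ∑-mono {suc n} le = +-mono-≤ (le zero) (∑-mono (le ∘ suc))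

  ∑-cong : ∀ {n} {f g : Fin n → ℕ} → (∀ v → f v ≡ g v) → ∑ f ≡ ∑ g
  ∑-cong {zero}  e = refl
  ∑-cong {suc n} e = cong₂ _+_ (e zero) (∑-cong (e ∘ suc))

  ∑-+ : ∀ {n} (f g : Fin n → ℕ) → ∑ (λ v → f v + g v) ≡ ∑ f + ∑ g
  ∑-+ {zero}  f g = refl
  ∑-+ {suc n} f g = trans (cong (f zero + g zero +_) (∑-+ (f ∘ suc) (g ∘ suc))) (lem (f zero) (g zero) _ _)
    where
    lem : ∀ a b c d → a + b + (c + d) ≡ a + c + (b + d)
    lem = solve-∀

  ∑-* : ∀ {n} c (f : Fin n → ℕ) → ∑ (λ v → c * f v) ≡ c * ∑ f
  ∑-* {zero}  c f = sym (*-zeroʳ c)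
  ∑-* {suc n} c f = trans (cong (c * f zero +_) (∑-* c (f ∘ suc))) (sym (*-distribˡ-+ c (f zero) _))

  term≤∑ : ∀ {n} (f : Fin n → ℕ) v → f v ≤ ∑ f
  term≤∑ f zero    = m≤m+n (f zero) _
  term≤∑ f (suc v) = ≤-trans (term≤∑ (f ∘ suc) v) (m≤n+m _ (f zero))

  ∑-one : ∀ {n} → ∑ {n} (λ _ → 1) ≡ n
  ∑-one {zero}  = refl
  ∑-one {suc n} = cong suc (∑-one {n})

𝟙 : ∀ {P : Set} → Dec P → ℕ
𝟙 (yes _) = 1
𝟙 (no _)  = 0

mass : ∀ {n} → (Fin n → ℕ) → {P : Fin n → Set} → DecPred P → ℕ
mass x P? = ∑ (λ w → 𝟙 (P? w) * x w)

mass≤∑ : ∀ {n} (x : Fin n → ℕ) {P : Fin n → Set} (P? : DecPred P) → mass x P? ≤ ∑ x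
mass≤∑ x P? = ∑-mono λ w → bound (P? w) (x w)
  where
  bound : ∀ {Q : Set} (d : Dec Q) k → 𝟙 d * k ≤ k
  bound (yes _) k = ≤-reflexive (+-identityʳ k)
  bound (no _)  k = z≤n

mass-disjoint : ∀ {n} (x : Fin n → ℕ) {P Q R : Fin n → Set} (P? : DecPred P) (Q? : DecPred Q) (R? : DecPred R) →
  (∀ {w} → P w → Q w → ⊥) → (∀ {w} → P w → R w) → (∀ {w} → Q w → R w) → mass x P? + mass x Q? ≤ mass x R?
mass-disjoint x P? Q? R? disj P⊆ Q⊆ = ≤-trans (≤-reflexive (sym (∑-+ _ _))) (∑-mono pointwise)
  where
  pointwise : ∀ w → 𝟙 (P? w) * x w + 𝟙 (Q? w) * x w ≤ 𝟙 (R? w) * x w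
  pointwise w with P? w | Q? w | R? w
  ... | yes p | yes q | _     = ⊥-elim (disj p q)
  ... | yes p | no _  | yes _ = ≤-reflexive (+-identityʳ _)
  ... | yes p | no _  | no ¬r = contradiction (P⊆ p) ¬r
  ... | no _  | yes q | yes _ = ≤-refl
  ... | no _  | yes q | no ¬r = contradiction (Q⊆ q) ¬r
  ... | no _  | no _  | _     = z≤n

sumOver : ∀ {X : Set} → (X → ℕ) → List X → ℕ
sumOver f []       = 0
sumOver f (x ∷ xs) = f x + sumOver f xs

sumOver-++ : ∀ {X : Set} (f : X → ℕ) xs ys → sumOver f (xs ++ ys) ≡ sumOver f xs + sumOver f ys
sumOver-++ f []       ys = refl
sumOver-++ f (x ∷ xs) ys = trans (cong (f x +_) (sumOver-++ f xs ys)) (sym (+-assoc (f x) _ _))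

-- Every vertex u is charged y u, the weight of all vertices w discounted by the factor 4 ^ (distance of u and w);
-- F u ρ is the same with the ball of radius ρ around u shrunk to a point.
module Smooth {n : ℕ} (G : Graph n) (N : ℕ) where

  E : Rel n
  E = Edge G

  private
    near? : ∀ u w k → Dec (N ≤ k ⊎ Within E k u w)
    near? u w k = (N ℕ.≤? k) ⊎-dec within? (edge? G) k u w

  abstract
    -- the distance, capped at N
    δ : Fin n → Fin n → ℕ
    δ u w = proj₁ (least (near? u w) N (inj₁ ≤-refl))

    δ≤N : ∀ u w → δ u w ≤ N
    δ≤N u w = proj₁ (proj₂ (proj₂ (least (near? u w) N (inj₁ ≤-refl))))

    δ-within : ∀ {u w} → δ u w < N → Within E (δ u w) u w
    δ-within {u} {w} l with proj₁ (proj₂ (least (near? u w) N (inj₁ ≤-refl)))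
    ... | inj₁ N≤ = contradiction N≤ (<⇒≱ l)
    ... | inj₂ wi = wi

    within-δ : ∀ {k u w} → Within E k u w → δ u w ≤ k
    within-δ {k} {u} {w} wi = proj₂ (proj₂ (proj₂ (least (near? u w) N (inj₁ ≤-refl)))) k (inj₂ wi)

  δ-refl : ∀ u → δ u u ≡ 0
  δ-refl u = n≤0⇒n≡0 (within-δ within-refl)

  δ-shift : ∀ {j u v} → Within E j u v → ∀ w → δ u w ≤ j + δ v w
  δ-shift {j} {u} {v} wi w with δ v w ℕ.<? N
  ... | yes l = within-δ (within-trans wi (δ-within l))
  ... | no ≮  = ≤-trans (δ≤N u w) (≤-trans (≮⇒≥ ≮) (m≤n+m _ j))

  module _ (x : Fin n → ℕ) where

    F : Fin n → ℕ → ℕ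
    F u ρ = ∑ (λ w → 4 ^ (N ∸ (δ u w ∸ ρ)) * x w)

    y : Fin n → ℕ
    y u = F u 0

    inBall? : ∀ u ρ → DecPred (λ w → δ u w ≤ ρ)
    inBall? u ρ w = δ u w ℕ.≤? ρ

    -- Outside the ball each term gains a factor 4. Inside, the exponent is already `N`, so the term
    -- stays and falls short of its fourfold by 3 * 4 ^ `N` * `x w`.
    F-step : ∀ u ρ → F u (suc ρ) + 3 * 4 ^ N * mass x (inBall? u ρ) ≡ 4 * F u ρ
    F-step u ρ = trans (cong (F u (suc ρ) +_) (sym (∑-* (3 * 4 ^ N) _)))
      (trans (sym (∑-+ _ _)) (trans (∑-cong (λ w → pointwise w (inBall? u ρ w))) (∑-* 4 _)))
      where
      lem₁ : ∀ a k → a * k + 3 * a * (1 * k) ≡ 4 * (a * k)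
      lem₁ = solve-∀
      lem₂ : ∀ a b k → 4 * a * k + 3 * b * (0 * k) ≡ 4 * (a * k)
      lem₂ = solve-∀
      pointwise : ∀ w (d : Dec (δ u w ≤ ρ)) →
        4 ^ (N ∸ (δ u w ∸ suc ρ)) * x w + 3 * 4 ^ N * (𝟙 d * x w) ≡ 4 * (4 ^ (N ∸ (δ u w ∸ ρ)) * x w)
      pointwise w (yes p) rewrite m≤n⇒m∸n≡0 p | m≤n⇒m∸n≡0 (m≤n⇒m≤1+n p) = lem₁ (4 ^ N) (x w)
      pointwise w (no ≰) = trans (cong (λ e → 4 ^ e * x w + 3 * 4 ^ N * (0 * x w)) exp) (lem₂ (4 ^ (N ∸ (δ u w ∸ ρ))) (4 ^ N) (x w))
        where
        e≡ : δ u w ∸ ρ ≡ suc (δ u w ∸ suc ρ)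
        e≡ = +-∸-assoc 1 (≰⇒> ≰)
        exp : N ∸ (δ u w ∸ suc ρ) ≡ suc (N ∸ (δ u w ∸ ρ))
        exp = trans (cong (suc N ∸_) (sym e≡)) (+-∸-assoc 1 (≤-trans (m∸n≤m (δ u w) ρ) (δ≤N u w)))

    y≤F : ∀ {u v ρ} → Within E ρ u v → y v ≤ F u ρ
    y≤F {u} {v} {ρ} wi = ∑-mono λ w → *-monoˡ-≤ (x w) (^-monoʳ-≤ 4 (∸-monoʳ-≤ N
      (m≤n+o⇒m∸n≤o (δ u w) ρ (δ-shift wi w))))

    F≤ : ∀ u ρ → F u ρ ≤ 4 ^ N * ∑ x
    F≤ u ρ = ≤-trans (∑-mono λ w → *-monoˡ-≤ (x w) (^-monoʳ-≤ 4 (m∸n≤m N (δ u w ∸ ρ)))) (≤-reflexive (∑-* (4 ^ N) x))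

    y-harnack : ∀ {u v} → E u v → y v ≤ 4 * y u
    y-harnack {u} {v} e = ≤-trans (∑-mono λ w → ≤-trans (*-monoˡ-≤ (x w) (^-monoʳ-≤ 4 (exponent w))) (≤-reflexive (*-assoc 4 (4 ^ (N ∸ δ u w)) (x w))))
        (≤-reflexive (∑-* 4 (λ w → 4 ^ (N ∸ δ u w) * x w)))
      where
      exponent : ∀ w → N ∸ δ v w ≤ suc (N ∸ δ u w)
      exponent w = ≤-trans (∸-monoʳ-≤ {δ u w} {suc (δ v w)} (suc N) (δ-shift (within-edge e) w))
                           (m≤n+o⇒m∸n≤o (suc N) (δ u w) (≤-trans (s≤s (m≤n+m∸n N (δ u w))) (≤-reflexive (sym (+-suc (δ u w) _)))))

    y-self : ∀ u → 4 ^ N * x u ≤ y u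
    y-self u = ≤-trans (≤-reflexive (cong (λ e → 4 ^ (N ∸ e) * x u) (sym (δ-refl u)))) (term≤∑ (λ w → 4 ^ (N ∸ δ u w) * x w) u)

  module Growth (x : Fin n → ℕ) (x-pos : ∀ v → 1 ≤ x v) (l : ℕ) (∑x< : ∑ x < 2 ^ suc l) where

    4^N>0 : 0 < 4 ^ N
    4^N>0 = m^n>0 4 N

    -- Through `y≤F`, the weight of a tame ball bounds the charge of each single vertex in it.
    Tame : Fin n → ℕ → Set
    Tame u ρ = F x u ρ ≤ 2 * (4 ^ N * mass x (inBall? x u ρ))

    private
      doubling : ∀ f f′ m → f′ + 3 * m ≡ 4 * f → 2 * m < f → 2 * f ≤ f′
      doubling f f′ m e l = *-cancelˡ-≤ 2 (+-cancelʳ-≤ (3 * (2 * m)) _ _ (begin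
        2 * (2 * f) + 3 * (2 * m)  ≤⟨ +-monoʳ-≤ (2 * (2 * f)) (*-monoʳ-≤ 3 (<⇒≤ l)) ⟩
        2 * (2 * f) + 3 * f        ≤⟨ m≤m+n _ f ⟩
        2 * (2 * f) + 3 * f + f    ≡⟨ lem₁ f ⟩
        2 * (4 * f)                ≡⟨ cong (2 *_) (sym e) ⟩
        2 * (f′ + 3 * m)           ≡⟨ lem₂ f′ m ⟩
        2 * f′ + 3 * (2 * m)       ∎))
        where
        open ≤-Reasoning
        lem₁ : ∀ f → 2 * (2 * f) + 3 * f + f ≡ 2 * (4 * f)
        lem₁ = solve-∀
        lem₂ : ∀ f m → 2 * (f + 3 * m) ≡ 2 * f + 3 * (2 * m)
        lem₂ = solve-∀

      grow : ∀ u ρ → 2 ^ ρ * 4 ^ N ≤ F x u ρ → ¬ Tame u ρ → 2 ^ suc ρ * 4 ^ N ≤ F x u (suc ρ)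
      grow u ρ big wild = ≤-trans (≤-reflexive (*-assoc 2 (2 ^ ρ) _)) (≤-trans (*-monoʳ-≤ 2 big)
        (doubling (F x u ρ) (F x u (suc ρ)) (4 ^ N * mass x (inBall? x u ρ))
          (trans (cong (F x u (suc ρ) +_) (sym (*-assoc 3 (4 ^ N) _))) (F-step x u ρ)) (≰⇒> wild)))

      search : ∀ k ρ u → k + ρ ≡ suc l → 2 ^ ρ * 4 ^ N ≤ F x u ρ → Σ ℕ λ r → r ≤ l × Tame u r
      search zero    ρ u refl big = contradiction
        (*-cancelʳ-≤ _ _ (4 ^ N) {{ℕ.>-nonZero 4^N>0}} (≤-trans big (≤-trans (F≤ x u ρ) (≤-reflexive (*-comm (4 ^ N) _)))))
        (<⇒≱ ∑x<)
      search (suc k) ρ u e big with F x u ρ ℕ.≤? 2 * (4 ^ N * mass x (inBall? x u ρ))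
      ... | yes t = ρ , ≤-trans (m≤n+m ρ k) (≤-reflexive (suc-injective e)) , t
      ... | no ¬t = search k (suc ρ) u (trans (+-suc k ρ) e) (grow u ρ big ¬t)

    abstract
      -- As long as the radius is not tame, `F` at least doubles. It starts at 4 ^ `N` or more and
      -- never reaches 4 ^ `N` * 2 ^ (`l` + 1).
      tame : ∀ u → Σ ℕ λ ρ → ρ ≤ l × Tame u ρ
      tame u = search (suc l) 0 u (+-identityʳ (suc l)) (≤-trans (≤-reflexive (*-comm 1 _)) (≤-trans (*-monoʳ-≤ (4 ^ N) (x-pos u)) (y-self x u)))

-- Rounding an expensive metric to a separator

module CostReach {n : ℕ} (G : Graph n) {A : Fin n → Set} (A? : DecPred A)
  (y : Fin n → ℕ) (y-pos : ∀ v → 1 ≤ y v) where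

  -- Standing still is allowed so that a detour through `v` needs no case distinction when `v` is
  -- itself on the trail. It never helps, as charges are positive.
  Lazy : Rel n
  Lazy u v = u ≡ v ⊎ Edge G u v

  lazy? : DecRel Lazy
  lazy? u v = (u Fin.≟ v) ⊎-dec edge? G u v

  lazy-sym : SymRel Lazy
  lazy-sym (inj₁ e) = inj₁ (sym e)
  lazy-sym (inj₂ e) = inj₂ (edge-sym G e)

  Reach : ℕ → Fin n → Set
  Reach c u = Σ (List (Fin n)) λ zs → Σ (Fin n) λ a → Trail Lazy u zs a × A a × sumOver y (u ∷ zs) ≤ c

  private
    -- Each vertex costs at least 1, so the budget itself bounds the depth of the search.
    search : ∀ fuel c u → c ≤ fuel → Dec (Reach c u)
    search zero zero u _ = no λ (zs , _ , _ , _ , le) → <⇒≱ (≤-trans (y-pos u) (m≤m+n (y u) (sumOver y zs))) le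
    search (suc f) c u c≤ with y u ℕ.≤? c
    ... | no ≰ = no λ (zs , _ , _ , _ , le) → ≰ (≤-trans (m≤m+n (y u) (sumOver y zs)) le)
    ... | yes y≤ with A? u
    ...   | yes Au = yes ([] , u , stop , Au , ≤-trans (≤-reflexive (+-identityʳ (y u))) y≤)
    ...   | no ¬Au with any? (λ z → lazy? u z ×-dec search f (c ∸ y u) z
                          (≤-pred (≤-trans (≤-trans (≤-reflexive (+-comm 1 _)) (≤-trans (+-monoʳ-≤ (c ∸ y u) (y-pos u)) (≤-reflexive (m∸n+n≡m y≤)))) c≤)))
    ...     | yes (z , e , zs , a , p , Aa , le) = yes (z ∷ zs , a , e ▸ p , Aa ,
                ≤-trans (+-monoʳ-≤ (y u) le) (≤-reflexive (m+[n∸m]≡n y≤)))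
    ...     | no none = no λ where
                ([] , _ , stop , Aa , _) → ¬Au Aa
                (z ∷ zs , a , e ▸ p , Aa , le) → none (z , e , zs , a , p , Aa , m+n≤o⇒n≤o∸m (y u) le)
      where
      m+n≤o⇒n≤o∸m : ∀ m {n o} → m + n ≤ o → n ≤ o ∸ m
      m+n≤o⇒n≤o∸m m {n} {o} le = ≤-trans (≤-reflexive (sym (m+n∸m≡n m n))) (∸-monoˡ-≤ m le)

  abstract
    reach? : ∀ c → DecPred (Reach c)
    reach? c u = search c c u ≤-refl

  reach-mono : ∀ {c c′ u} → c ≤ c′ → Reach c u → Reach c′ u
  reach-mono c≤ (zs , a , p , Aa , le) = zs , a , p , Aa , ≤-trans le c≤

  reach-zero : ∀ {u} → ¬ Reach 0 u
  reach-zero {u} (zs , _ , _ , _ , le) = <⇒≱ (≤-trans (y-pos u) (m≤m+n (y u) (sumOver y zs))) le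

  reach-A : ∀ {a} → A a → Reach (y a) a
  reach-A {a} Aa = [] , a , stop , Aa , ≤-reflexive (+-identityʳ (y a))

  reach-edge : ∀ {c u v} → Edge G u v → Reach c v → Reach (c + y u) u
  reach-edge {c} {u} e (zs , a , p , Aa , le) =
    _ , a , inj₂ e ▸ p , Aa , ≤-trans (+-monoʳ-≤ (y u) le) (≤-reflexive (+-comm (y u) c))

  reach-trail : ∀ {M c u zs v} → Trail (Edge G ↾ (λ z → y z ≤ M)) u zs v → Reach c v → Reach (c + length zs * M) u
  reach-trail {c = c} stop r = reach-mono (≤-reflexive (sym (+-identityʳ c))) r
  reach-trail {M} {c} {u} (_▸_ {zs = zs} (e , y≤ , _) p) r = reach-mono
    (≤-trans (+-monoʳ-≤ (c + length zs * M) y≤) (≤-reflexive (lem c (length zs * M) M)))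
    (reach-edge e (reach-trail p r))
    where
    lem : ∀ a b c → a + b + c ≡ a + (c + b)
    lem = solve-∀

  -- The cost distance of `u` from `A`, its own charge included, lies in the interval from `ϑ`
  -- (excluded) to `ϑ + y u`: the level `ϑ` is crossed at `u`.
  Cut : ℕ → Fin n → Set
  Cut ϑ u = Reach (ϑ + y u) u × ¬ Reach ϑ u

  cut? : ∀ ϑ → DecPred (Cut ϑ)
  cut? ϑ u = reach? (ϑ + y u) u ×-dec ¬? (reach? ϑ u)

  crosses : ∀ {ϑ u zs b} → Trail (Edge G) u zs b → Reach (ϑ + y u) u → ¬ Reach ϑ b → Any (Cut ϑ) (u ∷ zs)
  crosses {ϑ} {u} p r ¬r with reach? ϑ u
  ... | no ¬ru = here (r , ¬ru)
  crosses stop    r ¬r | yes ru = contradiction ru ¬r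
  crosses (e ▸ p) r ¬r | yes ru = there (crosses p (reach-edge (edge-sym G e) ru) ¬r)

sumUpTo : ℕ → (ℕ → ℕ) → ℕ
sumUpTo zero    f = 0
sumUpTo (suc τ) f = sumUpTo τ f + f τ

sumUpTo-+ : ∀ τ f g → sumUpTo τ (λ ϑ → f ϑ + g ϑ) ≡ sumUpTo τ f + sumUpTo τ g
sumUpTo-+ zero    f g = refl
sumUpTo-+ (suc τ) f g = trans (cong (_+ (f τ + g τ)) (sumUpTo-+ τ f g)) (lem (sumUpTo τ f) (sumUpTo τ g) (f τ) (g τ))
  where
  lem : ∀ a b c d → a + b + (c + d) ≡ a + c + (b + d)
  lem = solve-∀

sumUpTo-cong : ∀ τ {f g} → (∀ ϑ → f ϑ ≡ g ϑ) → sumUpTo τ f ≡ sumUpTo τ g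
sumUpTo-cong zero    e = refl
sumUpTo-cong (suc τ) e = cong₂ _+_ (sumUpTo-cong τ e) (e τ)

sumUpTo-zero : ∀ τ → sumUpTo τ (λ _ → 0) ≡ 0
sumUpTo-zero zero    = refl
sumUpTo-zero (suc τ) = trans (+-identityʳ _) (sumUpTo-zero τ)

small-value : ∀ τ f c → 0 < τ → sumUpTo τ f ≤ τ * c → Σ ℕ λ ϑ → ϑ < τ × f ϑ ≤ c
small-value (suc τ) f c _ le with f τ ℕ.≤? c
... | yes f≤ = τ , ≤-refl , f≤
small-value (suc zero) f c _ le | no ≰ = contradiction (≤-trans le (≤-reflexive (+-identityʳ c))) ≰
small-value (suc (suc τ)) f c _ le | no ≰ with small-value (suc τ) f c (s≤s z≤n)
   (+-cancelʳ-≤ c _ _ (≤-trans (+-monoʳ-≤ _ (<⇒≤ (≰⇒> ≰))) (≤-trans le (≤-reflexive (+-comm c _)))))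
... | ϑ , l , f≤ = ϑ , m<n⇒m<1+n l , f≤

window-count : ∀ {P : ℕ → Set} (P? : ∀ ϑ → Dec (P ϑ)) lo hi → (∀ {ϑ} → P ϑ → lo ≤ ϑ × ϑ < hi) →
               ∀ τ → sumUpTo τ (λ ϑ → 𝟙 (P? ϑ)) ≤ hi ∸ lo
window-count P? lo hi inside τ = ≤-trans (go τ) (∸-monoˡ-≤ lo (m⊓n≤n τ hi))
  where
  go : ∀ τ → sumUpTo τ (λ ϑ → 𝟙 (P? ϑ)) ≤ (τ ℕ.⊓ hi) ∸ lo
  go zero = z≤n
  go (suc τ) with P? τ
  ... | no _ = ≤-trans (≤-reflexive (+-identityʳ _)) (≤-trans (go τ) (∸-monoˡ-≤ lo (⊓-monoˡ-≤ hi (n≤1+n τ))))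
  ... | yes p with inside p
  ...   | lo≤ , <hi = ≤-trans (+-monoˡ-≤ 1 (go τ)) (≤-reflexive (trans (+-comm _ 1)
            (trans (cong (λ m → suc (m ∸ lo)) (m≤n⇒m⊓n≡m (<⇒≤ <hi)))
              (trans (sym (+-∸-assoc 1 lo≤)) (cong (_∸ lo) (sym (m≤n⇒m⊓n≡m <hi)))))))

-- Vitali's covering argument: choose sets greedily by decreasing weight.
vitali : ∀ {X : Set} (b : X → ℕ) {Meet : X → X → Set} → (∀ u v → Dec (Meet u v)) → (∀ u → Meet u u) →
         (∀ {u v} → Meet u v → Meet v u) → ∀ fuel vs → length vs ≤ fuel →
         Σ (List X) λ net → AllPairs (λ u v → ¬ Meet u v) net × (∀ {v} → v ∈ net → v ∈ vs) ×
           (∀ {u} → u ∈ vs → Σ X λ v → v ∈ net × Meet u v × b u ≤ b v)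
vitali b Meet? refl′ sym′ fuel [] _ = [] , [] , (λ ()) , λ ()
vitali {X} b {Meet} Meet? refl′ sym′ (suc fuel) vs@(v₀ ∷ vs₀) (s≤s len≤) = top ∷ net ,
    (All.tabulate (λ m → proj₂ (∈-filter⁻ P? {xs = vs} (net⊆ m))) ∷ net-apart) ,
    (λ { (here refl) → top∈ ; (there m) → proj₁ (∈-filter⁻ P? {xs = vs} (net⊆ m)) }) ,
    λ {u} u∈ → case Meet? top u of λ where
      (yes m) → top , here refl , sym′ m , top-max u∈
      (no ¬m) → let v , v∈ , m , le = cover (∈-filter⁺ P? u∈ ¬m) in v , there v∈ , m , le
  where
  maximum : ∀ v vs → Σ X λ t → t ∈ v ∷ vs × (∀ {u} → u ∈ v ∷ vs → b u ≤ b t)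
  maximum v [] = v , here refl , λ { (here refl) → ≤-refl }
  maximum v (v′ ∷ vs) with maximum v′ vs
  ... | t , t∈ , max with b v ℕ.≤? b t
  ...   | yes le = t , there t∈ , λ { (here refl) → le ; (there m) → max m }
  ...   | no ≰   = v , here refl , λ { (here refl) → ≤-refl ; (there m) → ≤-trans (max m) (<⇒≤ (≰⇒> ≰)) }
  top = proj₁ (maximum v₀ vs₀)
  top∈ = proj₁ (proj₂ (maximum v₀ vs₀))
  top-max : ∀ {u} → u ∈ vs → b u ≤ b top
  top-max = proj₂ (proj₂ (maximum v₀ vs₀))
  P? : ∀ u → Dec (¬ Meet top u)
  P? u = ¬? (Meet? top u)
  rec = vitali b Meet? refl′ sym′ fuel (filter P? vs)
    (≤-pred (≤-trans (filter-notAll P? vs (lose top∈ (λ ¬m → ¬m (refl′ top)))) (s≤s len≤)))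
  net = proj₁ rec
  net-apart = proj₁ (proj₂ rec)
  net⊆ : ∀ {v} → v ∈ net → v ∈ filter P? vs
  net⊆ = proj₁ (proj₂ (proj₂ rec))
  cover : ∀ {u} → u ∈ filter P? vs → Σ X λ v → v ∈ net × Meet u v × b u ≤ b v
  cover = proj₂ (proj₂ (proj₂ rec))

enumerate : ∀ {n} (I : Subset n) → Σ (Fin Sub.∣ I ∣ → Fin n) λ f → (∀ {i j} → f i ≡ f j → i ≡ j) × (∀ i → f i Sub.∈ I)
enumerate Vec.[] = (λ ()) , (λ { {()} }) , λ ()
enumerate (false Vec.∷ I) with enumerate I
... | f , inj , mem = suc ∘ f , inj ∘ Finₚ.suc-injective , Vec.there ∘ mem
enumerate {suc n} (true Vec.∷ I) with enumerate I
... | f , inj , mem = f′ , inj′ , mem′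
  where
  f′ : Fin (suc Sub.∣ I ∣) → Fin (suc n)
  f′ zero    = zero
  f′ (suc i) = suc (f i)
  inj′ : ∀ {i j} → f′ i ≡ f′ j → i ≡ j
  inj′ {zero}  {zero}  _ = refl
  inj′ {suc i} {suc j} e = cong suc (inj (Finₚ.suc-injective e))
  mem′ : ∀ i → f′ i Sub.∈ (true Vec.∷ I)
  mem′ zero    = Vec.here
  mem′ (suc i) = Vec.there (mem i)

module Rounding {n : ℕ} (G : Graph n) (N l m : ℕ) (l<N : l < N) (1≤l : 1 ≤ l) (m<2^ : m < 2 ^ suc l) (2^≤ : 2 ^ l ≤ 2 * n)
  (x : Fin n → ℕ) (x-pos : ∀ v → 1 ≤ x v) (∑x≤ : ∑ x ≤ m)
  {A B : Fin n → Set} (A? : DecPred A) where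

  open Smooth G N
  open Growth x x-pos l (≤-trans (s≤s ∑x≤) m<2^)

  y-pos : ∀ v → 1 ≤ y x v
  y-pos v = ≤-trans (*-mono-≤ 4^N>0 (x-pos v)) (y-self x v)

  open CostReach G A? (y x) y-pos

  ρ : Fin n → ℕ
  ρ u = proj₁ (tame u)

  ρ≤ : ∀ u → ρ u ≤ l
  ρ≤ u = proj₁ (proj₂ (tame u))

  ball? : ∀ u → DecPred (λ w → δ u w ≤ ρ u)
  ball? u = inBall? x u (ρ u)

  -- `M u` bounds all charges in the tame ball of `u`. `Δ u` is the price of two walks of at most
  -- `l` steps at that rate, from one centre to the other of two meeting balls; the factor `l` is a
  -- bound on the radii.
  b M Δ : Fin n → ℕ
  b u = mass x (ball? u)
  M u = 2 * (4 ^ N * b u)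
  Δ u = 2 * (l * M u)

  Meet : Fin n → Fin n → Set
  Meet u v = Σ (Fin n) λ w → δ u w ≤ ρ u × δ v w ≤ ρ v

  meet? : ∀ u v → Dec (Meet u v)
  meet? u v = any? λ w → ball? u w ×-dec ball? v w

  meet-refl : ∀ u → Meet u u
  meet-refl u = u , ≤-trans (≤-reflexive (δ-refl u)) z≤n , ≤-trans (≤-reflexive (δ-refl u)) z≤n

  meet-sym : ∀ {u v} → Meet u v → Meet v u
  meet-sym (w , p , q) = w , q , p

  ball-within : ∀ {u w} → δ u w ≤ ρ u → Within E (ρ u) u w
  ball-within {u} p = within-mono p (δ-within (≤-trans (s≤s (≤-trans p (ρ≤ u))) l<N))

  y≤M : ∀ {u v} → Within E (ρ u) u v → y x v ≤ M u
  y≤M {u} wi = ≤-trans (y≤F x wi) (proj₂ (proj₂ (tame u)))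

  cheap-within : ∀ {u w k} → M u ≤ k → δ u w ≤ ρ u → Within (E ↾ (λ z → y x z ≤ k)) l u w
  cheap-within {u} {w} {k} M≤ d≤ = let zs , le , p = ball-within d≤ in
    zs , ≤-trans le (ρ≤ u) , go within-refl le p
    where
    go : ∀ {a z zs} → Within E a u z → a + length zs ≤ ρ u → Trail E z zs w → Trail (E ↾ (λ z → y x z ≤ k)) z zs w
    go wi le stop = stop
    go {a} wi le (_▸_ {v = z′} {zs = zs} e p) =
      (e , ≤-trans (y≤M (within-mono (≤-trans (m≤m+n a _) le) wi)) M≤
         , ≤-trans (y≤M (within-mono (≤-trans (m≤m+n (suc a) _) le′) wi′)) M≤) ▸ go wi′ le′ p
      where
      wi′ : Within E (suc a) u z′
      wi′ = within-mono (≤-reflexive (+-comm a 1)) (within-trans wi (within-edge e))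
      le′ : suc a + length zs ≤ ρ u
      le′ = ≤-trans (≤-reflexive (sym (+-suc a _))) le

  M-mono : ∀ {u v} → b u ≤ b v → M u ≤ M v
  M-mono le = *-monoʳ-≤ 2 (*-monoʳ-≤ (4 ^ N) le)

  reach-within : ∀ {k c u v} → Within (E ↾ (λ z → y x z ≤ k)) l u v → Reach c v → Reach (c + l * k) u
  reach-within {k} {c} (zs , le , p) r = reach-mono (+-monoʳ-≤ c (*-monoˡ-≤ k le)) (reach-trail p r)

  reach-meet : ∀ {u v c} → Meet u v → b u ≤ b v → (Reach c u → Reach (c + Δ v) v) × (Reach c v → Reach (c + Δ v) u)
  reach-meet {u} {v} {c} (w , d , d′) le =
      (λ r → reach-mono total (reach-within vw (reach-within (back uw) r))) ,
      (λ r → reach-mono total (reach-within uw (reach-within (back vw) r)))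
    where
    uw : Within (E ↾ (λ z → y x z ≤ M v)) l u w
    uw = cheap-within (M-mono le) d
    vw : Within (E ↾ (λ z → y x z ≤ M v)) l v w
    vw = cheap-within ≤-refl d′
    back : ∀ {u v} → Within (E ↾ (λ z → y x z ≤ M _)) l u v → Within (E ↾ (λ z → y x z ≤ M _)) l v u
    back = within-sym (↾-sym {X = λ z → y x z ≤ M v} (edge-sym G))
    total : c + l * M v + l * M v ≤ c + Δ v
    total = ≤-reflexive (trans (+-assoc c _ _) (cong (λ k → c + (l * M v + k)) (sym (+-identityʳ (l * M v)))))

  -- What a cut vertex imposes on its representative, stated in terms of the representative alone:
  -- one `Δ v` on either side for the walk between the two, and another one for the charge of the
  -- cut vertex.
  Touch : ℕ → Fin n → Set
  Touch ϑ v = Reach (ϑ + 2 * Δ v) v × ¬ Reach (ϑ ∸ Δ v) v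

  touch? : ∀ ϑ v → Dec (Touch ϑ v)
  touch? ϑ v = reach? (ϑ + 2 * Δ v) v ×-dec ¬? (reach? (ϑ ∸ Δ v) v)

  cut-touch : ∀ {ϑ u v} → Meet u v → b u ≤ b v → Cut ϑ u → Touch ϑ v
  cut-touch {ϑ} {u} {v} meet le (r , ¬r) =
      reach-mono (≤-trans (+-monoˡ-≤ (Δ v) (+-monoʳ-≤ ϑ y≤Δ))
        (≤-reflexive (trans (+-assoc ϑ _ _) (cong (λ k → ϑ + (Δ v + k)) (sym (+-identityʳ (Δ v)))))))
        (proj₁ (reach-meet meet le) r) ,
      λ r′ → case Δ v ℕ.≤? ϑ of λ where
        (yes Δ≤) → ¬r (reach-mono (≤-reflexive (m∸n+n≡m Δ≤)) (proj₂ (reach-meet meet le) r′))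
        -- Here the truncated difference is 0, and nothing is reached at cost 0.
        (no ≰)   → reach-zero (subst (λ k → Reach k v) (m≤n⇒m∸n≡0 (<⇒≤ (≰⇒> ≰))) r′)
    where
    y≤Δ : y x u ≤ Δ v
    y≤Δ = ≤-trans (y≤M within-refl) (≤-trans (M-mono le) (≤-trans (≤-reflexive (sym (*-identityˡ (M v))))
            (≤-trans (*-monoˡ-≤ (M v) 1≤l) (m≤m+n _ _))))

  -- If `c` is the cost distance of `v`, the thresholds in question lie between `c ∸ 2 * Δ v` and
  -- `c + Δ v`. If no budget up to `τ + 2 * Δ v` reaches `v`, there are none.
  touch-count : ∀ τ v → sumUpTo τ (λ ϑ → 𝟙 (touch? ϑ v)) ≤ 3 * Δ v
  touch-count τ v with any? (λ (i : Fin (suc (τ + 2 * Δ v))) → reach? (toℕ i) v)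
  ... | no none = ≤-trans (bounded τ ≤-refl) z≤n
    where
    bounded : ∀ τ′ → τ′ ≤ τ → sumUpTo τ′ (λ ϑ → 𝟙 (touch? ϑ v)) ≤ 0
    bounded zero _ = z≤n
    bounded (suc τ′) le with touch? τ′ v
    ... | no _ = ≤-trans (≤-reflexive (+-identityʳ _)) (bounded τ′ (<⇒≤ le))
    ... | yes (r , _) = contradiction (fromℕ< l′ , subst (λ k → Reach k v) (sym (toℕ-fromℕ< l′)) r) none
      where
      l′ : τ′ + 2 * Δ v < suc (τ + 2 * Δ v)
      l′ = s≤s (+-monoˡ-≤ (2 * Δ v) (<⇒≤ le))
  ... | yes (i , r) with least (λ c → reach? c v) (toℕ i) r
  ...   | c , rc , _ , min = ≤-trans
          (window-count (λ ϑ → touch? ϑ v) (c ∸ 2 * Δ v) (c + Δ v)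
            (λ {ϑ} (r , ¬r) → m≤n+o⇒m∸n≤o c (2 * Δ v) (≤-trans (min _ r) (≤-reflexive (+-comm ϑ _))) ,
              below ϑ ¬r) τ)
          (m≤n+o⇒m∸n≤o (c + Δ v) (c ∸ 2 * Δ v) (≤-trans (+-monoˡ-≤ (Δ v) (m≤n+m∸n c (2 * Δ v)))
            (≤-reflexive (lem (Δ v) (c ∸ 2 * Δ v)))))
    where
    lem : ∀ d e → 2 * d + e + d ≡ e + 3 * d
    lem = solve-∀
    below : ∀ ϑ → ¬ Reach (ϑ ∸ Δ v) v → ϑ < c + Δ v
    below ϑ ¬r with ϑ ℕ.<? c + Δ v
    ... | yes p = p
    ... | no ≮ = contradiction (reach-mono (≤-trans (≤-reflexive (sym (m+n∸n≡m c (Δ v)))) (∸-monoˡ-≤ (Δ v) (≮⇒≥ ≮))) rc) ¬r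

  touch-sum : ∀ τ net → sumUpTo τ (λ ϑ → length (filter (touch? ϑ) net)) ≤ sumOver (λ v → 3 * Δ v) net
  touch-sum τ []        = ≤-reflexive (sumUpTo-zero τ)
  touch-sum τ (v ∷ net) = ≤-trans (≤-reflexive (trans (sumUpTo-cong τ split) (sumUpTo-+ τ _ _)))
                                  (+-mono-≤ (touch-count τ v) (touch-sum τ net))
    where
    split : ∀ ϑ → length (filter (touch? ϑ) (v ∷ net)) ≡ 𝟙 (touch? ϑ v) + length (filter (touch? ϑ) net)
    split ϑ with touch? ϑ v
    ... | yes t = cong length (filter-accept (touch? ϑ) t)
    ... | no ¬t = cong length (filter-reject (touch? ϑ) ¬t)

  union? : ∀ net → DecPred (λ w → Any (λ v → δ v w ≤ ρ v) net)
  union? net w = Any.any? (λ v → ball? v w) net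

  net-mass : ∀ net → AllPairs (λ u v → ¬ Meet u v) net → sumOver b net ≤ mass x (union? net)
  net-mass []        _          = z≤n
  net-mass (v ∷ net) (ap ∷ aps) = ≤-trans (+-monoʳ-≤ (b v) (net-mass net aps))
    (mass-disjoint x (ball? v) (union? net) (union? (v ∷ net)) disj here there)
    where
    disj : ∀ {w} → δ v w ≤ ρ v → Any (λ v → δ v w ≤ ρ v) net → ⊥
    disj {w} d a = let u , u∈ , d′ = find a in All.lookup ap u∈ (w , d , d′)

  abstract
    net-data : Σ (List (Fin n)) λ net → AllPairs (λ u v → ¬ Meet u v) net × (∀ {v} → v ∈ net → v ∈ allFin n) ×
               (∀ {u} → u ∈ allFin n → Σ (Fin n) λ v → v ∈ net × Meet u v × b u ≤ b v)
    net-data = vitali b meet? meet-refl meet-sym (length (allFin n)) (allFin n) ≤-refl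

  net : List (Fin n)
  net = proj₁ net-data

  rep : Fin n → Fin n
  rep u = proj₁ (proj₂ (proj₂ (proj₂ net-data)) (∈-allFin u))

  rep∈ : ∀ u → rep u ∈ net
  rep∈ u = proj₁ (proj₂ (proj₂ (proj₂ (proj₂ net-data)) (∈-allFin u)))

  rep-meet : ∀ u → Meet u (rep u)
  rep-meet u = proj₁ (proj₂ (proj₂ (proj₂ (proj₂ (proj₂ net-data)) (∈-allFin u))))

  rep-b : ∀ u → b u ≤ b (rep u)
  rep-b u = proj₂ (proj₂ (proj₂ (proj₂ (proj₂ (proj₂ net-data)) (∈-allFin u))))

  -- The balls of the net are disjoint, so their weights add up to at most `m`; 12 is 3 from the
  -- window times 2 from `Δ` times 2 from `M`.
  touch-total : ∀ τ → sumUpTo τ (λ ϑ → length (filter (touch? ϑ) net)) ≤ 12 * l * (4 ^ N * m)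
  touch-total τ = ≤-trans (touch-sum τ net) (≤-trans (≤-reflexive (scale net))
    (≤-trans (*-monoʳ-≤ (12 * l) (*-monoʳ-≤ (4 ^ N) (≤-trans (net-mass net (proj₁ (proj₂ net-data)))
      (≤-trans (mass≤∑ x (union? net)) ∑x≤)))) ≤-refl))
    where
    lem₁ : ∀ l p b s → 3 * (2 * (l * (2 * (p * b)))) + 12 * l * (p * s) ≡ 12 * l * (p * (b + s))
    lem₁ = solve-∀
    lem₀ : ∀ l p → 0 ≡ 12 * l * (p * 0)
    lem₀ = solve-∀
    scale : ∀ net → sumOver (λ v → 3 * Δ v) net ≡ 12 * l * (4 ^ N * sumOver b net)
    scale []        = lem₀ l (4 ^ N)
    scale (v ∷ net) = trans (cong (3 * Δ v +_) (scale net)) (lem₁ l (4 ^ N) (b v) (sumOver b net))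

  -- Vertices with a common representative are joined through four radii, at distance at most 4 `l`,
  -- and 2 ^ (4 `l`) ≤ (2n) ^ 4 contradicts `FarApart`. Hence a distance independent subset of the
  -- cut injects into the touched part of the net.
  rep-injective : ∀ {u v} → rep u ≡ rep v → (u ≢ v → FarApart G u v) → u ≡ v
  rep-injective {u} {v} e far with u Fin.≟ v
  ... | yes u≡v = u≡v
  ... | no u≢v = contradiction (far u≢v path (trans start≡ (sym g.at-A)) (trans end≡ (sym g.at-B))) (≤⇒≯ short)
    where
    half : ∀ u → Within E (l + l) u (rep u)
    half u = let w , d , d′ = rep-meet u in within-trans (within-mono (ρ≤ u) (ball-within d))
      (within-sym (edge-sym G) (within-mono (ρ≤ (rep u)) (ball-within d′)))
    whole : Within E (l + l + (l + l)) u v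
    whole = within-trans (half u) (subst (λ r → Within E (l + l) r v) (sym e) (within-sym (edge-sym G) (half v)))
    g = geodesic₂ (edge? G) (proj₁ whole , proj₂ (proj₂ whole))
    module g = Geodesic g
    open PathAlong (geodesicPath G id g)
    len≤ : len path ≤ l * 4
    len≤ = ≤-trans (≤-reflexive len≡) (≤-trans (g.minimal refl refl (proj₂ (proj₂ whole)))
             (≤-trans (proj₁ (proj₂ whole)) (≤-reflexive (lem l))))
      where
      lem : ∀ l → l + l + (l + l) ≡ l * 4
      lem = solve-∀
    short : 2 ^ len path ≤ (2 * n) ^ 16
    short = ≤-trans (^-monoʳ-≤ 2 len≤) (≤-trans (≤-reflexive (sym (^-*-assoc 2 l 4)))
      (≤-trans (^-monoˡ-≤ 4 2^≤) (^-monoʳ-≤ (2 * n) {{ℕ.>-nonZero (≤-trans (m^n>0 2 l) 2^≤)}} (m≤m+n 4 12))))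

  trailOf : ∀ {u us} → Linked (Edge G) (u ∷ us) → Trail (Edge G) u us (List⁺.last (u ∷ us))
  trailOf [-] = stop
  trailOf {u} (_∷_ {y = v} {xs = us} e p) = subst (Trail (Edge G) u (v ∷ us)) (sym (last-∷ u v us)) (e ▸ trailOf p)

  cheap-cut : ∀ τ c → 0 < τ → 12 * l * (4 ^ N * m) ≤ τ * c → (∀ {c v} → B v → Reach c v → τ ≤ c) →
    Σ (Subset n) λ S → (∀ (P : Path G) → A (start P) → B (end P) → Any (Sub._∈ S) (List⁺.toList (Path.verts P))) ×
                       (∀ I → DistIndep G S I → Sub.∣ I ∣ ≤ c)
  cheap-cut τ c 0<τ heavy costly = cutAt (small-value τ _ c 0<τ (≤-trans (touch-total τ) heavy))
    where
    cutAt : (Σ ℕ λ ϑ → ϑ < τ × length (filter (touch? ϑ) net) ≤ c) → _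
    cutAt (ϑ , ϑ<τ , few) = ⟦ cut? ϑ ⟧ , separates , small
      where
      separates : ∀ (P : Path G) → A (start P) → B (end P) → Any (Sub._∈ ⟦ cut? ϑ ⟧) (List⁺.toList (Path.verts P))
      separates P Aa Bb = Any.map (∈⟦⟧⁺ (cut? ϑ)) (crosses (trailOf (Path.linked P))
        (reach-mono (m≤n+m _ ϑ) (reach-A Aa)) (λ r → <⇒≱ ϑ<τ (costly Bb r)))
      small : ∀ I → DistIndep G ⟦ cut? ϑ ⟧ I → Sub.∣ I ∣ ≤ c
      small I (I⊆ , far) = let f , inj , mem = enumerate I in ≤-trans
        (inj-length (rep ∘ f) (λ {i} {j} e → inj (rep-injective e (far (f i) (f j) (mem i) (mem j)))) (filter (touch? ϑ) net)
          (λ i → ∈-filter⁺ (touch? ϑ) (rep∈ (f i))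
            (cut-touch (rep-meet (f i)) (rep-b (f i)) (∈⟦⟧⁻ (cut? ϑ) (I⊆ (mem i)))))) few

-- Collecting cheap paths

abstract
  cutBound : ℕ → ℕ → ℕ
  cutBound l T = 96 * l * T

  cutBound-def : ∀ l T → cutBound l T ≡ 96 * l * T
  cutBound-def l T = refl

  -- 96 = 12 * 2 * 4: the window total, the weight bound 2n, and the threshold between cheap and
  -- expensive.
  cutBound-heavy : ∀ l T τ n p → n * p ≤ 4 * T * τ → 12 * l * (p * (2 * n)) ≤ τ * cutBound l T
  cutBound-heavy l T τ n p le = ≤-trans (≤-reflexive (lem₁ l p n)) (≤-trans (*-monoʳ-≤ (24 * l) le) (≤-reflexive (lem₂ l T τ)))
    where
    lem₁ : ∀ l p n → 12 * l * (p * (2 * n)) ≡ 24 * l * (n * p)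
    lem₁ = solve-∀
    lem₂ : ∀ l T τ → 24 * l * (4 * T * τ) ≡ τ * (96 * l * T)
    lem₂ = solve-∀

count-split : ∀ {X : Set} {P : X → Set} (P? : ∀ z → Dec (P z)) L k → length (filter P? L) ≡ suc k →
  Σ (List X) λ pre → Σ X λ u → Σ (List X) λ zs → L ≡ pre ++ u ∷ zs × P u × length (filter P? zs) ≡ k
count-split P? (z ∷ L) k e with P? z
... | yes p = [] , z , L , refl , p , suc-injective e
... | no ¬p = let pre , u , zs , q , pu , c = count-split P? L k e in z ∷ pre , u , zs , cong (z ∷_) q , pu , c

-- `z` is the last element with `P`; each of the `k` earlier ones costs at least a quarter of `h`.
weighted-split : ∀ {X : Set} {P : X → Set} (P? : ∀ z → Dec (P z)) (f : X → ℕ) h → (∀ {z} → P z → h ≤ 4 * f z) →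
  ∀ zs k → length (filter P? zs) ≡ suc k →
  Σ (List X) λ as → Σ X λ z → Σ (List X) λ bs → zs ≡ as ++ z ∷ bs × P z × k * h ≤ 4 * sumOver f as
weighted-split P? f h heavy (z ∷ zs) k e with P? z
... | no ¬p = let as , z′ , bs , q , p , le = weighted-split P? f h heavy zs k e in
      z ∷ as , z′ , bs , cong (z ∷_) q , p ,
      ≤-trans le (*-monoʳ-≤ 4 (m≤n+m (sumOver f as) (f z)))
weighted-split P? f h heavy (z ∷ zs) zero    e | yes p = [] , z , zs , refl , p , z≤n
weighted-split P? f h heavy (z ∷ zs) (suc k) e | yes p =
      let as , z′ , bs , q , p′ , le = weighted-split P? f h heavy zs k (suc-injective e) in
      z ∷ as , z′ , bs , cong (z ∷_) q , p′ ,
      ≤-trans (+-mono-≤ (heavy p) le) (≤-reflexive (sym (*-distribˡ-+ 4 (f z) _)))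

module Strands {n : ℕ} (G : Graph n) {A B : Fin n → Set} (A? : DecPred A) (B? : DecPred B) where

  Closed : Rel n
  Closed v z = v ≡ z ⊎ Edge G v z

  closed? : DecRel Closed
  closed? v z = (v Fin.≟ z) ⊎-dec edge? G v z

  Hit : List (Fin n) → Fin n → Set
  Hit L v = Any (Closed v) L

  hit? : ∀ L → DecPred (Hit L)
  hit? L v = Any.any? (closed? v) L

  record Strand (L : List (Fin n)) : Set where
    field
      {source target} : Fin n
      source∈A  : A source
      target∈B  : B target
      source∈   : source ∈ L
      connects  : Conn (Edge G ↾ (_∈ L)) source target
      sparse    : ∀ v → length (filter (closed? v) L) ≤ 6

  NiceCut : ℕ → Set
  NiceCut c = Σ (Subset n) λ S →
    (∀ (P : Path G) → A (start P) → B (end P) → Any (Sub._∈ S) (List⁺.toList (Path.verts P))) ×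
    (∀ I → DistIndep G S I → Sub.∣ I ∣ ≤ c)

  module Round (l : ℕ) (1≤l : 1 ≤ l) (l<2n : l < 2 * n) (2^≤ : 2 ^ l ≤ 2 * n) (2n<2^ : 2 * n < 2 ^ suc l)
    (x : Fin n → ℕ) (x-pos : ∀ v → 1 ≤ x v) (∑x≤ : ∑ x ≤ 2 * n) (T : ℕ) where

    N : ℕ
    N = 2 * n

    open Smooth G N hiding (E)
    module Cut = Rounding G N l (2 * n) l<2n 1≤l 2n<2^ 2^≤ x x-pos ∑x≤ {A} {B} A?
    open CostReach G A? (y x) Cut.y-pos

    Cheapest : ℕ → Set
    Cheapest τ = ∀ {c v} → B v → Reach c v → τ ≤ c

    detour : ∀ {v b zs₀ a} → Trail Lazy b zs₀ a → ∀ pre u as z bs → b ∷ zs₀ ≡ pre ++ u ∷ (as ++ z ∷ bs) →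
             Lazy u v → Lazy v z → Σ (List (Fin n)) λ zs₁ → Trail Lazy b zs₁ a ×
             sumOver (y x) (b ∷ zs₁) ≡ sumOver (y x) (pre ++ u ∷ v ∷ z ∷ bs)
    detour p [] u as z bs refl e e′ = _ , e ▸ e′ ▸ proj₂ (splitTrail as bs p) , refl
    detour (e₀ ▸ p) (_ ∷ pre) u as z bs q e e′ with ∷-injective q
    ... | refl , q′ with detour p pre u as z bs q′ e e′
    ...   | zs₁ , r , s = _ , e₀ ▸ r , cong (y x _ +_) s
    detour stop (_ ∷ [])      u as z bs () e e′
    detour stop (_ ∷ _ ∷ pre) u as z bs () e e′

    -- Otherwise the detour through v would be cheaper, as y varies by a factor of at most 4 around v.
    cheapest-sparse : ∀ {τ b zs a} → Trail Lazy b zs a → A a → B b → sumOver (y x) (b ∷ zs) ≤ τ → Cheapest τ →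
                      ∀ v → length (filter (closed? v) (b ∷ zs)) ≤ 6
    cheapest-sparse {τ} {b} {zs} {a} p Aa Bb le cheapest v =
        bound (length (filter (closed? v) (b ∷ zs))) refl
      where
      heavy : ∀ {z} → Closed v z → y x v ≤ 4 * y x z
      heavy (inj₁ refl) = m≤m+n (y x v) _
      heavy (inj₂ e)    = y-harnack x (edge-sym G e)
      few : ∀ k → k * y x v ≤ 4 * y x v → k ≤ 4
      few k le = *-cancelʳ-≤ k 4 (y x v) {{ℕ.>-nonZero (Cut.y-pos v)}} le
      bound : ∀ c → length (filter (closed? v) (b ∷ zs)) ≡ c → c ≤ 6
      bound zero          e = z≤n
      bound (suc zero)    e = s≤s z≤n
      bound (suc (suc k)) e
        with count-split (closed? v) (b ∷ zs) (suc k) e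
      ... | pre , u , ws , q , vu , c with weighted-split (closed? v) (y x) (y x v) heavy ws k c
      ... | as , z , bs , refl , vz , le′ with detour p pre u as z bs q (lazy-sym vu) vz
      -- At most 4 hits strictly between the first hit `u` and the last hit `z`, hence the 6.
      ... | zs₁ , p₁ , cost₁ = s≤s (s≤s (few k (≤-trans le′ (*-monoʳ-≤ 4 short))))
        where
        s = sumOver (y x)
        old : s (pre ++ u ∷ (as ++ z ∷ bs)) ≡ s as + (s pre + (y x u + (y x z + s bs)))
        old = trans (sumOver-++ (y x) pre _) (trans (cong (λ t → s pre + (y x u + t)) (sumOver-++ (y x) as (z ∷ bs)))
                (lem (s pre) (y x u) (s as) (y x z + s bs)))
          where
          lem : ∀ p u a r → p + (u + (a + r)) ≡ a + (p + (u + r))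
          lem = solve-∀
        new : s (pre ++ u ∷ v ∷ z ∷ bs) ≡ y x v + (s pre + (y x u + (y x z + s bs)))
        new = trans (sumOver-++ (y x) pre _) (lem (s pre) (y x u) (y x v) (y x z + s bs))
          where
          lem : ∀ p u a r → p + (u + (a + r)) ≡ a + (p + (u + r))
          lem = solve-∀
        short : s as ≤ y x v
        short = +-cancelʳ-≤ (s pre + (y x u + (y x z + s bs))) _ _ (≤-trans
          (≤-trans (≤-reflexive (trans (sym old) (cong s (sym q)))) le)
          (≤-trans (cheapest Bb (zs₁ , a , p₁ , Aa , ≤-refl)) (≤-reflexive (trans cost₁ new))))

    unlazy : ∀ {u zs v} → Trail Lazy u zs v → Conn (Edge G ↾ (_∈ u ∷ zs)) u v
    unlazy stop = conn-refl
    unlazy {u} {v = w} (_▸_ {v = z} {zs} e p) = prepend e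
      where
      tail : Conn (Edge G ↾ (_∈ u ∷ z ∷ zs)) z w
      tail = conn-map (λ (e , m , m′) → e , there m , there m′) (unlazy p)
      prepend : Lazy u z → Conn (Edge G ↾ (_∈ u ∷ z ∷ zs)) u w
      prepend (inj₁ refl) = tail
      prepend (inj₂ e)    = conn-trans (conn-edge (e , here refl , there (here refl))) tail

    -- Every `w` in the closed neighbourhood of a vertex `u` on the trail adds at least a quarter of
    -- 4 ^ `N` * `x w` to the charge of `u`.
    hit-mass : ∀ L → 4 ^ N * mass x (hit? L) ≤ 4 * sumOver (y x) L
    hit-mass [] = ≤-trans (*-monoʳ-≤ (4 ^ N) (≤-trans (∑-mono {g = λ w → 0 * x w} (λ w → ≤-refl)) (≤-reflexive (∑-* 0 x))))
                          (≤-reflexive (*-zeroʳ (4 ^ N)))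
    hit-mass (u ∷ L) = ≤-trans (*-monoʳ-≤ (4 ^ N) (≤-trans (∑-mono (λ w → split w (hit? (u ∷ L) w) (closed? w u) (hit? L w))) (≤-reflexive (∑-+ _ _))))
      (≤-trans (≤-reflexive (*-distribˡ-+ (4 ^ N) _ _)) (≤-trans (+-mono-≤ around (hit-mass L))
        (≤-reflexive (sym (*-distribˡ-+ 4 (y x u) _)))))
      where
      split : ∀ w (d : Dec (Hit (u ∷ L) w)) (d₁ : Dec (Closed w u)) (d₂ : Dec (Hit L w)) →
              𝟙 d * x w ≤ 𝟙 d₁ * x w + 𝟙 d₂ * x w
      split w (no _)          _       _       = z≤n
      split w (yes _)         (yes _) _       = m≤m+n _ _
      split w (yes (here p))  (no ¬p) _       = contradiction p ¬p
      split w (yes (there h)) (no _)  (yes _) = ≤-refl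
      split w (yes (there h)) (no _)  (no ¬h) = contradiction h ¬h
      point : ∀ w (d : Dec (Closed w u)) → 4 ^ N * (𝟙 d * x w) ≤ 4 * (4 ^ (N ∸ δ u w) * x w)
      point w (no _) = ≤-trans (≤-reflexive (*-zeroʳ (4 ^ N))) z≤n
      point w (yes c) = ≤-trans (≤-reflexive (cong (4 ^ N *_) (*-identityˡ (x w))))
        (≤-trans (*-monoˡ-≤ (x w) (^-monoʳ-≤ 4 {N} {suc (N ∸ δ u w)}
          (≤-trans (m≤n+m∸n N (δ u w)) (+-monoˡ-≤ (N ∸ δ u w) (within-δ (near c))))))
          (≤-reflexive (*-assoc 4 (4 ^ (N ∸ δ u w)) (x w))))
        where
        near : ∀ {w} → Closed w u → Within (Edge G) 1 u w
        near (inj₁ refl) = within-refl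
        near (inj₂ e)    = within-edge (edge-sym G e)
      around : 4 ^ N * mass x (λ w → closed? w u) ≤ 4 * y x u
      around = ≤-trans (≤-reflexive (sym (∑-* (4 ^ N) _))) (≤-trans (∑-mono (λ w → point w (closed? w u))) (≤-reflexive (∑-* 4 _)))

    Outcome : Set
    Outcome = NiceCut (cutBound l T) ⊎ Σ (List (Fin n)) λ L → Strand L × T * mass x (hit? L) ≤ n

    connected-case : ∀ {c b} → B b → Reach c b → Outcome
    connected-case {c₀} {b₀} Bb₀ r₀ = decide
        (least (λ c → any? λ b → B? b ×-dec reach? c b) c₀ (b₀ , Bb₀ , r₀))
      where
      decide : (Σ ℕ λ τ → (Σ (Fin n) λ b → B b × Reach τ b) × τ ≤ c₀ ×
                 (∀ i → (Σ (Fin n) λ b → B b × Reach i b) → τ ≤ i)) → Outcome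
      decide (τ , (b , Bb , r@(zs , a , p , Aa , le)) , _ , min) = split (4 * T * τ ℕ.≤? n * 4 ^ N)
        where
        cheapest : Cheapest τ
        cheapest Bv rv = min _ (_ , Bv , rv)
        0<τ : 0 < τ
        0<τ = n≢0⇒n>0 λ { refl → reach-zero r }
        -- The threshold is set so that a path on the light side raises the total weight by at most
        -- n / `T`, while on the heavy side the averaged cut is within `cutBound l T`.
        split : Dec (4 * T * τ ≤ n * 4 ^ N) → Outcome
        split (no ≰) = inj₁ (Cut.cheap-cut τ (cutBound l T) 0<τ (cutBound-heavy l T τ n (4 ^ N) (<⇒≤ (≰⇒> ≰))) cheapest)
        split (yes light) = inj₂ (b ∷ zs , record
            { source∈A = Aa ; target∈B = Bb ; source∈ = end∈ p
            ; connects = conn-sym (↾-sym {X = _∈ b ∷ zs} (edge-sym G)) (unlazy p)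
            ; sparse = cheapest-sparse p Aa Bb le cheapest } ,
          *-cancelʳ-≤ _ _ (4 ^ N) {{ℕ.>-nonZero (m^n>0 4 N)}} (begin
            T * mass x (hit? (b ∷ zs)) * 4 ^ N    ≡⟨ lem₁ T _ (4 ^ N) ⟩
            T * (4 ^ N * mass x (hit? (b ∷ zs)))  ≤⟨ *-monoʳ-≤ T (≤-trans (hit-mass (b ∷ zs)) (*-monoʳ-≤ 4 le)) ⟩
            T * (4 * τ)                           ≡⟨ lem₂ T τ ⟩
            4 * T * τ                             ≤⟨ light ⟩
            n * 4 ^ N                             ∎))
          where
          open ≤-Reasoning
          lem₁ : ∀ t m p → t * m * p ≡ t * (p * m)
          lem₁ = solve-∀
          lem₂ : ∀ t s → t * (4 * s) ≡ 4 * t * s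
          lem₂ = solve-∀

    outcome : Outcome
    outcome with any? (λ b → B? b ×-dec any? (λ a → A? a ×-dec conn? (edge? G) b a))
    ... | yes (b , Bb , a , Aa , zs , p) = connected-case Bb (zs , a , mapTrail inj₂ p , Aa , ≤-refl)
    ... | no none = inj₁ (⟦ never ⟧ , (λ P Aa Bb → contradiction
              (_ , Bb , _ , Aa , conn-sym (edge-sym G) (_ , Cut.trailOf (Path.linked P))) none) ,
            λ I (I⊆ , _) → let f , inj , mem = enumerate I in
              ≤-trans (inj-length f inj [] (λ i → ⊥-elim (∈⟦⟧⁻ never (I⊆ (mem i))))) z≤n)
      where
      never : DecPred {n} (λ _ → ⊥)
      never _ = no λ ()

-- Multiplicative weights over the rounds

module Routing {n : ℕ} (G : Graph n) {A B : Fin n → Set} (A? : DecPred A) (B? : DecPred B)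
  (l : ℕ) (1≤l : 1 ≤ l) (l<2n : l < 2 * n) (2^≤ : 2 ^ l ≤ 2 * n) (2n<2^ : 2 * n < 2 ^ suc l) (T : ℕ) (0<T : 0 < T) where

  open Strands G A? B?

  hits : List (List (Fin n)) → Fin n → ℕ
  hits []       v = 0
  hits (L ∷ Ls) v = 𝟙 (hit? L v) + hits Ls v

  weight : List (List (Fin n)) → Fin n → ℕ
  weight Ls v = 2 ^ hits Ls v

  weight-∷ : ∀ L Ls → ∑ (weight (L ∷ Ls)) ≡ ∑ (weight Ls) + mass (weight Ls) (hit? L)
  weight-∷ L Ls = trans (∑-cong (λ v → double (hit? L v) (hits Ls v))) (∑-+ _ _)
    where
    double : ∀ {P : Set} (d : Dec P) h → 2 ^ (𝟙 d + h) ≡ 2 ^ h + 𝟙 d * 2 ^ h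
    double (yes _) h = refl
    double (no _)  h = sym (+-identityʳ (2 ^ h))

  -- The total weight starts at n and grows by at most n / `T` per round; `invariant` says so
  -- without denominators. After `T` rounds it is at most 2n.
  record Bundle (i : ℕ) : Set where
    field
      strands   : List (List (Fin n))
      size      : length strands ≡ i
      good      : All Strand strands
      invariant : T * ∑ (weight strands) ≤ T * n + i * n

    light : i ≤ T → ∑ (weight strands) ≤ 2 * n
    light i≤ = *-cancelˡ-≤ T {{ℕ.>-nonZero 0<T}} (≤-trans invariant
      (≤-trans (+-monoʳ-≤ (T * n) (*-monoˡ-≤ n i≤)) (≤-reflexive (lem T n))))
      where
      lem : ∀ t n → t * n + t * n ≡ t * (2 * n)
      lem = solve-∀

  bundles : ∀ i → i ≤ T → NiceCut (cutBound l T) ⊎ Bundle i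
  bundles zero _ = inj₂ record
    { strands = [] ; size = refl ; good = []
    ; invariant = ≤-reflexive (trans (cong (T *_) ∑-one) (sym (+-identityʳ (T * n)))) }
  bundles (suc i) i< with bundles i (<⇒≤ i<)
  ... | inj₁ cut = inj₁ cut
  ... | inj₂ β = next (Round.outcome l 1≤l l<2n 2^≤ 2n<2^ (weight strands) (λ v → m^n>0 2 (hits strands v)) (light (<⇒≤ i<)) T)
    where
    open Bundle β
    next : NiceCut (cutBound l T) ⊎ (Σ (List (Fin n)) λ L → Strand L × T * mass (weight strands) (hit? L) ≤ n) →
           NiceCut (cutBound l T) ⊎ Bundle (suc i)
    next (inj₁ cut) = inj₁ cut
    next (inj₂ (L , st , le)) = inj₂ record
      { strands = L ∷ strands ; size = cong suc size ; good = st ∷ good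
      ; invariant = ≤-trans (≤-reflexive (trans (cong (T *_) (weight-∷ L strands)) (*-distribˡ-+ T _ _)))
          (≤-trans (+-mono-≤ invariant le) (≤-reflexive (lem (T * n) i n))) }
      where
      lem : ∀ a i n → a + i * n + n ≡ a + suc i * n
      lem = solve-∀

  module Bundled (β : Bundle T) where
    open Bundle β

    -- A single weight, 2 to the number of hits, is at most the total 2n < 2 ^ (`l` + 1).
    hits≤ : ∀ v → hits strands v ≤ l
    hits≤ v = ≮⇒≥ λ l< → <⇒≱ 2n<2^ (≤-trans (^-monoʳ-≤ 2 l<) (≤-trans (term≤∑ (weight strands) v) (light ≤-refl)))

    U : Fin n → Set
    U v = Any (v ∈_) strands

    U? : DecPred U
    U? v = Any.any? (v ∈?_) strands

    nb : Fin n → List (Fin n)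
    nb v = concatMap (filter (closed? v)) strands

    private
      empty : ∀ v L → ¬ Hit L v → length (filter (closed? v) L) ≡ 0
      empty v []      ¬h = refl
      empty v (z ∷ L) ¬h = trans (cong length (filter-reject (closed? v) {x = z} {xs = L} (¬h ∘ here))) (empty v L (¬h ∘ there))

      nb-count : ∀ v {Ls} → All Strand Ls → length (concatMap (filter (closed? v)) Ls) ≤ 6 * hits Ls v
      nb-count v [] = z≤n
      nb-count v {L ∷ Ls} (st ∷ sts) = ≤-trans (≤-reflexive (length-++ (filter (closed? v) L)))
        (≤-trans (+-mono-≤ (one (hit? L v)) (nb-count v sts)) (≤-reflexive (sym (*-distribˡ-+ 6 (𝟙 (hit? L v)) _))))
        where
        one : (d : Dec (Hit L v)) → length (filter (closed? v) L) ≤ 6 * 𝟙 d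
        one (yes _) = Strand.sparse st v
        one (no ¬h) = ≤-reflexive (empty v L ¬h)

    nb-length : ∀ v → length (nb v) ≤ 6 * l
    nb-length v = ≤-trans (nb-count v good) (*-monoʳ-≤ 6 (hits≤ v))

    nb-member : ∀ {v z} → U z → Closed v z → z ∈ nb v
    nb-member {v} Uz c = let L , L∈ , z∈ = find Uz in ∈-concatMap (filter (closed? v)) L∈ (∈-filter⁺ (closed? v) z∈ c)

    private
      hits-total : ∀ Ls Z → All (λ L → Any (_∈ L) Z) Ls → length Ls ≤ sumOver (hits Ls) Z
      hits-total []       Z _          = z≤n
      hits-total (L ∷ Ls) Z (a ∷ as) = ≤-trans (+-mono-≤ (once Z a) (hits-total Ls Z as)) (≤-reflexive (sym (distrib Z)))
        where
        once : ∀ Z → Any (_∈ L) Z → 1 ≤ sumOver (λ z → 𝟙 (hit? L z)) Z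
        once (z ∷ Z) (here z∈) = ≤-trans (sure (hit? L z)) (m≤m+n _ _)
          where
          sure : (d : Dec (Hit L z)) → 1 ≤ 𝟙 d
          sure (yes _) = ≤-refl
          sure (no ¬h) = contradiction (lose z∈ (inj₁ refl)) ¬h
        once (z ∷ Z) (there a) = ≤-trans (once Z a) (m≤n+m _ _)
        distrib : ∀ Z → sumOver (hits (L ∷ Ls)) Z ≡ sumOver (λ z → 𝟙 (hit? L z)) Z + sumOver (hits Ls) Z
        distrib []      = refl
        distrib (z ∷ Z) = trans (cong (hits (L ∷ Ls) z +_) (distrib Z))
                                (lem (𝟙 (hit? L z)) (hits Ls z) (sumOver (λ z → 𝟙 (hit? L z)) Z) (sumOver (hits Ls) Z))
          where
          lem : ∀ a b c d → a + b + (c + d) ≡ a + c + (b + d)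
          lem = solve-∀

      hits-sum : ∀ Z → sumOver (hits strands) Z ≤ length Z * l
      hits-sum []      = z≤n
      hits-sum (z ∷ Z) = +-mono-≤ (hits≤ z) (hits-sum Z)

    open Reroute G A? B? using (Robust; Avoiding)

    -- Each vertex lies on at most `l` of the `T` strands, so fewer than `K` vertices leave some
    -- strand untouched.
    robust : ∀ K → K * l ≤ T → Robust K U
    robust K K≤ Z lZ with Any.any? (λ L → ¬? (Any.any? (_∈? L) Z)) strands
    ... | yes free = trailIn (find free)
      where
      trailIn : (Σ (List (Fin n)) λ L → L ∈ strands × ¬ Any (_∈ L) Z) → Avoiding U Z
      trailIn (L , L∈ , avoid) = source , proj₁ connects , target , source∈A , target∈B , mapTrail proj₁ (proj₂ connects) ,
          λ v∈ → lose L∈ (inside source∈ (proj₂ connects) v∈) , λ v∈Z → avoid (lose v∈Z (inside source∈ (proj₂ connects) v∈))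
        where
        open Strand (All.lookup good L∈)
        inside : ∀ {u zs w v} → u ∈ L → Trail (Edge G ↾ (_∈ L)) u zs w → v ∈ u ∷ zs → v ∈ L
        inside m p (here refl) = m
        inside m ((_ , _ , m′) ▸ p) (there k) = inside m′ p k
    ... | no none = contradiction (≤-trans (≤-reflexive (sym size)) (≤-trans
            (hits-total strands Z (All.map (λ {L} ¬¬a → decidable-stable (Any.any? (_∈? L) Z) ¬¬a) (Allₚ.¬Any⇒All¬ strands none)))
            (hits-sum Z)))
          (<⇒≱ (≤-trans (*-monoˡ-< l {{ℕ.>-nonZero 1≤l}} lZ) K≤))

-- Choice of parameters

logarithm : ∀ m → 1 ≤ m → Σ ℕ λ l → 2 ^ l ≤ m × m < 2 ^ suc l
logarithm (suc zero)    _ = 0 , ≤-refl , ≤-refl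
logarithm (suc (suc m)) _ with logarithm (suc m) (s≤s z≤n)
... | l , lo , hi with suc (suc m) ℕ.<? 2 ^ suc l
...   | yes p = l , m≤n⇒m≤1+n lo , p
...   | no ≮  = suc l , ≮⇒≥ ≮ , ≤-trans (s≤s hi) (m<m*2 (2 ^ suc l) (m^n>0 2 (suc l)))
  where
  m<m*2 : ∀ p → 0 < p → p < 2 * p
  m<m*2 p 0<p = ≤-trans (+-monoˡ-≤ p 0<p) (≤-reflexive (cong (p +_) (sym (+-identityʳ p))))

n<2^n : ∀ k → k < 2 ^ k
n<2^n zero    = s≤s z≤n
n<2^n (suc k) = ≤-trans (+-mono-≤ (m^n>0 2 k) (n<2^n k)) (≤-reflexive (cong (2 ^ k +_) (sym (+-identityʳ (2 ^ k)))))

module Dichotomy {n : ℕ} (G : Graph n) {q : ℕ} (minor-free : ¬ InducedMinor (Ktt (suc q)) G)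
  {A B : Fin n → Set} (A? : DecPred A) (B? : DecPred B)
  (l : ℕ) (1≤l : 1 ≤ l) (2^≤ : 2 ^ l ≤ 2 * n) (2n<2^ : 2 * n < 2 ^ suc l) (k : ℕ) (1≤k : 1 ≤ k) where

  open Strands G A? B? using (NiceCut)
  open Reroute G A? B? using (AnticompletePaths)

  -- `clusters` is the loss over all 2 ^ t passes with neighbour lists of length 6 `l`. The last
  -- factor `l` in `demand`, the number of rounds, is the loss in `Bundled.robust`.
  D clusters demand : ℕ
  D = suc (Λ (suc q) + Λ (suc q))
  clusters = (suc q * (6 * l) ^ D) ^ (2 ^ suc q)
  demand = k * clusters * l

  demand>0 : 0 < demand
  demand>0 = *-mono-≤ {1} {k * clusters} (*-mono-≤ {1} {k} 1≤k (m^n>0 (suc q * (6 * l) ^ D) {{ℕ.>-nonZero cluster>0}} (2 ^ suc q))) 1≤l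
    where
    cluster>0 : 0 < suc q * (6 * l) ^ D
    cluster>0 = *-mono-≤ {1} {suc q} (s≤s z≤n) (m^n>0 (6 * l) {{ℕ.>-nonZero (*-mono-≤ {1} {6} (s≤s z≤n) 1≤l)}} D)

  open Routing G A? B? l 1≤l (≤-trans (n<2^n l) 2^≤) 2^≤ 2n<2^ demand demand>0

  dichotomy : NiceCut (cutBound l demand) ⊎ AnticompletePaths k
  dichotomy with bundles demand ≤-refl
  ... | inj₁ cut = inj₁ cut
  ... | inj₂ β = inj₂ (reroute G A? B? U? minor-free nb (6 * l) nb-length
        (λ Uv → nb-member Uv (inj₁ refl)) (λ (e , _ , Uz) → nb-member Uz (inj₂ e)) (*-mono-≤ {1} {6} (s≤s z≤n) 1≤l)
        k (robust (k * clusters) ≤-refl))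
    where open Bundled β

-- The polylogarithmic bound

^-distribʳ-* : ∀ m a b → (a * b) ^ m ≡ a ^ m * b ^ m
^-distribʳ-* zero    a b = refl
^-distribʳ-* (suc m) a b = trans (cong (a * b *_) (^-distribʳ-* m a b)) (lem a b (a ^ m) (b ^ m))
  where
  lem : ∀ a b c d → a * b * (c * d) ≡ a * c * (b * d)
  lem = solve-∀

cutBound-monomial : ∀ l k t D m → cutBound l (k * (t * (6 * l) ^ D) ^ m * l) ≡ k * (96 * (t * 6 ^ D) ^ m) * l ^ (2 + D * m)
cutBound-monomial l k t D m = trans (cutBound-def l _) (trans (cong (λ c → 96 * l * (k * c * l)) power) (lem l k ((t * 6 ^ D) ^ m) (l ^ (D * m))))
  where
  power : (t * (6 * l) ^ D) ^ m ≡ (t * 6 ^ D) ^ m * l ^ (D * m)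
  power = trans (cong (_^ m) (trans (cong (t *_) (^-distribʳ-* D 6 l)) (sym (*-assoc t _ _))))
            (trans (^-distribʳ-* m (t * 6 ^ D) (l ^ D)) (cong ((t * 6 ^ D) ^ m *_) (^-*-assoc l D m)))
  lem : ∀ l k c z → 96 * l * (k * (c * z) * l) ≡ k * (96 * c) * (l * (l * z))
  lem = solve-∀

module _ (n l k C e α : ℕ) (1≤l : 1 ≤ l) (2^≤ : 2 ^ l ≤ 2 * n) (α≤ : α ≤ k * C * l ^ e) where

  private
    -- Large enough for two purposes: `C` < 2 ^ `C` ≤ 12 ^ `μ` absorbs the constant, and `e` ≤ 2 `μ`
    -- + 3 absorbs the power of the logarithm.
    μ : ℕ
    μ = e + C

    e≤ : e ≤ 2 * μ + 3
    e≤ = ≤-trans (m≤m+n e C) (≤-trans (m≤m+n μ (μ + 0)) (m≤m+n (2 * μ) 3))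

    C≤ : C ≤ 12 ^ μ
    C≤ = ≤-trans (<⇒≤ (n<2^n C)) (≤-trans (^-monoˡ-≤ C (m≤m+n 2 10)) (^-monoʳ-≤ 12 (m≤n+m C e)))

  polylog-bound : BoundedBy n k 0 μ α
  polylog-bound p q 1≤q log< = begin
      α * q ^ (2 * μ + 3)                          ≤⟨ *-monoˡ-≤ (q ^ (2 * μ + 3)) α≤ ⟩
      k * C * l ^ e * q ^ (2 * μ + 3)              ≤⟨ *-monoˡ-≤ (q ^ (2 * μ + 3)) (*-monoʳ-≤ (k * C) (^-monoʳ-≤ l {{ℕ.>-nonZero 1≤l}} e≤)) ⟩
      k * C * l ^ (2 * μ + 3) * q ^ (2 * μ + 3)    ≡⟨ *-assoc (k * C) _ _ ⟩
      k * C * (l ^ (2 * μ + 3) * q ^ (2 * μ + 3))  ≡⟨ cong (k * C *_) (sym (^-distribʳ-* (2 * μ + 3) l q)) ⟩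
      k * C * (l * q) ^ (2 * μ + 3)                ≤⟨ *-mono-≤ (*-monoʳ-≤ k C≤) (^-monoˡ-≤ (2 * μ + 3) lq≤p) ⟩
      k * 12 ^ μ * p ^ (2 * μ + 3)                 ≡⟨ cong (k * 12 ^ μ *_) (^-distribˡ-+-* p (2 * μ) 3) ⟩
      k * 12 ^ μ * (p ^ (2 * μ) * p ^ 3)           ≡⟨ cong (λ z → k * 12 ^ μ * (z * p ^ 3)) (sym (^-*-assoc p 2 μ)) ⟩
      k * 12 ^ μ * ((p ^ 2) ^ μ * p ^ 3)           ≡⟨ regroup k (12 ^ μ) ((p ^ 2) ^ μ) (p ^ 3) ⟩
      k * (12 ^ μ * (p ^ 2) ^ μ) * p ^ 3           ≡⟨ cong (λ z → k * z * p ^ 3) (sym (^-distribʳ-* μ 12 (p ^ 2))) ⟩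
      k * (12 * p ^ 2) ^ μ * p ^ 3                 ≤⟨ *-monoˡ-≤ (p ^ 3) (enlarge 50 ((2 * μ + 1) ^ (4 * μ ^ 2 + 1)) (s≤s z≤n)
                                                       (m^n>0 (2 * μ + 1) {{ℕ.>-nonZero (m≤n+m 1 (2 * μ))}} (4 * μ ^ 2 + 1))
                                                       (^-monoˡ-≤ μ (m≤m+n (12 * p ^ 2) ((4 * 0 + 1) * q ^ 2)))) ⟩
      50 * k * (12 * p ^ 2 + (4 * 0 + 1) * q ^ 2) ^ μ * (2 * μ + 1) ^ (4 * μ ^ 2 + 1) * p ^ 3  ∎
    where
    open ≤-Reasoning
    regroup : ∀ a b c d → a * b * (c * d) ≡ a * (b * c) * d
    regroup = solve-∀
    enlarge : ∀ c r {a b} → 1 ≤ c → 1 ≤ r → a ≤ b → k * a ≤ c * k * b * r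
    enlarge c r {a} {b} 1≤c 1≤r a≤b = ≤-trans (≤-trans (≤-reflexive (sym (*-identityʳ (k * a))))
      (*-mono-≤ {k * a} {c * k * b} (*-mono-≤ {k} {c * k} (≤-trans (≤-reflexive (sym (*-identityˡ k))) (*-monoˡ-≤ k 1≤c)) a≤b) 1≤r)) ≤-refl
    -- The integer `l` lies below the logarithm of 2n and hence below every rational p / q above it.
    lq≤p : l * q ≤ p
    lq≤p = ≮⇒≥ λ p< → <⇒≱ log< (≤-trans (^-monoʳ-≤ 2 (<⇒≤ p<)) (≤-trans (≤-reflexive (sym (^-*-assoc 2 l q))) (^-monoˡ-≤ q 2^≤)))

theorem1p3 : (t : ℕ) → 1 ≤ t →
    Σ ℕ λ d → Σ ℕ λ μ →
    ∀ (n : ℕ) (G : Graph n) → ¬ InducedMinor (Ktt t) G →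
    ∀ (A B : Subset n) (k : ℕ) → 1 ≤ k →
    (Σ (Subset n) λ S → Separator G A B S × IndepNumberBounded G k d μ S)
    ⊎
    (Σ (Fin k → Path G) λ P →
    (∀ i → ABPath G A B (P i)) ×
    (∀ i j → i ≢ j → Anticomplete (P i) (P j)))
-- `μ` is the exponent plus the constant from `cutBound-monomial`; both depend on t alone, and `d` =
-- 0 already leaves 12 log² in the base of the power.
theorem1p3 (suc q) _ = 0 , 2 + D * 2 ^ t + 96 * (t * 6 ^ D) ^ 2 ^ t , main
  where
  t = suc q
  D = suc (Λ t + Λ t)
  main : ∀ (n : ℕ) (G : Graph n) → ¬ InducedMinor (Ktt t) G → ∀ (A B : Subset n) (k : ℕ) → 1 ≤ k →
    (Σ (Subset n) λ S → Separator G A B S × IndepNumberBounded G k 0 (2 + D * 2 ^ t + 96 * (t * 6 ^ D) ^ 2 ^ t) S)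
    ⊎
    (Σ (Fin k → Path G) λ P → (∀ i → ABPath G A B (P i)) × (∀ i j → i ≢ j → Anticomplete (P i) (P j)))
  main zero G minor-free A B k 1≤k = inj₁ (A , (λ P → case start P of λ ()) , λ { Vec.[] _ p q _ _ → z≤n })
  main (suc n) G minor-free A B k 1≤k = fromLog (logarithm (2 * suc n) (s≤s z≤n))
    where
    fromLog : (Σ ℕ λ l → 2 ^ l ≤ 2 * suc n × 2 * suc n < 2 ^ suc l) → _
    fromLog (l , lo , hi) = conclude (Dichotomy.dichotomy G minor-free (Subₚ._∈? A) (Subₚ._∈? B) l 1≤l lo hi k 1≤k)
      where
      1≤l : 1 ≤ l
      -- A nonempty graph has 2n ≥ 2, so its logarithm is at least 1; the empty graph was treated
      -- before.
      1≤l = n≢0⇒n>0 λ { refl → <⇒≱ hi (*-monoʳ-≤ 2 {1} {suc n} (s≤s z≤n)) }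
      conclude : _ ⊎ _ → _
      conclude (inj₂ paths) = inj₂ paths
      conclude (inj₁ (S , sep , small)) = inj₁ (S , (λ P (a , b) → sep P a b) , λ I indep →
        polylog-bound (suc n) l k (96 * (t * 6 ^ D) ^ 2 ^ t) (2 + D * 2 ^ t) Sub.∣ I ∣ 1≤l lo
          (≤-trans (small I indep) (≤-reflexive (cutBound-monomial l k t D (2 ^ t)))))
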